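{- Let $P$ be a poset with $n$ elements. Then \[ K_P(\mathbf{x})=\sum_{f\in\mathcal{O}^\ast(P)}\frac{\Psi_{\alpha(f)}(\mathbf{x})}{z_{\alpha(f)}}=\sum_{\alpha\vDash n}\frac{\Psi_\alpha(\mathbf{x})}{z_\alpha}\,|\mathcal{O}^\ast_\alpha(P)|. \]
   Context: $\mathcal{O}(P)$ is the set of order-preserving surjections $f:P\to[k]$ (i.e. $x\le_Py\Rightarrow f(x)\le f(y)$) for some $k\in\mathbb N$. The type of such $f$ is the composition $\alpha(f)=(|f^{ -1}(1)|,\dots,|f^{ -1}(k)|)$ of $n$. $\mathcal{O}^\ast(P)$ is the set of $f\in\mathcal O(P)$ such that each fiber $f^{ -1}(i)$, with the induced order, has a unique minimal element; $\mathcal{O}^\ast_\alpha(P)$ is the set of those of type $\alpha$. $K_P(\mathbf{x})=\sum_f\prod_{x\in P}\mathbf{x}_{f(x)}$ over all maps $f:P\to\mathbb{N}^+$ with $x<_Py\Rightarrow f(x)\le f(y)$. For a composition $\alpha=(\alpha_1,\dots,\alpha_\ell)\vDash n$: blocks $B_i(\alpha)=\{\alpha_1+\dots+\alpha_{i-1}+1,\dots,\alpha_1+\dots+\alpha_i\}$, $S_\alpha=\{\alpha_1,\dots,\alpha_1+\dots+\alpha_{\ell-1}\}$, and $\alpha\le\beta$ iff $S_\beta\subseteq S_\alpha$. $\mathrm{M}_\alpha=\sum_{i_1<\dots<i_\ell}\mathbf{x}_{i_1}^{\alpha_1}\cdots\mathbf{x}_{i_\ell}^{\alpha_\ell}$;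 $z_\alpha=\prod_i i^{m_i}m_i!$ ($m_i$ = number of parts equal to $i$); $\pi(\gamma)=\prod_i(\gamma_1+\dots+\gamma_i)$; for $\alpha\le\beta$, $\pi(\alpha,\beta)=\prod_{i=1}^{\ell(\beta)}\pi(\alpha^{(i)})$ where $\alpha^{(i)}$ consists of the parts $\alpha_j$ with $B_j(\alpha)\subseteq B_i(\beta)$; $\Psi_\alpha=z_\alpha\sum_{\beta\ge\alpha}\mathrm{M}_\beta/\pi(\alpha,\beta)$. -}

module Defs where

open import Level using (0ℓ)
open import Data.Bool using (Bool; true; false; if_then_else_)
open import Data.Nat as ℕ using (ℕ; zero; suc; _<_; _≤_; _≤?_; _^_)
open import Data.Nat.ListAction using (sum; product)
import Data.Nat.Properties as ℕP
open import Data.Fin as Fin using (Fin; toℕ)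
open import Data.Fin.Properties as FinP using (all?; any?)
open import Data.Vec as Vec using (Vec; []; _∷_; lookup)
open import Data.List as List using (List; []; _∷_; map; concatMap; filter; length; allFin; upTo)
import Data.List.Properties as ListP
open import Data.List.Relation.Unary.All as All using (All)
open import Data.List.Membership.DecPropositional ℕ._≟_ using (_∈?_; _∈_)
open import Data.Product using (Σ; _×_; _,_; proj₁; proj₂)
open import Data.Integer using (+_)
open import Data.Rational as ℚ using (ℚ; 0ℚ; 1ℚ)
open import Relation.Binary using (Rel; IsPartialOrder; Decidable)
open import Relation.Binary.PropositionalEquality using (_≡_)
open import Relation.Nullary using (¬_; Dec; does)
open import Relation.Nullary.Decidable using (_×-dec_; _→-dec_; ¬?; ⌊_⌋)

record FinPoset (n : ℕ) : Set₁ where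
  field
    _≤P_      : Rel (Fin n) 0ℓ
    isPartialOrder : IsPartialOrder _≡_ _≤P_
    _≤P?_     : Decidable _≤P_

  _<P_ : Rel (Fin n) 0ℓ
  x <P y = (x ≤P y) × ¬ (x ≡ y)

  _<P?_ : Decidable _<P_
  x <P? y = (x ≤P? y) ×-dec ¬? (x Fin.≟ y)

allVec : (k n : ℕ) → List (Vec (Fin k) n)
allVec k zero    = [] ∷ []
allVec k (suc n) = concatMap (λ i → map (i ∷_) (allVec k n)) (allFin k)

allListsUpTo : (m n : ℕ) → List (List ℕ)
allListsUpTo m n =
  concatMap (λ l → map (λ v → Vec.toList (Vec.map toℕ v)) (allVec m l)) (upTo (suc n))

countFin : ∀ {n} {P : Fin n → Set} → ((x : Fin n) → Dec (P x)) → ℕ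
countFin P? = length (filter P? (allFin _))

ΣL : ∀ {A : Set} → List A → (A → ℚ) → ℚ
ΣL xs f = List.foldr (λ x acc → f x ℚ.+ acc) 0ℚ (xs)

ℕtoℚ : ℕ → ℚ
ℕtoℚ m = (+ m) ℚ./ 1

-- 1 / d as a rational (junk value 0 when d = 0; never used at d = 0 below)
inv : ℕ → ℚ
inv zero    = 0ℚ
inv (suc d) = (+ 1) ℚ./ (suc d)

-- A monomial x_1^{a_1}...x_m^{a_m}
-- is represented by its exponent list (a_1,...,a_m); lists that differ by
-- trailing zeros represent the same monomial (all series below are
-- invariant under this).

Monomial : Set
Monomial = List ℕ

Series : Set
Series = Monomial → ℚ

_≈ₛ_ : Series → Series → Set
F ≈ₛ G = ∀ (a : Monomial) → F a ≡ G a

_⊕_ : Series → Series → Series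
(F ⊕ G) a = F a ℚ.+ G a

_⊙_ : ℚ → Series → Series
(c ⊙ F) a = c ℚ.* F a

0ₛ : Series
0ₛ a = 0ℚ

Σₛ : ∀ {A : Set} → List A → (A → Series) → Series
Σₛ xs F = List.foldr (λ x acc → F x ⊕ acc) 0ₛ xs

_⊨_ : List ℕ → ℕ → Set
α ⊨ n = All (λ p → 0 < p) α × sum α ≡ n

_⊨?_ : (α : List ℕ) (n : ℕ) → Dec (α ⊨ n)
α ⊨? n = All.all? (λ p → 0 ℕ.<? p) α ×-dec (sum α ℕ.≟ n)

compositions : ℕ → List (List ℕ)
compositions n = filter (λ α → α ⊨? n) (allListsUpTo (suc n) n)

partialSums : List ℕ → List ℕ
partialSums = go 0
  where
  go : ℕ → List ℕ → List ℕ
  go s []       = []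
  go s (p ∷ ps) = (s ℕ.+ p) ∷ go (s ℕ.+ p) ps

S : List ℕ → List ℕ
S α = List.take (length α ℕ.∸ 1) (partialSums α)

_≼_ : List ℕ → List ℕ → Set
α ≼ β = All (λ s → s ∈ S α) (S β)

_≼?_ : (α β : List ℕ) → Dec (α ≼ β)
α ≼? β = All.all? (λ s → s ∈? S α) (S β)

-- blocks B_i(α) = {lo+1, ..., hi}, encoded as (lo , hi), paired with α_i
blocks : List ℕ → List (ℕ × ℕ)
blocks = go 0
  where
  go : ℕ → List ℕ → List (ℕ × ℕ)
  go s []       = []
  go s (p ∷ ps) = (s , s ℕ.+ p) ∷ go (s ℕ.+ p) ps

_⊆B?_ : (B B' : ℕ × ℕ) → Dec ((proj₁ B' ≤ proj₁ B) × (proj₂ B ≤ proj₂ B'))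
(lo , hi) ⊆B? (lo' , hi') = (lo' ≤? lo) ×-dec (hi ≤? hi')

πc : List ℕ → ℕ
πc γ = product (partialSums γ)

subcomp : List ℕ → (ℕ × ℕ) → List ℕ
subcomp α Bβ =
  map proj₁ (filter (λ pB → proj₂ pB ⊆B? Bβ) (List.zip α (blocks α)))

π2 : List ℕ → List ℕ → ℕ
π2 α β = product (map (λ Bβ → πc (subcomp α Bβ)) (blocks β))

mult : ℕ → List ℕ → ℕ
mult i α = length (filter (λ p → p ℕ.≟ i) α)

-- z_α = ∏_i i^{m_i} m_i!   (i ranging over 1..|α|, which covers all parts)
z : List ℕ → ℕ
z α = product
  (map (λ j → let i = suc j in (i ^ mult i α) ℕ.* ((mult i α) ℕ.!)) (upTo (sum α)))

nonzeroParts : Monomial → List ℕ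
nonzeroParts = filter (λ p → ¬? (p ℕ.≟ 0))

M : List ℕ → Series
M β a = if ⌊ ListP.≡-dec ℕ._≟_ (nonzeroParts a) β ⌋ then 1ℚ else 0ℚ

Ψ : List ℕ → Series
Ψ α = ℕtoℚ (z α) ⊙
  Σₛ (filter (λ β → α ≼? β) (compositions (sum α)))
     (λ β → inv (π2 α β) ⊙ M β)

module _ {n : ℕ} (P : FinPoset n) where
  open FinPoset P

  fiberSize : ∀ {k} → Vec (Fin k) n → Fin k → ℕ
  fiberSize f i = countFin (λ x → lookup f x Fin.≟ i)

  -- K_P: coefficient of x^a is the number of maps f : P → ℕ⁺ with
  -- x <_P y ⇒ f(x) ≤ f(y) and |f⁻¹(i)| = a_i for all i (such f take
  -- values in {1..length a}, encoded as Fin (length a))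
  IsPPartition : ∀ {k} → Vec (Fin k) n → Set
  IsPPartition f = ∀ x y → x <P y → lookup f x Fin.≤ lookup f y

  IsPPartition? : ∀ {k} (f : Vec (Fin k) n) → Dec (IsPPartition f)
  IsPPartition? f = all? λ x → all? λ y → (x <P? y) →-dec (lookup f x Fin.≤? lookup f y)

  HasContent : (a : Monomial) → Vec (Fin (length a)) n → Set
  HasContent a f = ∀ i → fiberSize f i ≡ List.lookup a i

  HasContent? : (a : Monomial) (f : Vec (Fin (length a)) n) → Dec (HasContent a f)
  HasContent? a f = all? λ i → fiberSize f i ℕ.≟ List.lookup a i

  K : Series
  K a = ℕtoℚ (length (filter (λ f → IsPPartition? f ×-dec HasContent? a f)
                             (allVec (length a) n)))

  OrderPreserving : ∀ {k} → Vec (Fin k) n → Set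
  OrderPreserving f = ∀ x y → x ≤P y → lookup f x Fin.≤ lookup f y

  Surjective : ∀ {k} → Vec (Fin k) n → Set
  Surjective {k} f = ∀ (i : Fin k) → Σ (Fin n) λ x → lookup f x ≡ i

  MinimalInFiber : ∀ {k} → Vec (Fin k) n → Fin k → Fin n → Set
  MinimalInFiber f i m = (lookup f m ≡ i) × (∀ y → lookup f y ≡ i → ¬ (y <P m))

  MinimalInFiber? : ∀ {k} (f : Vec (Fin k) n) (i : Fin k) (m : Fin n) → Dec (MinimalInFiber f i m)
  MinimalInFiber? f i m =
    (lookup f m Fin.≟ i) ×-dec (all? λ y → (lookup f y Fin.≟ i) →-dec ¬? (y <P? m))

  UniqueMinFibers : ∀ {k} → Vec (Fin k) n → Set
  UniqueMinFibers {k} f = ∀ (i : Fin k) → countFin (MinimalInFiber? f i) ≡ 1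

  IsOStar : ∀ {k} → Vec (Fin k) n → Set
  IsOStar f = OrderPreserving f × Surjective f × UniqueMinFibers f

  IsOStar? : ∀ {k} (f : Vec (Fin k) n) → Dec (IsOStar f)
  IsOStar? f =
    (all? λ x → all? λ y → (x ≤P? y) →-dec (lookup f x Fin.≤? lookup f y))
    ×-dec ((all? λ i → any? λ x → lookup f x Fin.≟ i)
    ×-dec (all? λ i → countFin (MinimalInFiber? f i) ℕ.≟ 1))

  -- 𝒪*(P) as a list of pairs (k , f) with f : P → [k].  A surjection
  -- P → [k] forces k ≤ n, so k ranges over 0..n.
  OStar : List (Σ ℕ λ k → Vec (Fin k) n)
  OStar = concatMap (λ k → map (k ,_) (filter IsOStar? (allVec k n))) (upTo (suc n))

  type : (Σ ℕ λ k → Vec (Fin k) n) → List ℕ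
  type (k , f) = map (fiberSize f) (allFin k)

  OStarCount : List ℕ → ℕ
  OStarCount α = length (filter (λ kf → ListP.≡-dec ℕ._≟_ (type kf) α) OStar)

-- Both sides are compared coefficientwise.  For an exponent list a,
-- [x^a] K_P counts the P-partitions with content a, and
-- [x^a] Ψ_α / z_α = [β ⊨ |α|] [α ≤ β] / π(α,β) =: W(α, a), where β is the
-- list of nonzero entries of a (exactly one M_β contains x^a).
--
-- The heart of the proof is a peeling recursion on induced subposets
-- X ⊆ P (module Core).  A map on X is encoded as a labelling
-- g : P → {0,…,L} with label 0 exactly off X.  If the last entry of the
-- content c is b > 0, then
--  * b · #{P-partitions of X with content c}
--      = Σ_{x ∈ X, |↑x| ≤ b} #{P-partitions of X ∖ ↑x, last entry b - |↑x|},
--    pairing a P-partition with a point x of its last fibre, which then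
--    contains the up-set ↑x (taken inside X)   (`ppCount-peel`);
--  * the weighted count Σ_{g ∈ 𝒪*(X)} w(α(g), c) obeys the same recursion,
--    pairing g with the unique minimum x of its last fibre, which then IS
--    ↑x   (`oWeightUpTo-peel`); here w(α·u, c·b) = [u ≤ b] / b · w(α, c·(b-u)).
-- With the trivial base cases this gives equality of the two counts by
-- strong induction on |X| (`ppCount≡oWeightUpTo`).  Separately (modules
-- Weights, WeightLists), w(α, c) = W(α, c) (`weight≡W`), which reduces to the
-- behaviour of π(α,β) when last parts are appended.  Specialising to X = P
-- (module Final) and grouping 𝒪*(P) by type gives both forms of the theorem.
module Submission where

open import Defs
open import Data.Bool using (Bool; true; false; _∧_; not; if_then_else_)
import Data.Bool.Properties as BP
open import Data.Empty using (⊥; ⊥-elim)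
open import Data.Fin as Fin using (Fin; zero; suc)
import Data.Fin.Properties as FP
import Data.Integer as Z
import Data.Integer.Properties as ZP
open import Data.List as List
  using (List; []; _∷_; map; concatMap; _++_; _∷ʳ_; tabulate; allFin; foldr; zip; take; length; filter)
import Data.List.Properties as LP
open import Data.List.Relation.Unary.All as All using (All; []; _∷_)
import Data.List.Relation.Unary.All.Properties as AllP
open import Data.List.Relation.Unary.Any using (Any; here; there)
import Data.List.Relation.Unary.Any.Properties as AnyP
open import Data.Nat as ℕ using (ℕ; zero; suc)
open import Data.Nat.ListAction using (sum; product)
import Data.Nat.ListAction.Properties as LAP
import Data.Nat.Properties as NP
open import Data.Product using (Σ-syntax; _×_; _,_; proj₁; proj₂)
import Data.Rational as Q
import Data.Rational.Properties as QP
import Data.Rational.Unnormalised as Qᵘ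
import Data.Rational.Unnormalised.Properties as QᵘP
open import Data.Sum using (_⊎_; inj₁; inj₂)
open import Data.Vec as Vec using (Vec; []; _∷_; lookup)
import Data.Vec.Properties as VP
open import Algebra.Structures using (IsCommutativeSemiring; IsCommutativeRing)
open import Function using (mk⇔) renaming (_∘′_ to _∘_)
open import Relation.Binary using (IsPartialOrder; Tri; tri<; tri≈; tri>)
open import Relation.Binary.PropositionalEquality
open import Relation.Nullary using (¬_; Dec; yes; no; does)
open import Relation.Nullary.Decidable
  using (_×-dec_; _→-dec_; ¬?; ⌊_⌋; dec-true; dec-false; does-⇔; isYes≗does)

does-cong : ∀ {P Q : Set} → (P → Q) → (Q → P) → (p : Dec P) (q : Dec Q) → does p ≡ does q
does-cong f g = does-⇔ (mk⇔ f g)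

does-yes : ∀ {P : Set} → (p : Dec P) → does p ≡ true → P
does-yes (yes p) _ = p
does-yes (no _) ()

record ≡-CommutativeSemiring : Set₁ where
  infixl 6 _+_
  infixl 7 _*_
  field
    Carrier : Set
    _+_ _*_ : Carrier → Carrier → Carrier
    0# 1#   : Carrier
    isCommutativeSemiring : IsCommutativeSemiring _≡_ _+_ _*_ 0# 1#
  open IsCommutativeSemiring isCommutativeSemiring public
    using (+-assoc; +-comm; +-identityˡ; +-identityʳ; *-assoc; *-comm;
           *-identityˡ; *-identityʳ; zeroˡ; zeroʳ; distribˡ)

module Sums (R : ≡-CommutativeSemiring) where
  open ≡-CommutativeSemiring R public renaming (Carrier to A)
  open ≡-Reasoning

  +-interchange : ∀ a b c d → (a + b) + (c + d) ≡ (a + c) + (b + d)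
  +-interchange a b c d = begin
    (a + b) + (c + d) ≡⟨ +-assoc a b (c + d) ⟩
    a + (b + (c + d)) ≡⟨ cong (a +_) (sym (+-assoc b c d)) ⟩
    a + ((b + c) + d) ≡⟨ cong (λ t → a + (t + d)) (+-comm b c) ⟩
    a + ((c + b) + d) ≡⟨ cong (a +_) (+-assoc c b d) ⟩
    a + (c + (b + d)) ≡⟨ sym (+-assoc a c (b + d)) ⟩
    (a + c) + (b + d) ∎

  Σ : ∀ {X : Set} → List X → (X → A) → A
  Σ xs f = foldr (λ x acc → f x + acc) 0# xs

  ind : Bool → A
  ind true = 1#
  ind false = 0#

  ind-∧ : ∀ a b → ind (a ∧ b) ≡ ind a * ind b
  ind-∧ true b = sym (*-identityˡ (ind b))
  ind-∧ false b = sym (zeroˡ (ind b))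

  𝕀 : ∀ {P : Set} → Dec P → A
  𝕀 d = ind (does d)

  𝕀-cong : ∀ {P Q : Set} → (P → Q) → (Q → P) → (p : Dec P) (q : Dec Q) → 𝕀 p ≡ 𝕀 q
  𝕀-cong f g p q = cong ind (does-cong f g p q)

  𝕀-yes : ∀ {P : Set} → P → (p : Dec P) → 𝕀 p ≡ 1#
  𝕀-yes x p = cong ind (dec-true p x)

  𝕀-no : ∀ {P : Set} → ¬ P → (p : Dec P) → 𝕀 p ≡ 0#
  𝕀-no ¬x p = cong ind (dec-false p ¬x)

  condEq : ∀ {P Q : Set} (p : Dec P) (q : Dec Q) (a a' : A) → (P → Q) → (Q → P) → (P → a ≡ a') → 𝕀 p * a ≡ 𝕀 q * a'
  condEq (yes x) (yes y) a a' f g e = cong (1# *_) (e x)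
  condEq (yes x) (no ¬y) a a' f g e = ⊥-elim (¬y (f x))
  condEq (no ¬x) (yes y) a a' f g e = ⊥-elim (¬x (g y))
  condEq (no ¬x) (no ¬y) a a' f g e = trans (zeroˡ a) (sym (zeroˡ a'))

  𝕀-∧ : ∀ {P₁ P₂ : Set} (p : Dec P₁) (q : Dec P₂) x → 𝕀 p * (𝕀 q * x) ≡ 𝕀 (p ×-dec q) * x
  𝕀-∧ p q x = trans (sym (*-assoc (𝕀 p) (𝕀 q) x)) (cong (_* x) (sym (ind-∧ (does p) (does q))))

  *-𝕀-swap : ∀ {P : Set} a (p : Dec P) x → a * (𝕀 p * x) ≡ 𝕀 p * (a * x)
  *-𝕀-swap a p x = trans (sym (*-assoc a (𝕀 p) x)) (trans (cong (_* x) (*-comm a (𝕀 p))) (*-assoc (𝕀 p) a x))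

  𝕀-implied : ∀ {P Q : Set} (d : Dec P) (q : Dec Q) x → (P → Q) → 𝕀 d * (𝕀 q * x) ≡ 𝕀 d * x
  𝕀-implied (no _) q x f = trans (zeroˡ (𝕀 q * x)) (sym (zeroˡ x))
  𝕀-implied (yes a) q x f = cong (1# *_) (trans (cong (_* x) (𝕀-yes (f a) q)) (*-identityˡ x))

  𝕀-guard : ∀ {P : Set} (d : Dec P) (b : Bool) → (P → b ≡ true) → 𝕀 d ≡ ind b * 𝕀 d
  𝕀-guard (yes p) b h rewrite h p = sym (*-identityˡ _)
  𝕀-guard (no _) b h = sym (zeroʳ _)

  Σ-cong : ∀ {X : Set} (xs : List X) {f g : X → A} → (∀ x → f x ≡ g x) → Σ xs f ≡ Σ xs g
  Σ-cong [] eq = refl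
  Σ-cong (x ∷ xs) eq = cong₂ _+_ (eq x) (Σ-cong xs eq)

  Σ-++ : ∀ {X : Set} (xs ys : List X) f → Σ (xs ++ ys) f ≡ Σ xs f + Σ ys f
  Σ-++ [] ys f = sym (+-identityˡ _)
  Σ-++ (x ∷ xs) ys f = trans (cong (f x +_) (Σ-++ xs ys f)) (sym (+-assoc _ _ _))

  Σ-map : ∀ {X Y : Set} (h : X → Y) (xs : List X) f → Σ (map h xs) f ≡ Σ xs (f ∘ h)
  Σ-map h [] f = refl
  Σ-map h (x ∷ xs) f = cong (f (h x) +_) (Σ-map h xs f)

  Σ-concatMap : ∀ {X Y : Set} (h : X → List Y) (xs : List X) f →
    Σ (concatMap h xs) f ≡ Σ xs (λ x → Σ (h x) f)
  Σ-concatMap h [] f = refl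
  Σ-concatMap h (x ∷ xs) f = trans (Σ-++ (h x) (concatMap h xs) f) (cong (Σ (h x) f +_) (Σ-concatMap h xs f))

  Σ-filter : ∀ {X : Set} {P : X → Set} (p : ∀ x → Dec (P x)) xs (F : X → A) →
    Σ (filter p xs) F ≡ Σ xs (λ x → 𝕀 (p x) * F x)
  Σ-filter p [] F = refl
  Σ-filter p (x ∷ xs) F with does (p x)
  ... | true = cong₂ _+_ (sym (*-identityˡ (F x))) (Σ-filter p xs F)
  ... | false = trans (Σ-filter p xs F) (sym (trans (cong (_+ Σ xs (λ x → 𝕀 (p x) * F x)) (zeroˡ (F x))) (+-identityˡ _)))

  Σ-0 : ∀ {X : Set} (xs : List X) → Σ xs (λ _ → 0#) ≡ 0#
  Σ-0 [] = refl
  Σ-0 (x ∷ xs) = trans (+-identityˡ _) (Σ-0 xs)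

  Σ-+ : ∀ {X : Set} (xs : List X) f g → Σ xs (λ x → f x + g x) ≡ Σ xs f + Σ xs g
  Σ-+ [] f g = sym (+-identityˡ 0#)
  Σ-+ (x ∷ xs) f g = trans (cong (f x + g x +_) (Σ-+ xs f g)) (+-interchange _ _ _ _)

  Σ-*ˡ : ∀ {X : Set} (xs : List X) c f → c * Σ xs f ≡ Σ xs (λ x → c * f x)
  Σ-*ˡ [] c f = zeroʳ c
  Σ-*ˡ (x ∷ xs) c f = trans (distribˡ c _ _) (cong (c * f x +_) (Σ-*ˡ xs c f))

  Σ-*ʳ : ∀ {X : Set} (xs : List X) c f → Σ xs f * c ≡ Σ xs (λ x → f x * c)
  Σ-*ʳ xs c f = trans (*-comm _ c) (trans (Σ-*ˡ xs c f) (Σ-cong xs (λ x → *-comm c (f x))))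

  Σ-swap : ∀ {X Y : Set} (xs : List X) (ys : List Y) (f : X → Y → A) →
    Σ xs (λ x → Σ ys (λ y → f x y)) ≡ Σ ys (λ y → Σ xs (λ x → f x y))
  Σ-swap [] ys f = sym (Σ-0 ys)
  Σ-swap (x ∷ xs) ys f = trans (cong (Σ ys (f x) +_) (Σ-swap xs ys f)) (sym (Σ-+ ys (f x) _))

  Σ-applyUpTo-shift : ∀ (F : ℕ → A) N (f : ℕ → ℕ) →
    Σ (List.applyUpTo (λ i → suc (f i)) N) F ≡ Σ (List.applyUpTo f N) (λ k → F (suc k))
  Σ-applyUpTo-shift F zero f = refl
  Σ-applyUpTo-shift F (suc N) f = cong (F (suc (f 0)) +_) (Σ-applyUpTo-shift F N (λ i → f (suc i)))

  Σ-upTo-suc-0 : ∀ (F : ℕ → A) N → (∀ m → F (suc m) ≡ 0#) → Σ (List.applyUpTo suc N) F ≡ 0#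
  Σ-upTo-suc-0 F N h = trans (Σ-applyUpTo-shift F N (λ i → i)) (trans (Σ-cong (List.upTo N) h) (Σ-0 (List.upTo N)))

  ΣF : ∀ K → (Fin K → A) → A
  ΣF K f = Σ (allFin K) f

  Σ-tab : ∀ {X : Set} K (h : Fin K → X) f → Σ (tabulate h) f ≡ ΣF K (f ∘ h)
  Σ-tab zero h f = refl
  Σ-tab (suc K) h f = cong (f (h zero) +_) (trans (Σ-tab K (h ∘ Fin.suc) f) (sym (Σ-tab K Fin.suc (f ∘ h))))

  ΣF-suc : ∀ K f → ΣF (suc K) f ≡ f zero + ΣF K (f ∘ Fin.suc)
  ΣF-suc K f = cong (f zero +_) (Σ-tab K Fin.suc f)

  ΣF-cong : ∀ K {f g} → (∀ i → f i ≡ g i) → ΣF K f ≡ ΣF K g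
  ΣF-cong K = Σ-cong (allFin K)

  ΣF-last : ∀ K f → ΣF (suc K) f ≡ ΣF K (f ∘ Fin.inject₁) + f (Fin.fromℕ K)
  ΣF-last zero f = trans (+-identityʳ _) (sym (+-identityˡ _))
  ΣF-last (suc K) f = begin
    ΣF (suc (suc K)) f ≡⟨ ΣF-suc (suc K) f ⟩
    f zero + ΣF (suc K) (f ∘ Fin.suc) ≡⟨ cong (f zero +_) (ΣF-last K (f ∘ Fin.suc)) ⟩
    f zero + (ΣF K (f ∘ Fin.suc ∘ Fin.inject₁) + f (Fin.fromℕ (suc K))) ≡⟨ sym (+-assoc _ _ _) ⟩
    (f zero + ΣF K (f ∘ Fin.suc ∘ Fin.inject₁)) + f (Fin.fromℕ (suc K)) ≡⟨ cong (_+ f (Fin.fromℕ (suc K))) (sym (ΣF-suc K (f ∘ Fin.inject₁))) ⟩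
    ΣF (suc K) (f ∘ Fin.inject₁) + f (Fin.fromℕ (suc K)) ∎

  ΣF-δ : ∀ K (c : Fin K) f → ΣF K (λ i → 𝕀 (i Fin.≟ c) * f i) ≡ f c
  ΣF-δ (suc K) zero f = begin
    ΣF (suc K) (λ i → 𝕀 (i Fin.≟ zero) * f i) ≡⟨ ΣF-suc K _ ⟩
    1# * f zero + ΣF K (λ i → 0# * f (suc i)) ≡⟨ cong₂ _+_ (*-identityˡ _) (ΣF-cong K (λ i → zeroˡ _)) ⟩
    f zero + ΣF K (λ i → 0#) ≡⟨ cong (f zero +_) (Σ-0 (allFin K)) ⟩
    f zero + 0# ≡⟨ +-identityʳ _ ⟩
    f zero ∎
  ΣF-δ (suc K) (suc c) f = begin
    ΣF (suc K) (λ i → 𝕀 (i Fin.≟ suc c) * f i) ≡⟨ ΣF-suc K _ ⟩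
    0# * f zero + ΣF K (λ i → 𝕀 (suc i Fin.≟ suc c) * f (suc i)) ≡⟨ cong₂ _+_ (zeroˡ _) (ΣF-cong K (λ i → cong (λ b → b * f (suc i)) (lem i))) ⟩
    0# + ΣF K (λ i → 𝕀 (i Fin.≟ c) * f (suc i)) ≡⟨ +-identityˡ _ ⟩
    ΣF K (λ i → 𝕀 (i Fin.≟ c) * f (suc i)) ≡⟨ ΣF-δ K c (f ∘ Fin.suc) ⟩
    f (suc c) ∎
    where
    lem : ∀ i → 𝕀 (suc i Fin.≟ suc c) ≡ 𝕀 (i Fin.≟ c)
    lem i with i Fin.≟ c
    ... | yes _ = refl
    ... | no _ = refl

  ΣF-δ' : ∀ K (c : Fin K) f → ΣF K (λ i → 𝕀 (c Fin.≟ i) * f i) ≡ f c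
  ΣF-δ' K c f = trans (ΣF-cong K (λ i → cong (_* f i) (lem i))) (ΣF-δ K c f)
    where
    lem : ∀ i → 𝕀 (c Fin.≟ i) ≡ 𝕀 (i Fin.≟ c)
    lem i = 𝕀-cong sym sym (c Fin.≟ i) (i Fin.≟ c)

  ΣV : ∀ K n → (Vec (Fin K) n → A) → A
  ΣV K n G = Σ (allVec K n) G

  ΣV-cong : ∀ K n {f g} → (∀ v → f v ≡ g v) → ΣV K n f ≡ ΣV K n g
  ΣV-cong K n = Σ-cong (allVec K n)

  ΣV-suc : ∀ K n G → ΣV K (suc n) G ≡ ΣF K (λ i → ΣV K n (λ v → G (i ∷ v)))
  ΣV-suc K n G = trans (Σ-concatMap _ (allFin K) G) (ΣF-cong K (λ i → Σ-map (i ∷_) (allVec K n) G))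

  infix 4 _≟V_
  _≟V_ : ∀ {K n} (u v : Vec (Fin K) n) → Dec (u ≡ v)
  _≟V_ = VP.≡-dec Fin._≟_

  ΣV-δ : ∀ K n (w : Vec (Fin K) n) (G : Vec (Fin K) n → A) → ΣV K n (λ v → 𝕀 (w ≟V v) * G v) ≡ G w
  ΣV-δ K zero [] G = trans (+-identityʳ _) (*-identityˡ _)
  ΣV-δ K (suc n) (j ∷ w) G = begin
    ΣV K (suc n) (λ v → 𝕀 (j ∷ w ≟V v) * G v) ≡⟨ ΣV-suc K n _ ⟩
    ΣF K (λ i → ΣV K n (λ v → ind (does (j Fin.≟ i) ∧ does (w ≟V v)) * G (i ∷ v)))
      ≡⟨ ΣF-cong K (λ i → trans (ΣV-cong K n (λ v → trans (cong (_* G (i ∷ v)) (ind-∧ (does (j Fin.≟ i)) _)) (*-assoc _ _ _)))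
                                (sym (Σ-*ˡ (allVec K n) _ _))) ⟩
    ΣF K (λ i → 𝕀 (j Fin.≟ i) * ΣV K n (λ v → 𝕀 (w ≟V v) * G (i ∷ v))) ≡⟨ ΣF-δ' K j _ ⟩
    ΣV K n (λ v → 𝕀 (w ≟V v) * G (j ∷ v)) ≡⟨ ΣV-δ K n w (λ v → G (j ∷ v)) ⟩
    G (j ∷ w) ∎
    where open ≡-Reasoning

  ΣV-singleton : ∀ n (G : Vec (Fin 1) n → A) → ΣV 1 n G ≡ G (Vec.replicate n zero)
  ΣV-singleton zero G = +-identityʳ _
  ΣV-singleton (suc n) G = trans (ΣV-suc 1 n G) (trans (+-identityʳ _) (ΣV-singleton n (λ v → G (zero ∷ v))))

  fill : ∀ {K n} → (Fin n → Bool) → Fin K → Vec (Fin K) n → Vec (Fin K) n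
  fill S c g = Vec.tabulate (λ y → if S y then c else lookup g y)

  -- The maps with g = fill S c g correspond to those with g = fill S d g
  -- through g ↦ fill S c g; the head coordinate first, then all of them.
  ΣF-refill-head : ∀ K (b : Bool) (c d : Fin K) (F : Fin K → A) →
    ΣF K (λ i → 𝕀 ((if b then c else i) Fin.≟ i) * F i) ≡ ΣF K (λ i → 𝕀 ((if b then d else i) Fin.≟ i) * F (if b then c else i))
  ΣF-refill-head K true c d F = trans (ΣF-δ' K c F) (sym (ΣF-δ' K d (λ _ → F c)))
  ΣF-refill-head K false c d F = refl

  Σ-factor-ind : ∀ {X : Set} (xs : List X) (a : Bool) (h : X → Bool) (F : X → A) →
    Σ xs (λ v → ind (a ∧ h v) * F v) ≡ ind a * Σ xs (λ v → ind (h v) * F v)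
  Σ-factor-ind xs a h F = trans (Σ-cong xs (λ v → trans (cong (_* F v) (ind-∧ a (h v))) (*-assoc _ _ _))) (sym (Σ-*ˡ xs _ _))

  ΣV-refill : ∀ K n (S : Fin n → Bool) (c d : Fin K) (G : Vec (Fin K) n → A) →
    ΣV K n (λ g → 𝕀 (fill S c g ≟V g) * G g) ≡ ΣV K n (λ g → 𝕀 (fill S d g ≟V g) * G (fill S c g))
  ΣV-refill K zero S c d G = refl
  ΣV-refill K (suc n) S c d G = begin
    ΣV K (suc n) (λ g → 𝕀 (fill S c g ≟V g) * G g) ≡⟨ ΣV-suc K n (λ g → 𝕀 (fill S c g ≟V g) * G g) ⟩
    ΣF K (λ i → ΣV K n (λ v → ind (does (hc i Fin.≟ i) ∧ does (fill S' c v ≟V v)) * G (i ∷ v))) ≡⟨ ΣF-cong K (λ i → Σ-factor-ind (allVec K n) (does (hc i Fin.≟ i)) (λ v → does (fill S' c v ≟V v)) (λ v → G (i ∷ v))) ⟩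
    ΣF K (λ i → 𝕀 (hc i Fin.≟ i) * ΣV K n (λ v → 𝕀 (fill S' c v ≟V v) * G (i ∷ v))) ≡⟨ ΣF-cong K (λ i → cong (𝕀 (hc i Fin.≟ i) *_) (ΣV-refill K n S' c d (λ v → G (i ∷ v)))) ⟩
    ΣF K (λ i → 𝕀 (hc i Fin.≟ i) * ΣV K n (λ v → 𝕀 (fill S' d v ≟V v) * G (i ∷ fill S' c v))) ≡⟨ ΣF-refill-head K (S zero) c d _ ⟩
    ΣF K (λ i → 𝕀 (hd i Fin.≟ i) * ΣV K n (λ v → 𝕀 (fill S' d v ≟V v) * G (hc i ∷ fill S' c v))) ≡⟨ sym (ΣF-cong K (λ i → Σ-factor-ind (allVec K n) (does (hd i Fin.≟ i)) (λ v → does (fill S' d v ≟V v)) (λ v → G (hc i ∷ fill S' c v)))) ⟩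
    ΣF K (λ i → ΣV K n (λ v → ind (does (hd i Fin.≟ i) ∧ does (fill S' d v ≟V v)) * G (hc i ∷ fill S' c v))) ≡⟨ sym (ΣV-suc K n (λ g → 𝕀 (fill S d g ≟V g) * G (fill S c g))) ⟩
    ΣV K (suc n) (λ g → 𝕀 (fill S d g ≟V g) * G (fill S c g)) ∎
    where
    open ≡-Reasoning
    S' = λ y → S (suc y)
    hc = λ (i : Fin K) → if S zero then c else i
    hd = λ (i : Fin K) → if S zero then d else i

  avoids : ∀ {K n} → Fin K → Vec (Fin K) n → Bool
  avoids e [] = true
  avoids e (i ∷ v) = not (does (i Fin.≟ e)) ∧ avoids e v

  -- Maps avoiding e correspond to maps into the smaller codomain Fin K,
  -- embedded by ι, as soon as this holds for a single coordinate.
  ΣV-avoiding : ∀ K n (e : Fin (suc K)) (ι : Fin K → Fin (suc K)) →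
    (∀ (G : Fin (suc K) → A) → ΣF (suc K) (λ i → ind (not (does (i Fin.≟ e))) * G i) ≡ ΣF K (λ j → G (ι j))) →
    ∀ (G : Vec (Fin (suc K)) n → A) → ΣV (suc K) n (λ g → ind (avoids e g) * G g) ≡ ΣV K n (λ g → G (Vec.map ι g))
  ΣV-avoiding K zero e ι H G = trans (+-identityʳ _) (trans (*-identityˡ _) (sym (+-identityʳ _)))
  ΣV-avoiding K (suc n) e ι H G = begin
    ΣV (suc K) (suc n) (λ g → ind (avoids e g) * G g) ≡⟨ ΣV-suc (suc K) n _ ⟩
    ΣF (suc K) (λ i → ΣV (suc K) n (λ v → ind (not (does (i Fin.≟ e)) ∧ avoids e v) * G (i ∷ v)))
      ≡⟨ ΣF-cong (suc K) (λ i → trans (ΣV-cong (suc K) n (λ v → trans (cong (_* G (i ∷ v)) (ind-∧ (not (does (i Fin.≟ e))) _)) (*-assoc _ _ _))) (sym (Σ-*ˡ (allVec (suc K) n) _ _))) ⟩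
    ΣF (suc K) (λ i → ind (not (does (i Fin.≟ e))) * ΣV (suc K) n (λ v → ind (avoids e v) * G (i ∷ v)))
      ≡⟨ ΣF-cong (suc K) (λ i → cong (ind (not (does (i Fin.≟ e))) *_) (ΣV-avoiding K n e ι H (λ v → G (i ∷ v)))) ⟩
    ΣF (suc K) (λ i → ind (not (does (i Fin.≟ e))) * ΣV K n (λ v → G (i ∷ Vec.map ι v))) ≡⟨ H _ ⟩
    ΣF K (λ j → ΣV K n (λ v → G (ι j ∷ Vec.map ι v))) ≡⟨ sym (ΣV-suc K n _) ⟩
    ΣV K (suc n) (λ g → G (Vec.map ι g)) ∎
    where open ≡-Reasoning

  ΣF-avoid-zero : ∀ K (G : Fin (suc K) → A) → ΣF (suc K) (λ i → ind (not (does (i Fin.≟ zero))) * G i) ≡ ΣF K (λ j → G (suc j))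
  ΣF-avoid-zero K G = trans (ΣF-suc K _) (trans (cong₂ _+_ (zeroˡ _) (ΣF-cong K (λ j → *-identityˡ _))) (+-identityˡ _))

  ΣF-avoid-last : ∀ K (G : Fin (suc K) → A) → ΣF (suc K) (λ i → ind (not (does (i Fin.≟ Fin.fromℕ K))) * G i) ≡ ΣF K (λ j → G (Fin.inject₁ j))
  ΣF-avoid-last K G = trans (ΣF-last K _) (trans (cong₂ _+_ (ΣF-cong K (λ j → trans (cong (λ t → ind (not t) * G (Fin.inject₁ j)) (lem j)) (*-identityˡ _))) (lem2 (Fin.fromℕ K Fin.≟ Fin.fromℕ K))) (+-identityʳ _))
    where
    lem : ∀ j → does (Fin.inject₁ j Fin.≟ Fin.fromℕ K) ≡ false
    lem j = dec-false (Fin.inject₁ j Fin.≟ Fin.fromℕ K) (λ p → FP.fromℕ≢inject₁ (sym p))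
    lem2 : (d : Dec (Fin.fromℕ K ≡ Fin.fromℕ K)) → ind (not (does d)) * G (Fin.fromℕ K) ≡ 0#
    lem2 (yes _) = zeroˡ _
    lem2 (no ¬p) = ⊥-elim (¬p refl)

ℕ-semiring : ≡-CommutativeSemiring
ℕ-semiring = record { isCommutativeSemiring = NP.+-*-isCommutativeSemiring }

ℚ-semiring : ≡-CommutativeSemiring
ℚ-semiring = record
  { isCommutativeSemiring = IsCommutativeRing.isCommutativeSemiring QP.+-*-isCommutativeRing }

module N = Sums ℕ-semiring
module R = Sums ℚ-semiring

ℕtoℚ-ᵘ : ∀ m → Q.toℚᵘ (ℕtoℚ m) Qᵘ.≃ Qᵘ.mkℚᵘ (Z.+ m) 0
ℕtoℚ-ᵘ m = QP.toℚᵘ-fromℚᵘ (Qᵘ.mkℚᵘ (Z.+ m) 0)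

ℕtoℚ-+ : ∀ m n → ℕtoℚ (m ℕ.+ n) ≡ ℕtoℚ m Q.+ ℕtoℚ n
ℕtoℚ-+ m n = QP.toℚᵘ-injective (QᵘP.≃-trans (ℕtoℚ-ᵘ (m ℕ.+ n)) (QᵘP.≃-trans X
   (QᵘP.≃-sym (QᵘP.≃-trans (QP.toℚᵘ-homo-+ (ℕtoℚ m) (ℕtoℚ n)) (QᵘP.+-cong (ℕtoℚ-ᵘ m) (ℕtoℚ-ᵘ n))))))
  where
  X : Qᵘ.mkℚᵘ (Z.+ (m ℕ.+ n)) 0 Qᵘ.≃ (Qᵘ.mkℚᵘ (Z.+ m) 0 Qᵘ.+ Qᵘ.mkℚᵘ (Z.+ n) 0)
  X = Qᵘ.*≡* (trans (ZP.*-identityʳ (Z.+ (m ℕ.+ n))) (trans (ZP.pos-+ m n) (sym (trans (ZP.*-identityʳ (Z.+ m Z.* Z.+ 1 Z.+ Z.+ n Z.* Z.+ 1)) (cong₂ Z._+_ (ZP.*-identityʳ (Z.+ m)) (ZP.*-identityʳ (Z.+ n)))))))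

inv-ℕ : ∀ d → inv (suc d) Q.* ℕtoℚ (suc d) ≡ Q.1ℚ
inv-ℕ d = QP.toℚᵘ-injective (QᵘP.≃-trans (QP.toℚᵘ-homo-* (inv (suc d)) (ℕtoℚ (suc d)))
   (QᵘP.≃-trans (QᵘP.*-cong (QP.toℚᵘ-fromℚᵘ (Qᵘ.mkℚᵘ (Z.+ 1) d)) (ℕtoℚ-ᵘ (suc d))) X))
  where
  X : (Qᵘ.mkℚᵘ (Z.+ 1) d Qᵘ.* Qᵘ.mkℚᵘ (Z.+ (suc d)) 0) Qᵘ.≃ Qᵘ.mkℚᵘ (Z.+ 1) 0
  X = Qᵘ.*≡* (trans (ZP.*-identityʳ (Z.+ 1 Z.* Z.+ (suc d))) (trans (ZP.*-identityˡ (Z.+ (suc d))) (trans (cong Z.+_ (sym (NP.*-identityʳ (suc d)))) (sym (ZP.*-identityˡ (Z.+ (suc d ℕ.* 1)))))))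

*-cancelˡ-suc : ∀ b {p q} → ℕtoℚ (suc b) Q.* p ≡ ℕtoℚ (suc b) Q.* q → p ≡ q
*-cancelˡ-suc b {p} {q} eq = begin
  p ≡⟨ sym (QP.*-identityˡ p) ⟩
  Q.1ℚ Q.* p ≡⟨ cong (Q._* p) (sym (inv-ℕ b)) ⟩
  (inv (suc b) Q.* ℕtoℚ (suc b)) Q.* p ≡⟨ QP.*-assoc (inv (suc b)) (ℕtoℚ (suc b)) p ⟩
  inv (suc b) Q.* (ℕtoℚ (suc b) Q.* p) ≡⟨ cong (inv (suc b) Q.*_) eq ⟩
  inv (suc b) Q.* (ℕtoℚ (suc b) Q.* q) ≡⟨ sym (QP.*-assoc (inv (suc b)) (ℕtoℚ (suc b)) q) ⟩
  (inv (suc b) Q.* ℕtoℚ (suc b)) Q.* q ≡⟨ cong (Q._* q) (inv-ℕ b) ⟩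
  Q.1ℚ Q.* q ≡⟨ QP.*-identityˡ q ⟩
  q ∎
  where open ≡-Reasoning

*-inv-cancel : ∀ b a W → ℕtoℚ (suc b) Q.* (a Q.* (inv (suc b) Q.* W)) ≡ a Q.* W
*-inv-cancel b a W = begin
  ℕtoℚ (suc b) Q.* (a Q.* (inv (suc b) Q.* W)) ≡⟨ sym (QP.*-assoc (ℕtoℚ (suc b)) a (inv (suc b) Q.* W)) ⟩
  (ℕtoℚ (suc b) Q.* a) Q.* (inv (suc b) Q.* W) ≡⟨ cong (Q._* (inv (suc b) Q.* W)) (QP.*-comm (ℕtoℚ (suc b)) a) ⟩
  (a Q.* ℕtoℚ (suc b)) Q.* (inv (suc b) Q.* W) ≡⟨ QP.*-assoc a (ℕtoℚ (suc b)) (inv (suc b) Q.* W) ⟩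
  a Q.* (ℕtoℚ (suc b) Q.* (inv (suc b) Q.* W)) ≡⟨ cong (a Q.*_) (sym (QP.*-assoc (ℕtoℚ (suc b)) (inv (suc b)) W)) ⟩
  a Q.* ((ℕtoℚ (suc b) Q.* inv (suc b)) Q.* W) ≡⟨ cong (λ t → a Q.* (t Q.* W)) (trans (QP.*-comm (ℕtoℚ (suc b)) (inv (suc b))) (inv-ℕ b)) ⟩
  a Q.* (Q.1ℚ Q.* W) ≡⟨ cong (a Q.*_) (QP.*-identityˡ W) ⟩
  a Q.* W ∎
  where open ≡-Reasoning

assoc4 : ∀ a b c d W → (a Q.* (b Q.* (c Q.* d))) Q.* W ≡ a Q.* (b Q.* (c Q.* (d Q.* W)))
assoc4 a b c d W = trans (QP.*-assoc a (b Q.* (c Q.* d)) W) (cong (a Q.*_) (trans (QP.*-assoc b (c Q.* d) W) (cong (b Q.*_) (QP.*-assoc c d W))))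

ℕtoℚ-Σ : ∀ {Y : Set} (xs : List Y) f → ℕtoℚ (N.Σ xs f) ≡ R.Σ xs (λ x → ℕtoℚ (f x))
ℕtoℚ-Σ [] f = refl
ℕtoℚ-Σ (x ∷ xs) f = trans (ℕtoℚ-+ (f x) (N.Σ xs f)) (cong (ℕtoℚ (f x) Q.+_) (ℕtoℚ-Σ xs f))

ℕtoℚ-ind : ∀ b → ℕtoℚ (N.ind b) ≡ R.ind b
ℕtoℚ-ind true = refl
ℕtoℚ-ind false = refl

-- 1/(m(1+b)) = 1/(1+b) · 1/m (also for m = 0, where inv 0 = 0).
inv-mul : ∀ m b → inv (m ℕ.* suc b) ≡ inv (suc b) Q.* inv m
inv-mul zero b = sym (QP.*-zeroʳ (inv (suc b)))
inv-mul (suc m) b = QP.toℚᵘ-injective (QᵘP.≃-trans (QP.toℚᵘ-fromℚᵘ (Qᵘ.mkℚᵘ (Z.+ 1) (b ℕ.+ m ℕ.* suc b)))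
    (QᵘP.≃-sym (QᵘP.≃-trans (QP.toℚᵘ-homo-* (inv (suc b)) (inv (suc m)))
      (QᵘP.≃-trans (QᵘP.*-cong (QP.toℚᵘ-fromℚᵘ (Qᵘ.mkℚᵘ (Z.+ 1) b)) (QP.toℚᵘ-fromℚᵘ (Qᵘ.mkℚᵘ (Z.+ 1) m))) X))))
  where
  X : (Qᵘ.mkℚᵘ (Z.+ 1) b Qᵘ.* Qᵘ.mkℚᵘ (Z.+ 1) m) Qᵘ.≃ Qᵘ.mkℚᵘ (Z.+ 1) (b ℕ.+ m ℕ.* suc b)
  X = Qᵘ.*≡* (trans (ZP.*-identityˡ (Z.+ (suc m ℕ.* suc b))) (trans (cong Z.+_ (NP.*-comm (suc m) (suc b))) (sym (ZP.*-identityˡ (Z.+ (suc b ℕ.* suc m))))))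

lower : ∀ {k} → Fin (suc (suc k)) → Fin (suc k)
lower zero = zero
lower {zero} (suc _) = zero
lower {suc k} (suc i) = suc (lower i)

lower-inject₁ : ∀ {k} (i : Fin (suc k)) → lower (Fin.inject₁ i) ≡ i
lower-inject₁ zero = refl
lower-inject₁ {suc k} (suc i) = cong suc (lower-inject₁ i)

inject₁-lower : ∀ {k} (i : Fin (suc (suc k))) → i ≢ Fin.fromℕ (suc k) → Fin.inject₁ (lower i) ≡ i
inject₁-lower zero ne = refl
inject₁-lower {zero} (suc zero) ne = ⊥-elim (ne refl)
inject₁-lower {suc k} (suc i) ne = cong suc (inject₁-lower i (λ eq → ne (cong suc eq)))

lastView : ∀ {k} (i : Fin (suc k)) → (i ≡ Fin.fromℕ k) ⊎ Σ[ j ∈ Fin k ] (i ≡ Fin.inject₁ j)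
lastView {zero} zero = inj₁ refl
lastView {suc k} zero = inj₂ (zero , refl)
lastView {suc k} (suc i) with lastView i
... | inj₁ eq = inj₁ (cong suc eq)
... | inj₂ (j , eq) = inj₂ (suc j , cong suc eq)

inject₁≢last : ∀ {k} (j : Fin k) → Fin.inject₁ j ≢ Fin.fromℕ k
inject₁≢last j eq = FP.fromℕ≢inject₁ (sym eq)

inject₁-mono : ∀ {k} {i j : Fin k} → i Fin.≤ j → Fin.inject₁ i Fin.≤ Fin.inject₁ j
inject₁-mono {i = i} {j} le = subst₂ ℕ._≤_ (sym (FP.toℕ-inject₁ i)) (sym (FP.toℕ-inject₁ j)) le

inject₁-mono⁻ : ∀ {k} {i j : Fin k} → Fin.inject₁ i Fin.≤ Fin.inject₁ j → i Fin.≤ j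
inject₁-mono⁻ {i = i} {j} le = subst₂ ℕ._≤_ (FP.toℕ-inject₁ i) (FP.toℕ-inject₁ j) le

true≢false : true ≢ false
true≢false ()

isSuc : ∀ {K} → Fin K → Bool
isSuc zero = false
isSuc (suc _) = true

count : ∀ {n} → (Fin n → Bool) → ℕ
count {n} p = N.ΣF n (λ y → N.ind (p y))

count-cong : ∀ {n} {p q : Fin n → Bool} → (∀ y → p y ≡ q y) → count p ≡ count q
count-cong {n} eq = N.ΣF-cong n (λ y → cong N.ind (eq y))

ind-split : ∀ a b → N.ind a ≡ N.ind (a ∧ b) ℕ.+ N.ind (a ∧ not b)
ind-split false b = refl
ind-split true true = refl
ind-split true false = refl

count-split : ∀ {n} (p q : Fin n → Bool) → count p ≡ count (λ y → p y ∧ q y) ℕ.+ count (λ y → p y ∧ not (q y))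
count-split {n} p q = trans (N.ΣF-cong n (λ y → ind-split (p y) (q y))) (N.Σ-+ (allFin n) _ _)

Σ-mono : ∀ {X : Set} (xs : List X) {f g : X → ℕ} → (∀ x → f x ℕ.≤ g x) → N.Σ xs f ℕ.≤ N.Σ xs g
Σ-mono [] le = ℕ.z≤n
Σ-mono (x ∷ xs) le = NP.+-mono-≤ (le x) (Σ-mono xs le)

count-mono : ∀ {n} {p q : Fin n → Bool} → (∀ y → p y ≡ true → q y ≡ true) → count p ℕ.≤ count q
count-mono {n} {p} {q} h = Σ-mono (allFin n) lem
  where
  lem : ∀ y → N.ind (p y) ℕ.≤ N.ind (q y)
  lem y with p y | h y
  ... | false | _ = ℕ.z≤n
  ... | true | hy rewrite hy refl = ℕ.s≤s ℕ.z≤n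

count-δ : ∀ {n} (x : Fin n) → count (λ y → does (y Fin.≟ x)) ≡ 1
count-δ {n} x = trans (N.ΣF-cong n (λ y → sym (NP.*-identityʳ _))) (N.ΣF-δ n x (λ _ → 1))

count-pos : ∀ {n} {p : Fin n → Bool} x → p x ≡ true → 1 ℕ.≤ count p
count-pos {p = p} x px = NP.≤-trans (NP.≤-reflexive (sym (count-δ x))) (count-mono lem)
  where
  lem : ∀ y → does (y Fin.≟ x) ≡ true → p y ≡ true
  lem y h with y Fin.≟ x
  lem y h | yes refl = px

count-none : ∀ {n} {p : Fin n → Bool} → (∀ y → p y ≡ false) → count p ≡ 0
count-none {n} h = trans (N.ΣF-cong n (λ y → cong N.ind (h y))) (N.Σ-0 (allFin n))

count-strict : ∀ {n} {p q : Fin n → Bool} → (∀ y → p y ≡ true → q y ≡ true) → ∀ y → q y ≡ true → p y ≡ false → count p ℕ.< count q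
count-strict {n} {p} {q} h y qy py = begin-strict
    count p ≡⟨ count-cong (λ z → lem1 z) ⟩
    count (λ z → q z ∧ p z) ≡⟨ sym (NP.+-identityʳ _) ⟩
    count (λ z → q z ∧ p z) ℕ.+ 0 <⟨ NP.+-monoʳ-< (count (λ z → q z ∧ p z)) (count-pos {p = λ z → q z ∧ not (p z)} y (subst₂ (λ a b → a ∧ not b ≡ true) (sym qy) (sym py) refl)) ⟩
    count (λ z → q z ∧ p z) ℕ.+ count (λ z → q z ∧ not (p z)) ≡⟨ sym (count-split q p) ⟩
    count q ∎
  where
  open NP.≤-Reasoning
  lem1 : ∀ z → p z ≡ (q z ∧ p z)
  lem1 z with p z in pz
  ... | false = sym (BP.∧-zeroʳ (q z))
  ... | true rewrite h z pz = refl

count-two : ∀ {n} {p : Fin n → Bool} x m → p x ≡ true → p m ≡ true → x ≢ m → 2 ℕ.≤ count p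
count-two {n} {p} x m px pm ne = begin
    2 ≡⟨ cong₂ ℕ._+_ (sym (count-δ x)) (sym (count-δ m)) ⟩
    count (λ y → does (y Fin.≟ x)) ℕ.+ count (λ y → does (y Fin.≟ m)) ≤⟨ NP.+-mono-≤ (count-mono l1) (count-mono l2) ⟩
    count (λ y → p y ∧ does (y Fin.≟ x)) ℕ.+ count (λ y → p y ∧ not (does (y Fin.≟ x))) ≡⟨ sym (count-split p (λ y → does (y Fin.≟ x))) ⟩
    count p ∎
  where
  open NP.≤-Reasoning
  l1 : ∀ y → does (y Fin.≟ x) ≡ true → (p y ∧ does (y Fin.≟ x)) ≡ true
  l1 y h with y Fin.≟ x
  l1 y h | yes refl rewrite px = refl
  l2 : ∀ y → does (y Fin.≟ m) ≡ true → (p y ∧ not (does (y Fin.≟ x))) ≡ true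
  l2 y h with y Fin.≟ m
  l2 y h | yes refl with y Fin.≟ x
  ... | yes refl = ⊥-elim (ne refl)
  ... | no _ rewrite pm = refl

-- Induced subposets X ⊆ P (boolean predicates on Fin n) and labellings
-- g : Fin n → Fin (1+L), where label 0 means "outside X" and labels
-- 1,…,L are the values of a map on X.
module Core {n : ℕ} (P : FinPoset n) where
  open FinPoset P
  open IsPartialOrder (FinPoset.isPartialOrder P) using (antisym) renaming (refl to ≤P-refl; trans to ≤P-trans)
  open R using (avoids; fill; _≟V_)

  IsMin : (Fin n → Bool) → Fin n → Set
  IsMin U m = (U m ≡ true) × (∀ y → U y ≡ true → ¬ (y <P m))

  IsMin? : (U : Fin n → Bool) → ∀ m → Dec (IsMin U m)
  IsMin? U m = (U m BP.≟ true) ×-dec FP.all? (λ y → (U y BP.≟ true) →-dec ¬? (y <P? m))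

  below : (Fin n → Bool) → Fin n → Fin n → Bool
  below U y z = U z ∧ does (z ≤P? y)

  module _ (U : Fin n → Bool) (y z : Fin n) (z<y : z <P y) where
    below-shrinks : ∀ v → below U z v ≡ true → below U y v ≡ true
    below-shrinks v h with U v | v ≤P? z | h
    ... | true | yes v≤z | _ = dec-true (v ≤P? y) (≤P-trans v≤z (proj₁ z<y))
    below-excludes : below U z y ≡ false
    below-excludes with U y
    ... | false = refl
    ... | true = dec-false (y ≤P? z) (λ y≤z → proj₂ z<y (antisym (proj₁ z<y) y≤z))

  below-includes : ∀ U y → U y ≡ true → below U y y ≡ true
  below-includes U y Uy = subst (λ b → b ∧ does (y ≤P? y) ≡ true) (sym Uy) (dec-true (y ≤P? y) ≤P-refl)

  -- Every element y of U lies above a minimal element of U (by induction on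
  -- the number of elements of U below y).
  min-below : ∀ (U : Fin n → Bool) F y → count (below U y) ℕ.≤ F → U y ≡ true → Σ[ m ∈ Fin n ] (IsMin U m × (m ≤P y))
  min-below U zero y le Uy = ⊥-elim (NP.<⇒≱ (count-pos {p = below U y} y (below-includes U y Uy)) le)
  min-below U (suc F) y le Uy with FP.any? (λ z → (U z BP.≟ true) ×-dec (z <P? y))
  ... | no ¬ex = y , (Uy , (λ z Uz z<y → ¬ex (z , (Uz , z<y)))) , ≤P-refl
  ... | yes (z , Uz , z<y) with min-below U F z (NP.≤-pred (NP.≤-trans (count-strict (below-shrinks U y z z<y) y (below-includes U y Uy) (below-excludes U y z z<y)) le)) Uz
  ... | m , minm , m≤z = m , minm , ≤P-trans m≤z (proj₁ z<y)

  unique-min-least : ∀ U x → IsMin U x → count (λ m → does (IsMin? U m)) ≡ 1 → ∀ y → U y ≡ true → x ≤P y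
  unique-min-least U x minx c1 y Uy with min-below U (count (below U y)) y NP.≤-refl Uy
  ... | m , minm , m≤y with x Fin.≟ m
  ... | yes refl = m≤y
  ... | no x≢m = ⊥-elim (¬2≤1 (subst (2 ℕ.≤_) c1 (count-two {p = λ m → does (IsMin? U m)} x m (dec-true (IsMin? U x) minx) (dec-true (IsMin? U m) minm) x≢m)))
    where
    ¬2≤1 : ¬ (2 ℕ.≤ 1)
    ¬2≤1 (ℕ.s≤s ())

  infixl 9 _!_
  _!_ : ∀ {K} → Vec (Fin K) n → Fin n → Fin K
  g ! y = lookup g y

  fibre : ∀ {K} → Vec (Fin K) n → Fin K → Fin n → Bool
  fibre g j y = does (g ! y Fin.≟ j)

  Support : ∀ {K} → (Fin n → Bool) → Vec (Fin K) n → Set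
  Support X g = ∀ y → X y ≡ isSuc (g ! y)

  Support? : ∀ {K} X (g : Vec (Fin K) n) → Dec (Support X g)
  Support? X g = FP.all? (λ y → X y BP.≟ isSuc (g ! y))

  Monotone : ∀ {K} → (Fin n → Bool) → Vec (Fin K) n → Set
  Monotone X g = ∀ y z → X y ≡ true → X z ≡ true → y ≤P z → g ! y Fin.≤ g ! z

  Monotone? : ∀ {K} X (g : Vec (Fin K) n) → Dec (Monotone X g)
  Monotone? X g = FP.all? (λ y → FP.all? (λ z → (X y BP.≟ true) →-dec ((X z BP.≟ true) →-dec ((y ≤P? z) →-dec (g ! y Fin.≤? g ! z)))))

  -- The content of g: label i+1 is used c i times.
  Content : ∀ {L} → (Fin L → ℕ) → Vec (Fin (suc L)) n → Set
  Content {L} c g = ∀ (i : Fin L) → count (fibre g (suc i)) ≡ c i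

  Content? : ∀ {L} c (g : Vec (Fin (suc L)) n) → Dec (Content c g)
  Content? c g = FP.all? (λ i → count (fibre g (suc i)) ℕ.≟ c i)

  IsPPart : ∀ {L} → (Fin n → Bool) → (Fin L → ℕ) → Vec (Fin (suc L)) n → Set
  IsPPart X c g = Support X g × Monotone X g × Content c g

  IsPPart? : ∀ {L} X c (g : Vec (Fin (suc L)) n) → Dec (IsPPart X c g)
  IsPPart? X c g = Support? X g ×-dec (Monotone? X g ×-dec Content? c g)

  Onto : ∀ {k} → Vec (Fin (suc k)) n → Set
  Onto {k} g = ∀ (i : Fin k) → Σ[ y ∈ Fin n ] (g ! y ≡ suc i)

  Onto? : ∀ {k} (g : Vec (Fin (suc k)) n) → Dec (Onto g)
  Onto? g = FP.all? (λ i → FP.any? (λ y → g ! y Fin.≟ suc i))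

  UniqueMins : ∀ {k} → Vec (Fin (suc k)) n → Set
  UniqueMins {k} g = ∀ (i : Fin k) → count (λ m → does (IsMin? (fibre g (suc i)) m)) ≡ 1

  UniqueMins? : ∀ {k} (g : Vec (Fin (suc k)) n) → Dec (UniqueMins g)
  UniqueMins? g = FP.all? (λ i → count (λ m → does (IsMin? (fibre g (suc i)) m)) ℕ.≟ 1)

  IsOStarOn : ∀ {k} → (Fin n → Bool) → Vec (Fin (suc k)) n → Set
  IsOStarOn X g = Support X g × Monotone X g × Onto g × UniqueMins g

  IsOStarOn? : ∀ {k} X (g : Vec (Fin (suc k)) n) → Dec (IsOStarOn X g)
  IsOStarOn? X g = Support? X g ×-dec (Monotone? X g ×-dec (Onto? g ×-dec UniqueMins? g))

  blockSizes : ∀ {k} → Vec (Fin (suc k)) n → Fin k → ℕ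
  blockSizes g i = count (fibre g (suc i))

  setLast : ∀ {L} → (Fin (suc L) → ℕ) → ℕ → Fin (suc L) → ℕ
  setLast {L} c v i = if does (i Fin.≟ Fin.fromℕ L) then v else c i

  -- The weight w(α, c): defined by recursion on the last entries,
  --   w(α·u, c·b) = [u ≤ b] / b · w(α, c·(b - u)),   w(∅, c·b) = 0   (b > 0),
  --   w(α, c·0) = w(α, c),   w(α, ∅) = [α = ∅];
  -- it equals W(α, c) = [x^c] Ψ_α / z_α (`weight≡W`).
  weight : ∀ k → (Fin k → ℕ) → ∀ L → (Fin L → ℕ) → Q.ℚ
  weightStep : ∀ k → (Fin k → ℕ) → ∀ L → (Fin (suc L) → ℕ) → ℕ → Q.ℚ
  weightBase : ℕ → Q.ℚ
  weightBase zero = Q.1ℚ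
  weightBase (suc k) = Q.0ℚ
  weight k α zero c = weightBase k
  weight k α (suc L) c = weightStep k α L c (c (Fin.fromℕ L))
  weightStep k α L c zero = weight k α L (λ i → c (Fin.inject₁ i))
  weightStep zero α L c (suc b) = Q.0ℚ
  weightStep (suc k) α L c (suc b) =
    R.ind (does (α (Fin.fromℕ k) ℕ.≤? suc b)) Q.* (inv (suc b) Q.* weight k (λ i → α (Fin.inject₁ i)) (suc L) (setLast c (suc b ℕ.∸ α (Fin.fromℕ k))))

  ppCount : (Fin n → Bool) → ∀ L → (Fin L → ℕ) → Q.ℚ
  ppCount X L c = R.ΣV (suc L) n (λ g → R.𝕀 (IsPPart? X c g))

  oWeight : (Fin n → Bool) → ℕ → ∀ L → (Fin L → ℕ) → Q.ℚ
  oWeight X k L c = R.ΣV (suc k) n (λ g → R.𝕀 (IsOStarOn? X g) Q.* weight k (blockSizes g) L c)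

  oWeightUpTo : (Fin n → Bool) → ℕ → ∀ L → (Fin L → ℕ) → Q.ℚ
  oWeightUpTo X N L c = R.Σ (List.upTo N) (λ k → oWeight X k L c)

  Up : (Fin n → Bool) → Fin n → Fin n → Bool
  Up X x y = X y ∧ does (x ≤P? y)

  Down : (Fin n → Bool) → Fin n → Fin n → Bool
  Down X x y = X y ∧ not (does (x ≤P? y))

  upSize : (Fin n → Bool) → Fin n → ℕ
  upSize X x = count (Up X x)

  Empty? : (X : Fin n → Bool) → Dec (∀ y → X y ≡ false)
  Empty? X = FP.all? (λ y → X y BP.≟ false)

  Down-smaller : ∀ X x → X x ≡ true → count (Down X x) ℕ.< count X
  Down-smaller X x Xx = count-strict sub x Xx out
    where
    sub : ∀ y → Down X x y ≡ true → X y ≡ true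
    sub y h with X y
    ... | true = refl
    ... | false = h
    out : Down X x x ≡ false
    out rewrite Xx | dec-true (x ≤P? x) ≤P-refl = refl

  lookup-map-inj : ∀ {K} (g : Vec (Fin K) n) y → Vec.map Fin.inject₁ g ! y ≡ Fin.inject₁ (g ! y)
  lookup-map-inj g y = VP.lookup-map y Fin.inject₁ g

  isSuc-inject₁ : ∀ {K} (a : Fin K) → isSuc (Fin.inject₁ a) ≡ isSuc a
  isSuc-inject₁ zero = refl
  isSuc-inject₁ (suc a) = refl

  does-inj : ∀ {K} (a j : Fin K) → does (Fin.inject₁ a Fin.≟ Fin.inject₁ j) ≡ does (a Fin.≟ j)
  does-inj a j = does-cong FP.inject₁-injective (cong Fin.inject₁) (Fin.inject₁ a Fin.≟ Fin.inject₁ j) (a Fin.≟ j)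

  does-inj-top : ∀ {K} (a : Fin K) → does (Fin.inject₁ a Fin.≟ Fin.fromℕ K) ≡ false
  does-inj-top a = dec-false (Fin.inject₁ a Fin.≟ _) (inject₁≢last a)

  avoids-intro : ∀ {K m} (e : Fin K) (g : Vec (Fin K) m) → (∀ y → lookup g y ≢ e) → avoids e g ≡ true
  avoids-intro e [] h = refl
  avoids-intro e (i ∷ g) h rewrite dec-false (i Fin.≟ e) (h zero) = avoids-intro e g (λ y → h (suc y))

  avoids-elim : ∀ {K m} (e : Fin K) (g : Vec (Fin K) m) → avoids e g ≡ true → ∀ y → lookup g y ≢ e
  avoids-elim e (i ∷ g) h zero with i Fin.≟ e
  avoids-elim e (i ∷ g) () zero | yes _
  ... | no ne = ne
  avoids-elim e (i ∷ g) h (suc y) with i Fin.≟ e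
  avoids-elim e (i ∷ g) () (suc y) | yes _
  ... | no ne = avoids-elim e g h y

  zeros : ∀ {K} → Vec (Fin (suc K)) n
  zeros = Vec.replicate n zero

  zeros! : ∀ {K} y → (zeros {K}) ! y ≡ zero
  zeros! y = VP.lookup-replicate y zero

  fibre-count-pos : ∀ {K} (g : Vec (Fin K) n) y j → g ! y ≡ j → 1 ℕ.≤ count (fibre g j)
  fibre-count-pos g y j eq = count-pos {p = fibre g j} y (dec-true (g ! y Fin.≟ j) eq)

  IsPPart-nil : ∀ X (c : Fin 0 → ℕ) → R.𝕀 (IsPPart? X c zeros) ≡ R.𝕀 (Empty? X)
  IsPPart-nil X c = R.𝕀-cong to from (IsPPart? X c zeros) (Empty? X)
    where
    to : IsPPart X c zeros → ∀ y → X y ≡ false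
    to (oo , _) y = trans (oo y) (cong isSuc (zeros! y))
    from : (∀ y → X y ≡ false) → IsPPart X c zeros
    from e = (λ y → trans (e y) (sym (cong isSuc (zeros! y)))) ,
             (λ y z Xy → ⊥-elim (case (trans (sym Xy) (e y)))) , (λ ())
      where case : true ≡ false → ⊥
            case ()

  IsOStarOn-nil : ∀ X → R.𝕀 (IsOStarOn? {0} X zeros) ≡ R.𝕀 (Empty? X)
  IsOStarOn-nil X = R.𝕀-cong to from (IsOStarOn? X zeros) (Empty? X)
    where
    to : IsOStarOn {0} X zeros → ∀ y → X y ≡ false
    to (oo , _) y = trans (oo y) (cong isSuc (zeros! y))
    from : (∀ y → X y ≡ false) → IsOStarOn {0} X zeros
    from e = (λ y → trans (e y) (sym (cong isSuc (zeros! y)))) ,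
             (λ y z Xy → ⊥-elim (case (trans (sym Xy) (e y)))) , (λ ()) , (λ ())
      where case : true ≡ false → ⊥
            case ()

  ppCount-nil : ∀ X c → ppCount X 0 c ≡ R.𝕀 (Empty? X)
  ppCount-nil X c = trans (R.ΣV-singleton n (λ g → R.𝕀 (IsPPart? X c g))) (IsPPart-nil X c)

  oWeight-nil : ∀ X k c → oWeight X (suc k) 0 c ≡ Q.0ℚ
  oWeight-nil X k c = trans (R.ΣV-cong (suc (suc k)) n (λ g → QP.*-zeroʳ (R.𝕀 (IsOStarOn? X g)))) (R.Σ-0 (allVec (suc (suc k)) n))

  oWeightUpTo-nil : ∀ X N c → oWeightUpTo X (suc N) 0 c ≡ R.𝕀 (Empty? X)
  oWeightUpTo-nil X N c = begin
    oWeight X 0 0 c Q.+ R.Σ (List.applyUpTo (λ i → suc i) N) (λ k → oWeight X k 0 c)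
      ≡⟨ cong₂ Q._+_ (trans (R.ΣV-singleton n (λ g → R.𝕀 (IsOStarOn? {0} X g) Q.* weight 0 (blockSizes g) 0 c)) (trans (QP.*-identityʳ (R.𝕀 (IsOStarOn? {0} X zeros))) (IsOStarOn-nil X))) (R.Σ-upTo-suc-0 (λ k → oWeight X k 0 c) N (λ m → oWeight-nil X m c)) ⟩
    R.𝕀 (Empty? X) Q.+ Q.0ℚ ≡⟨ QP.+-identityʳ _ ⟩
    R.𝕀 (Empty? X) ∎
    where open ≡-Reasoning

  -- A last content entry 0 can be dropped: the last label is then unused,
  -- and the labellings are those into one label fewer.
  weight-last0 : ∀ k α L c → c (Fin.fromℕ L) ≡ 0 → weight k α (suc L) c ≡ weight k α L (λ i → c (Fin.inject₁ i))
  weight-last0 k α L c eq rewrite eq = refl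

  oWeightUpTo-last0 : ∀ X N L c → c (Fin.fromℕ L) ≡ 0 → oWeightUpTo X N (suc L) c ≡ oWeightUpTo X N L (λ i → c (Fin.inject₁ i))
  oWeightUpTo-last0 X N L c eq = R.Σ-cong (List.upTo N) (λ k → R.ΣV-cong (suc k) n (λ g → cong (R.𝕀 (IsOStarOn? X g) Q.*_) (weight-last0 k (blockSizes g) L c eq)))

  fibre-inject₁ : ∀ {K} (g : Vec (Fin K) n) (j : Fin K) y → fibre (Vec.map Fin.inject₁ g) (Fin.inject₁ j) y ≡ fibre g j y
  fibre-inject₁ g j y = trans (cong (λ t → does (t Fin.≟ Fin.inject₁ j)) (lookup-map-inj g y)) (does-inj (g ! y) j)

  fibre-inject₁-last : ∀ {K} (g : Vec (Fin K) n) y → fibre (Vec.map Fin.inject₁ g) (Fin.fromℕ K) y ≡ false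
  fibre-inject₁-last g y = trans (cong (λ t → does (t Fin.≟ Fin.fromℕ _)) (lookup-map-inj g y)) (does-inj-top (g ! y))

  Support-inject₁ : ∀ {K} X (g : Vec (Fin K) n) → Support X (Vec.map Fin.inject₁ g) → Support X g
  Support-inject₁ X g oo y = trans (oo y) (trans (cong isSuc (lookup-map-inj g y)) (isSuc-inject₁ (g ! y)))

  Support-inject₁⁻ : ∀ {K} X (g : Vec (Fin K) n) → Support X g → Support X (Vec.map Fin.inject₁ g)
  Support-inject₁⁻ X g oo y = trans (oo y) (sym (trans (cong isSuc (lookup-map-inj g y)) (isSuc-inject₁ (g ! y))))

  Monotone-inject₁ : ∀ {K} X (g : Vec (Fin K) n) → Monotone X (Vec.map Fin.inject₁ g) → Monotone X g
  Monotone-inject₁ X g mo y z Xy Xz le = inject₁-mono⁻ (subst₂ Fin._≤_ (lookup-map-inj g y) (lookup-map-inj g z) (mo y z Xy Xz le))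

  Monotone-inject₁⁻ : ∀ {K} X (g : Vec (Fin K) n) → Monotone X g → Monotone X (Vec.map Fin.inject₁ g)
  Monotone-inject₁⁻ X g mo y z Xy Xz le = subst₂ Fin._≤_ (sym (lookup-map-inj g y)) (sym (lookup-map-inj g z)) (inject₁-mono (mo y z Xy Xz le))

  ppCount-last0 : ∀ X L c → c (Fin.fromℕ L) ≡ 0 → ppCount X (suc L) c ≡ ppCount X L (λ i → c (Fin.inject₁ i))
  ppCount-last0 X L c eq = begin
    R.ΣV (suc (suc L)) n (λ g → R.𝕀 (IsPPart? X c g)) ≡⟨ R.ΣV-cong (suc (suc L)) n pt ⟩
    R.ΣV (suc (suc L)) n (λ g → R.ind (avoids top g) Q.* R.𝕀 (IsPPart? X c g)) ≡⟨ R.ΣV-avoiding (suc L) n top Fin.inject₁ (R.ΣF-avoid-last (suc L)) (λ g → R.𝕀 (IsPPart? X c g)) ⟩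
    R.ΣV (suc L) n (λ g → R.𝕀 (IsPPart? X c (Vec.map Fin.inject₁ g))) ≡⟨ R.ΣV-cong (suc L) n (λ g → R.𝕀-cong (to g) (from g) (IsPPart? X c (Vec.map Fin.inject₁ g)) (IsPPart? X c' g)) ⟩
    R.ΣV (suc L) n (λ g → R.𝕀 (IsPPart? X c' g)) ∎
    where
    open ≡-Reasoning
    top = Fin.fromℕ (suc L)
    c' = λ i → c (Fin.inject₁ i)
    pt : ∀ g → R.𝕀 (IsPPart? X c g) ≡ R.ind (avoids top g) Q.* R.𝕀 (IsPPart? X c g)
    pt g = R.𝕀-guard (IsPPart? X c g) (avoids top g) (λ { (_ , _ , ct) → avoids-intro top g (λ y eqy → NP.<⇒≢ (subst (1 ℕ.≤_) (trans (ct (Fin.fromℕ L)) eq) (fibre-count-pos g y top eqy)) refl) })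
    to : ∀ g → IsPPart X c (Vec.map Fin.inject₁ g) → IsPPart X c' g
    to g (oo , mo , ct) = Support-inject₁ X g oo , Monotone-inject₁ X g mo , (λ i → trans (sym (count-cong (fibre-inject₁ g (suc i)))) (ct (Fin.inject₁ i)))
    from : ∀ g → IsPPart X c' g → IsPPart X c (Vec.map Fin.inject₁ g)
    from g (oo , mo , ct) = Support-inject₁⁻ X g oo , Monotone-inject₁⁻ X g mo , ct'
      where
      ct' : Content c (Vec.map Fin.inject₁ g)
      ct' i with lastView i
      ... | inj₁ refl = trans (count-none (fibre-inject₁-last g)) (sym eq)
      ... | inj₂ (j , refl) = trans (count-cong (fibre-inject₁ g (suc j))) (ct j)

  vext : ∀ {K} (g g' : Vec (Fin K) n) → (∀ y → g ! y ≡ g' ! y) → g ≡ g'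
  vext g g' hh = trans (sym (VP.tabulate∘lookup g)) (trans (VP.tabulate-cong hh) (VP.tabulate∘lookup g'))

  lookup-fill : ∀ {K} (S : Fin n → Bool) (a : Fin K) g y → fill S a g ! y ≡ (if S y then a else g ! y)
  lookup-fill S a g y = VP.lookup∘tabulate (λ y → if S y then a else g ! y) y

  fill-fill : ∀ {K} (S : Fin n → Bool) (a b : Fin K) g → fill S a (fill S b g) ≡ fill S a g
  fill-fill S a b g = vext _ _ (λ y → trans (lookup-fill S a (fill S b g) y) (trans (lem y) (sym (lookup-fill S a g y))))
    where
    lem : ∀ y → (if S y then a else fill S b g ! y) ≡ (if S y then a else g ! y)
    lem y with S y in Sy
    ... | true = refl
    ... | false = trans (lookup-fill S b g y) (cong (λ t → if t then b else g ! y) Sy)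

  isSuc-false : ∀ {K} (a : Fin (suc K)) → isSuc a ≡ false → a ≡ zero
  isSuc-false zero _ = refl

  ≤last : ∀ {K} (a : Fin (suc K)) → a Fin.≤ Fin.fromℕ K
  ≤last a = FP.≤fromℕ a

  last≤⇒≡last : ∀ {K} (a : Fin (suc K)) → Fin.fromℕ K Fin.≤ a → a ≡ Fin.fromℕ K
  last≤⇒≡last a le = FP.≤-antisym (≤last a) le

  -- Peeling the up-set ↑x of x ∈ X off a labelling g into Fin (2+K'):
  -- `erase g` relabels ↑x by 0, turning a labelling of X whose last label
  -- is used on ↑x (`LastOnUx`) into a labelling of X' = X ∖ ↑x.
  module Peel (X : Fin n → Bool) (x : Fin n) (K' : ℕ) where
    Label : Set
    Label = Fin (suc (suc K'))
    last : Label
    last = Fin.fromℕ (suc K')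
    Ux X' : Fin n → Bool
    Ux = Up X x
    X' = Down X x
    erase : Vec Label n → Vec Label n
    erase g = fill Ux zero g
    LastOnUx : Vec Label n → Set
    LastOnUx g = ∀ y → Ux y ≡ true → g ! y ≡ last

    erase-on-Ux : ∀ g y → Ux y ≡ true → erase g ! y ≡ zero
    erase-on-Ux g y Sy = trans (lookup-fill Ux zero g y) (cong (λ t → if t then zero else g ! y) Sy)
    erase-off-Ux : ∀ g y → Ux y ≡ false → erase g ! y ≡ g ! y
    erase-off-Ux g y Sy = trans (lookup-fill Ux zero g y) (cong (λ t → if t then zero else g ! y) Sy)

    X'-elim : ∀ y → X' y ≡ true → (X y ≡ true) × (Ux y ≡ false)
    X'-elim y e with X y | x ≤P? y
    X'-elim y e | true | no _ = refl , refl
    X'-elim y () | true | yes _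
    X'-elim y () | false | _

    X'-intro : ∀ y → X y ≡ true → Ux y ≡ false → X' y ≡ true
    X'-intro y Xy Sy with X y | x ≤P? y
    X'-intro y Xy Sy | true | no _ = refl
    X'-intro y Xy () | true | yes _

    Ux⊆X : ∀ y → Ux y ≡ true → X y ≡ true
    Ux⊆X y e with X y
    ... | true = refl
    ... | false = e

    Ux-disjoint : ∀ y → Ux y ≡ true → X' y ≡ false
    Ux-disjoint y e with X y | x ≤P? y
    ... | true | yes _ = refl
    ... | false | _ = refl
    Ux-disjoint y () | true | no _

    Ux-upward : ∀ y z → Ux y ≡ true → X z ≡ true → y ≤P z → Ux z ≡ true
    Ux-upward y z Sy Xz le with X y | x ≤P? y
    Ux-upward y z Sy Xz le | true | yes x≤y rewrite Xz = dec-true (x ≤P? z) (≤P-trans x≤y le)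
    Ux-upward y z () Xz le | true | no _
    Ux-upward y z () Xz le | false | _

    x∈Ux : X x ≡ true → Ux x ≡ true
    x∈Ux Xx rewrite Xx = dec-true (x ≤P? x) ≤P-refl

    fill-last-id : ∀ g → LastOnUx g → fill Ux last g ≡ g
    fill-last-id g tf = vext _ _ (λ y → trans (lookup-fill Ux last g y) (lem y))
      where
      lem : ∀ y → (if Ux y then last else g ! y) ≡ g ! y
      lem y with Ux y in Sy
      ... | true = sym (tf y Sy)
      ... | false = refl

    LastOnUx-fill : ∀ g → fill Ux last g ≡ g → LastOnUx g
    LastOnUx-fill g eq y Sy = trans (cong (_! y) (sym eq)) (trans (lookup-fill Ux last g y) (cong (λ t → if t then last else g ! y) Sy))

    count-last : ∀ g → LastOnUx g → count (fibre g last) ≡ upSize X x ℕ.+ count (fibre (erase g) last)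
    count-last g tf = trans (count-split (fibre g last) Ux) (cong₂ ℕ._+_ (count-cong l1) (count-cong l2))
      where
      l1 : ∀ y → (fibre g last y ∧ Ux y) ≡ Ux y
      l1 y with Ux y in Sy
      ... | true = trans (BP.∧-identityʳ _) (dec-true (g ! y Fin.≟ last) (tf y Sy))
      ... | false = BP.∧-zeroʳ _
      l2 : ∀ y → (fibre g last y ∧ not (Ux y)) ≡ fibre (erase g) last y
      l2 y with Ux y in Sy
      ... | true = trans (BP.∧-zeroʳ (fibre g last y)) (sym (cong (λ t → does (t Fin.≟ last)) (erase-on-Ux g y Sy)))
      ... | false = trans (BP.∧-identityʳ _) (sym (cong (λ t → does (t Fin.≟ last)) (erase-off-Ux g y Sy)))

    fibre-erase : ∀ g → LastOnUx g → ∀ (j : Fin K') y → fibre (erase g) (suc (Fin.inject₁ j)) y ≡ fibre g (suc (Fin.inject₁ j)) y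
    fibre-erase g tf j y with Ux y in Sy
    ... | true = trans (cong (λ t → does (t Fin.≟ suc (Fin.inject₁ j))) (erase-on-Ux g y Sy))
                   (sym (trans (cong (λ t → does (t Fin.≟ suc (Fin.inject₁ j))) (tf y Sy)) (dec-false (last Fin.≟ suc (Fin.inject₁ j)) (λ e → inject₁≢last j (sym (FP.suc-injective e))))))
    ... | false = cong (λ t → does (t Fin.≟ suc (Fin.inject₁ j))) (erase-off-Ux g y Sy)

    Support-erase : ∀ g → Support X g → Support X' (erase g)
    Support-erase g oo y with Ux y in Sy
    ... | true = trans (Ux-disjoint y Sy) (sym (cong isSuc (erase-on-Ux g y Sy)))
    ... | false = trans (lem (X y) refl) (trans (oo y) (sym (cong isSuc (erase-off-Ux g y Sy))))
      where
      lem : ∀ b → X y ≡ b → X' y ≡ X y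
      lem true Xy = trans (X'-intro y Xy Sy) (sym Xy)
      lem false Xy rewrite Xy = refl

    Support-erase⁻ : ∀ g → LastOnUx g → Support X' (erase g) → Support X g
    Support-erase⁻ g tf oo y with Ux y in Sy
    ... | true = trans (Ux⊆X y Sy) (cong isSuc (sym (tf y Sy)))
    ... | false = trans (lem (X y) refl) (trans (oo y) (cong isSuc (erase-off-Ux g y Sy)))
      where
      lem : ∀ b → X y ≡ b → X y ≡ X' y
      lem true Xy = trans Xy (sym (X'-intro y Xy Sy))
      lem false Xy rewrite Xy = refl

    Monotone-erase : ∀ g → Monotone X g → Monotone X' (erase g)
    Monotone-erase g mo y z X'y X'z le with X'-elim y X'y | X'-elim z X'z
    ... | Xy , Sy | Xz , Sz = subst₂ Fin._≤_ (sym (erase-off-Ux g y Sy)) (sym (erase-off-Ux g z Sz)) (mo y z Xy Xz le)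

    Monotone-erase⁻ : ∀ g → LastOnUx g → Monotone X' (erase g) → Monotone X g
    Monotone-erase⁻ g tf mo y z Xy Xz le with Ux z in Sz
    ... | true = subst (g ! y Fin.≤_) (sym (tf z Sz)) (≤last (g ! y))
    ... | false = subst₂ Fin._≤_ (erase-off-Ux g y Sy) (erase-off-Ux g z Sz) (mo y z (X'-intro y Xy Sy) (X'-intro z Xz Sz) le)
      where
      Sy : Ux y ≡ false
      Sy with Ux y in e
      ... | false = refl
      ... | true = ⊥-elim (true≢false (trans (sym (Ux-upward y z e Xz le)) Sz))

    x∈X : ∀ g → Support X g → g ! x ≡ last → X x ≡ true
    x∈X g oo gx = trans (oo x) (cong isSuc gx)

    LastOnUx-mono : ∀ g → Monotone X g → X x ≡ true → g ! x ≡ last → LastOnUx g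
    LastOnUx-mono g mo Xx gx y Sy = last≤⇒≡last (g ! y) (subst (Fin._≤ g ! y) gx (mo x y Xx (Ux⊆X y Sy) (proj₂ (lemS Sy))))
      where
      lemS : Ux y ≡ true → (X y ≡ true) × (x ≤P y)
      lemS e with X y | x ≤P? y
      lemS e | true | yes p = refl , p
      lemS () | true | no _
      lemS () | false | _

    x-last : ∀ g → LastOnUx g → X x ≡ true → g ! x ≡ last
    x-last g tf Xx = tf x (x∈Ux Xx)

    zero-on-Ux : ∀ (g' : Vec Label n) → Support X' g' → ∀ y → Ux y ≡ true → g' ! y ≡ zero
    zero-on-Ux g' oo y Sy = isSuc-false (g' ! y) (trans (sym (oo y)) (Ux-disjoint y Sy))

    erase-id : ∀ (g' : Vec Label n) → Support X' g' → fill Ux zero g' ≡ g'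
    erase-id g' oo = vext _ _ (λ y → trans (lookup-fill Ux zero g' y) (lem y))
      where
      lem : ∀ y → (if Ux y then zero else g' ! y) ≡ g' ! y
      lem y with Ux y in Sy
      ... | true = sym (zero-on-Ux g' oo y Sy)
      ... | false = refl

  ℕtoℚ-count : ∀ (p : Fin n → Bool) → ℕtoℚ (count p) ≡ R.ΣF n (λ y → R.ind (p y))
  ℕtoℚ-count p = trans (ℕtoℚ-Σ (allFin n) (λ y → N.ind (p y))) (R.ΣF-cong n (λ y → ℕtoℚ-ind (p y)))

  does≟true : ∀ b → does (b BP.≟ true) ≡ b
  does≟true true = refl
  does≟true false = refl

  setLast-last : ∀ {L} (c : Fin (suc L) → ℕ) v → setLast c v (Fin.fromℕ L) ≡ v
  setLast-last {L} c v rewrite dec-true (Fin.fromℕ L Fin.≟ Fin.fromℕ L) refl = refl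

  setLast-inject₁ : ∀ {L} (c : Fin (suc L) → ℕ) v (j : Fin L) → setLast c v (Fin.inject₁ j) ≡ c (Fin.inject₁ j)
  setLast-inject₁ {L} c v j rewrite does-inj-top j = refl

  Σ-mark : ∀ {K'} (V : Vec (Fin K') n → Set) (V? : ∀ g → Dec (V g)) (M : Vec (Fin K') n → Fin n → Bool) (m : ℕ) →
    (∀ g → V g → count (M g) ≡ m) → (Φ : Vec (Fin K') n → Q.ℚ) →
    ℕtoℚ m Q.* R.ΣV K' n (λ g → R.𝕀 (V? g) Q.* Φ g) ≡
    R.ΣF n (λ x → R.ΣV K' n (λ g → (R.𝕀 (V? g) Q.* R.ind (M g x)) Q.* Φ g))
  Σ-mark {K'} V V? M m hm Φ = begin
    ℕtoℚ m Q.* R.ΣV K' n (λ g → R.𝕀 (V? g) Q.* Φ g) ≡⟨ R.Σ-*ˡ (allVec K' n) (ℕtoℚ m) (λ g → R.𝕀 (V? g) Q.* Φ g) ⟩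
    R.ΣV K' n (λ g → ℕtoℚ m Q.* (R.𝕀 (V? g) Q.* Φ g)) ≡⟨ R.ΣV-cong K' n (λ g → count-marks g (V? g)) ⟩
    R.ΣV K' n (λ g → R.ΣF n (λ x → (R.𝕀 (V? g) Q.* R.ind (M g x)) Q.* Φ g)) ≡⟨ R.Σ-swap (allVec K' n) (allFin n) (λ g x → (R.𝕀 (V? g) Q.* R.ind (M g x)) Q.* Φ g) ⟩
    R.ΣF n (λ x → R.ΣV K' n (λ g → (R.𝕀 (V? g) Q.* R.ind (M g x)) Q.* Φ g)) ∎
    where
    open ≡-Reasoning
    count-marks : ∀ g (d : Dec (V g)) → ℕtoℚ m Q.* (R.𝕀 d Q.* Φ g) ≡ R.ΣF n (λ x → (R.𝕀 d Q.* R.ind (M g x)) Q.* Φ g)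
    count-marks g (no _) = trans (cong (ℕtoℚ m Q.*_) (QP.*-zeroˡ (Φ g))) (trans (QP.*-zeroʳ (ℕtoℚ m))
                    (sym (trans (R.ΣF-cong n (λ x → trans (cong (Q._* Φ g) (QP.*-zeroˡ (R.ind (M g x)))) (QP.*-zeroˡ (Φ g)))) (R.Σ-0 (allFin n)))))
    count-marks g (yes v) = begin
      ℕtoℚ m Q.* (Q.1ℚ Q.* Φ g) ≡⟨ cong (λ t → ℕtoℚ t Q.* (Q.1ℚ Q.* Φ g)) (sym (hm g v)) ⟩
      ℕtoℚ (count (M g)) Q.* (Q.1ℚ Q.* Φ g) ≡⟨ cong₂ Q._*_ (ℕtoℚ-count (M g)) (QP.*-identityˡ (Φ g)) ⟩
      R.ΣF n (λ x → R.ind (M g x)) Q.* Φ g ≡⟨ R.Σ-*ʳ (allFin n) (Φ g) (λ x → R.ind (M g x)) ⟩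
      R.ΣF n (λ x → R.ind (M g x) Q.* Φ g) ≡⟨ R.ΣF-cong n (λ x → cong (Q._* Φ g) (sym (QP.*-identityˡ (R.ind (M g x))))) ⟩
      R.ΣF n (λ x → (Q.1ℚ Q.* R.ind (M g x)) Q.* Φ g) ∎

  -- Substitution g ↦ fill S 0 g: the labellings that carry the last label on
  -- S correspond to those vanishing on S.  This is the bijection behind both
  -- peeling steps.
  ΣV-peel : ∀ (S : Fin n → Bool) K (F : Vec (Fin (suc K)) n → Q.ℚ) →
    (∀ g → fill S zero g ≢ g → F g ≡ Q.0ℚ) →
    R.ΣV (suc K) n (λ g → R.𝕀 (fill S (Fin.fromℕ K) g ≟V g) Q.* F (fill S zero g)) ≡ R.ΣV (suc K) n F
  ΣV-peel S K F F-off = begin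
    R.ΣV (suc K) n (λ g → R.𝕀 (fill S (Fin.fromℕ K) g ≟V g) Q.* F (fill S zero g))
      ≡⟨ R.ΣV-refill (suc K) n S (Fin.fromℕ K) zero (λ g → F (fill S zero g)) ⟩
    R.ΣV (suc K) n (λ g → R.𝕀 (fill S zero g ≟V g) Q.* F (fill S zero (fill S (Fin.fromℕ K) g)))
      ≡⟨ R.ΣV-cong (suc K) n (λ g → cong (λ t → R.𝕀 (fill S zero g ≟V g) Q.* F t) (fill-fill S zero (Fin.fromℕ K) g)) ⟩
    R.ΣV (suc K) n (λ g → R.𝕀 (fill S zero g ≟V g) Q.* F (fill S zero g))
      ≡⟨ R.ΣV-cong (suc K) n (λ g → fixed g (fill S zero g ≟V g)) ⟩
    R.ΣV (suc K) n F ∎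
    where
    open ≡-Reasoning
    fixed : ∀ g (d : Dec (fill S zero g ≡ g)) → R.𝕀 d Q.* F (fill S zero g) ≡ F g
    fixed g (yes eq) = trans (QP.*-identityˡ (F (fill S zero g))) (cong F eq)
    fixed g (no ne) = trans (QP.*-zeroˡ (F (fill S zero g))) (sym (F-off g ne))

  -- The pairs (g, x) with g a P-partition of X with content c·(1+b) and x in
  -- its last fibre correspond, by erasing ↑x, to the P-partitions of X ∖ ↑x
  -- with content c·(1+b-|↑x|) (and |↑x| ≤ 1+b).
  module PeelPPart (X : Fin n → Bool) (L : ℕ) (c : Fin (suc L) → ℕ) (b : ℕ) (cb : c (Fin.fromℕ L) ≡ suc b) (x : Fin n) where
    open Peel X x L
    c' : Fin (suc L) → ℕ
    c' = setLast c (suc b ℕ.∸ upSize X x)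

    erasedTerm : Vec Label n → Q.ℚ
    erasedTerm g = R.ind (X x) Q.* (R.ind (does (upSize X x ℕ.≤? suc b)) Q.* R.𝕀 (IsPPart? X' c' g))

    erasedTerm-off-image : ∀ g → fill Ux zero g ≢ g → erasedTerm g ≡ Q.0ℚ
    erasedTerm-off-image g ne = trans (cong (λ t → R.ind (X x) Q.* (R.ind (does (upSize X x ℕ.≤? suc b)) Q.* t)) (R.𝕀-no (λ v → ne (erase-id g (proj₁ v))) (IsPPart? X' c' g)))
                (trans (cong (R.ind (X x) Q.*_) (QP.*-zeroʳ (R.ind (does (upSize X x ℕ.≤? suc b))))) (QP.*-zeroʳ (R.ind (X x))))

    to : ∀ g → IsPPart X c g × (g ! x ≡ last) → (fill Ux last g ≡ g) × ((X x ≡ true) × ((upSize X x ℕ.≤ suc b) × IsPPart X' c' (erase g)))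
    to g ((oo , mo , ct) , gx) = fill-last-id g tf , Xx , u≤ , (Support-erase g oo , Monotone-erase g mo , ct')
      where
      Xx = x∈X g oo gx
      tf = LastOnUx-mono g mo Xx gx
      dec : suc b ≡ upSize X x ℕ.+ count (fibre (erase g) last)
      dec = trans (sym (trans (ct (Fin.fromℕ L)) cb)) (count-last g tf)
      u≤ : upSize X x ℕ.≤ suc b
      u≤ = subst (upSize X x ℕ.≤_) (sym dec) (NP.m≤m+n (upSize X x) _)
      rest : count (fibre (erase g) last) ≡ suc b ℕ.∸ upSize X x
      rest = trans (sym (NP.m+n∸m≡n (upSize X x) _)) (cong (ℕ._∸ upSize X x) (sym dec))
      ct' : Content c' (erase g)
      ct' i with lastView i
      ... | inj₁ refl = trans rest (sym (setLast-last c (suc b ℕ.∸ upSize X x)))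
      ... | inj₂ (j , refl) = trans (count-cong (fibre-erase g tf j)) (trans (ct (Fin.inject₁ j)) (sym (setLast-inject₁ c _ j)))

    from : ∀ g → (fill Ux last g ≡ g) × ((X x ≡ true) × ((upSize X x ℕ.≤ suc b) × IsPPart X' c' (erase g))) → IsPPart X c g × (g ! x ≡ last)
    from g (eq , Xx , u≤ , (oo , mo , ct)) = (Support-erase⁻ g tf oo , Monotone-erase⁻ g tf mo , ct') , x-last g tf Xx
      where
      tf = LastOnUx-fill g eq
      ct' : Content c g
      ct' i with lastView i
      ... | inj₁ refl = trans (count-last g tf) (trans (cong (upSize X x ℕ.+_) (trans (ct (Fin.fromℕ L)) (setLast-last c _))) (trans (NP.m+[n∸m]≡n u≤) (sym cb)))
      ... | inj₂ (j , refl) = trans (sym (count-cong (fibre-erase g tf j))) (trans (ct (Fin.inject₁ j)) (setLast-inject₁ c _ j))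

    marked≡erased : ∀ g → R.𝕀 (IsPPart? X c g) Q.* R.ind (fibre g last x) ≡ R.𝕀 (fill Ux last g ≟V g) Q.* erasedTerm (erase g)
    marked≡erased g = begin
      R.𝕀 (IsPPart? X c g) Q.* R.ind (fibre g last x) ≡⟨ sym (R.ind-∧ (does (IsPPart? X c g)) (fibre g last x)) ⟩
      R.𝕀 (IsPPart? X c g ×-dec (g ! x Fin.≟ last)) ≡⟨ R.𝕀-cong (to g) (from g) (IsPPart? X c g ×-dec (g ! x Fin.≟ last)) D ⟩
      R.𝕀 D ≡⟨ R.ind-∧ (does (fill Ux last g ≟V g)) _ ⟩
      R.𝕀 (fill Ux last g ≟V g) Q.* R.ind (does (X x BP.≟ true) ∧ (does (upSize X x ℕ.≤? suc b) ∧ does (IsPPart? X' c' (erase g))))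
        ≡⟨ cong (R.𝕀 (fill Ux last g ≟V g) Q.*_) (trans (R.ind-∧ (does (X x BP.≟ true)) _) (cong₂ Q._*_ (cong R.ind (does≟true (X x))) (R.ind-∧ (does (upSize X x ℕ.≤? suc b)) _))) ⟩
      R.𝕀 (fill Ux last g ≟V g) Q.* erasedTerm (erase g) ∎
      where
      open ≡-Reasoning
      D = (fill Ux last g ≟V g) ×-dec ((X x BP.≟ true) ×-dec ((upSize X x ℕ.≤? suc b) ×-dec IsPPart? X' c' (erase g)))

    peel : R.ΣV (suc (suc L)) n (λ g → (R.𝕀 (IsPPart? X c g) Q.* R.ind (fibre g last x)) Q.* Q.1ℚ) ≡
             R.ind (X x) Q.* (R.ind (does (upSize X x ℕ.≤? suc b)) Q.* ppCount X' (suc L) c')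
    peel = begin
      R.ΣV (suc (suc L)) n (λ g → (R.𝕀 (IsPPart? X c g) Q.* R.ind (fibre g last x)) Q.* Q.1ℚ) ≡⟨ R.ΣV-cong (suc (suc L)) n (λ g → trans (QP.*-identityʳ _) (marked≡erased g)) ⟩
      R.ΣV (suc (suc L)) n (λ g → R.𝕀 (fill Ux last g ≟V g) Q.* erasedTerm (erase g)) ≡⟨ ΣV-peel (Up X x) (suc L) erasedTerm erasedTerm-off-image ⟩
      R.ΣV (suc (suc L)) n erasedTerm ≡⟨ sym (R.Σ-*ˡ (allVec (suc (suc L)) n) (R.ind (X x)) _) ⟩
      R.ind (X x) Q.* R.ΣV (suc (suc L)) n (λ g → R.ind (does (upSize X x ℕ.≤? suc b)) Q.* R.𝕀 (IsPPart? X' c' g)) ≡⟨ cong (R.ind (X x) Q.*_) (sym (R.Σ-*ˡ (allVec (suc (suc L)) n) (R.ind (does (upSize X x ℕ.≤? suc b))) _)) ⟩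
      R.ind (X x) Q.* (R.ind (does (upSize X x ℕ.≤? suc b)) Q.* ppCount X' (suc L) c') ∎
      where open ≡-Reasoning

  -- The peeling recursion for P-partitions:
  --   (1+b) · ppCount X c = Σ_{x ∈ X, |↑x| ≤ 1+b} ppCount (X ∖ ↑x) c',
  -- obtained by marking a point x of the last fibre of g.
  ppCount-peel : ∀ X L c b → c (Fin.fromℕ L) ≡ suc b → ℕtoℚ (suc b) Q.* ppCount X (suc L) c ≡
          R.ΣF n (λ x → R.ind (X x) Q.* (R.ind (does (upSize X x ℕ.≤? suc b)) Q.* ppCount (Down X x) (suc L) (setLast c (suc b ℕ.∸ upSize X x))))
  ppCount-peel X L c b cb = begin
    ℕtoℚ (suc b) Q.* ppCount X (suc L) c ≡⟨ cong (ℕtoℚ (suc b) Q.*_) (R.ΣV-cong (suc (suc L)) n (λ g → sym (QP.*-identityʳ (R.𝕀 (IsPPart? X c g))))) ⟩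
    ℕtoℚ (suc b) Q.* R.ΣV (suc (suc L)) n (λ g → R.𝕀 (IsPPart? X c g) Q.* Q.1ℚ)
      ≡⟨ Σ-mark (IsPPart X c) (IsPPart? X c) (λ g → fibre g (Fin.fromℕ (suc L))) (suc b) (λ g v → trans (proj₂ (proj₂ v) (Fin.fromℕ L)) cb) (λ _ → Q.1ℚ) ⟩
    R.ΣF n (λ x → R.ΣV (suc (suc L)) n (λ g → (R.𝕀 (IsPPart? X c g) Q.* R.ind (fibre g (Fin.fromℕ (suc L)) x)) Q.* Q.1ℚ)) ≡⟨ R.ΣF-cong n (λ x → PeelPPart.peel X L c b cb x) ⟩
    R.ΣF n (λ x → R.ind (X x) Q.* (R.ind (does (upSize X x ℕ.≤? suc b)) Q.* ppCount (Down X x) (suc L) (setLast c (suc b ℕ.∸ upSize X x)))) ∎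
    where open ≡-Reasoning

  weight-cong : ∀ k (α α' : Fin k → ℕ) L (c c' : Fin L → ℕ) → (∀ i → α i ≡ α' i) → (∀ i → c i ≡ c' i) → weight k α L c ≡ weight k α' L c'
  weightStep-cong : ∀ k (α α' : Fin k → ℕ) L (c c' : Fin (suc L) → ℕ) v → (∀ i → α i ≡ α' i) → (∀ i → c i ≡ c' i) → weightStep k α L c v ≡ weightStep k α' L c' v
  weight-cong k α α' zero c c' ea ec = refl
  weight-cong k α α' (suc L) c c' ea ec = trans (weightStep-cong k α α' L c c' (c (Fin.fromℕ L)) ea ec) (cong (weightStep k α' L c') (ec (Fin.fromℕ L)))
  weightStep-cong k α α' L c c' zero ea ec = weight-cong k α α' L _ _ ea (λ i → ec (Fin.inject₁ i))
  weightStep-cong zero α α' L c c' (suc b) ea ec = refl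
  weightStep-cong (suc k) α α' L c c' (suc b) ea ec =
    trans (cong (λ t → R.ind (does (t ℕ.≤? suc b)) Q.* (inv (suc b) Q.* weight k (λ i → α (Fin.inject₁ i)) (suc L) (setLast c (suc b ℕ.∸ t)))) (ea (Fin.fromℕ k)))
          (cong (λ t → R.ind (does (α' (Fin.fromℕ k) ℕ.≤? suc b)) Q.* (inv (suc b) Q.* t))
                (weight-cong k _ _ (suc L) _ _ (λ i → ea (Fin.inject₁ i)) (λ i → cong (if does (i Fin.≟ Fin.fromℕ L) then suc b ℕ.∸ α' (Fin.fromℕ k) else_) (ec i))))

  lowerV : ∀ {k} → Vec (Fin (suc (suc k))) n → Vec (Fin (suc k)) n
  lowerV = Vec.map lower

  lowerV-inject₁ : ∀ {k} (g' : Vec (Fin (suc k)) n) → lowerV (Vec.map Fin.inject₁ g') ≡ g'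
  lowerV-inject₁ g' = vext _ _ (λ y → trans (VP.lookup-map y lower (Vec.map Fin.inject₁ g')) (trans (cong lower (lookup-map-inj g' y)) (lower-inject₁ (g' ! y))))

  inject₁-lowerV : ∀ {k} (hh : Vec (Fin (suc (suc k))) n) → avoids (Fin.fromℕ (suc k)) hh ≡ true → Vec.map Fin.inject₁ (lowerV hh) ≡ hh
  inject₁-lowerV hh av = vext _ _ (λ y → trans (lookup-map-inj (lowerV hh) y) (trans (cong Fin.inject₁ (VP.lookup-map y lower hh)) (inject₁-lower (hh ! y) (avoids-elim _ hh av y))))

  IsMin-cong : ∀ {U U' : Fin n → Bool} → (∀ y → U y ≡ U' y) → ∀ m → does (IsMin? U m) ≡ does (IsMin? U' m)
  IsMin-cong {U} {U'} e m = does-cong (λ { (a , b) → trans (sym (e m)) a , (λ y t → b y (trans (e y) t)) })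
                                    (λ { (a , b) → trans (e m) a , (λ y t → b y (trans (sym (e y)) t)) }) (IsMin? U m) (IsMin? U' m)

  -- The pairs (g, x) with g ∈ 𝒪*(X) with k'+1 blocks and x the minimum of
  -- its last fibre correspond, by erasing ↑x, to the maps in 𝒪*(X ∖ ↑x) with
  -- k' blocks; the last fibre of g is then exactly ↑x.
  module PeelOStar (X : Fin n → Bool) (L : ℕ) (c : Fin (suc L) → ℕ) (b : ℕ) (cb : c (Fin.fromℕ L) ≡ suc b) (k' : ℕ) (x : Fin n) where
    open Peel X x k'
    c' : Fin (suc L) → ℕ
    c' = setLast c (suc b ℕ.∸ upSize X x)
    weightErased : Vec Label n → Q.ℚ
    weightErased hh = weight k' (blockSizes (lowerV hh)) (suc L) c'
    erasedOK? : ∀ hh → Dec ((X x ≡ true) × ((avoids last hh ≡ true) × ((upSize X x ℕ.≤ suc b) × IsOStarOn X' (lowerV hh))))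
    erasedOK? hh = (X x BP.≟ true) ×-dec ((avoids last hh BP.≟ true) ×-dec ((upSize X x ℕ.≤? suc b) ×-dec IsOStarOn? X' (lowerV hh)))
    erasedTerm : Vec Label n → Q.ℚ
    erasedTerm hh = R.𝕀 (erasedOK? hh) Q.* weightErased hh
    weightRest : Vec Label n → Q.ℚ
    weightRest g = weight k' (λ i → blockSizes g (Fin.inject₁ i)) (suc L) (setLast c (suc b ℕ.∸ count (fibre g last)))
    peeledWeight : Vec Label n → Q.ℚ
    peeledWeight g = R.ind (does (count (fibre g last) ℕ.≤? suc b)) Q.* weightRest g

    MarkedOStar : Vec Label n → Set
    MarkedOStar g = IsOStarOn X g × (IsMin (fibre g last) x × (count (fibre g last) ℕ.≤ suc b))
    MarkedOStar? : ∀ g → Dec (MarkedOStar g)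
    MarkedOStar? g = IsOStarOn? X g ×-dec (IsMin? (fibre g last) x ×-dec (count (fibre g last) ℕ.≤? suc b))
    ErasedOStar : Vec Label n → Set
    ErasedOStar g = (fill Ux last g ≡ g) × ((X x ≡ true) × ((avoids last (erase g) ≡ true) × ((upSize X x ℕ.≤ suc b) × IsOStarOn X' (lowerV (erase g)))))

    fibre-lower : ∀ g → LastOnUx g → avoids last (erase g) ≡ true → ∀ j y → fibre g (suc (Fin.inject₁ j)) y ≡ fibre (lowerV (erase g)) (suc j) y
    fibre-lower g tf av j y = trans (sym (fibre-erase g tf j y))
      (trans (cong (λ t → fibre t (suc (Fin.inject₁ j)) y) (sym (inject₁-lowerV (erase g) av))) (fibre-inject₁ (lowerV (erase g)) (suc j) y))

    lastFibre≡Ux : ∀ g → LastOnUx g → avoids last (erase g) ≡ true → ∀ y → fibre g last y ≡ Ux y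
    lastFibre≡Ux g tf av y with Ux y in Sy
    ... | true = dec-true (g ! y Fin.≟ last) (tf y Sy)
    ... | false = dec-false (g ! y Fin.≟ last) (λ e → avoids-elim last (erase g) av y (trans (erase-off-Ux g y Sy) e))

    count-lastFibre : ∀ g → LastOnUx g → avoids last (erase g) ≡ true → count (fibre g last) ≡ upSize X x
    count-lastFibre g tf av = count-cong (lastFibre≡Ux g tf av)

    marked-facts : ∀ g → MarkedOStar g → LastOnUx g × (avoids last (erase g) ≡ true) × (X x ≡ true)
    marked-facts g ((oo , mo , su , um) , minx , le) = tf , av , Xx
      where
      gx : g ! x ≡ last
      gx = does-yes (g ! x Fin.≟ last) (proj₁ minx)
      Xx = x∈X g oo gx
      tf = LastOnUx-mono g mo Xx gx
      key : ∀ y → g ! y ≡ last → Ux y ≡ true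
      key y e with unique-min-least (fibre g last) x minx (um (Fin.fromℕ k')) y (dec-true (g ! y Fin.≟ last) e)
      ... | x≤y rewrite trans (oo y) (cong isSuc e) = dec-true (x ≤P? y) x≤y
      av : avoids last (erase g) ≡ true
      av = avoids-intro last (erase g) lem
        where
        lem : ∀ y → erase g ! y ≢ last
        lem y e with Ux y in Sy
        ... | true = zero≢last (trans (sym (erase-on-Ux g y Sy)) e)
          where zero≢last : Fin.zero ≢ last
                zero≢last ()
        ... | false = true≢false (trans (sym (key y (trans (sym (erase-off-Ux g y Sy)) e))) Sy)

    to : ∀ g → MarkedOStar g → ErasedOStar g
    to g pg@((oo , mo , su , um) , minx , le) = fill-last-id g tf , Xx , av , subst (ℕ._≤ suc b) (count-lastFibre g tf av) le , (oo' , mo' , su' , um')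
      where
      fs = marked-facts g pg
      tf = proj₁ fs
      av = proj₁ (proj₂ fs)
      Xx = proj₂ (proj₂ fs)
      g' = lowerV (erase g)
      hq = inject₁-lowerV (erase g) av
      oo' : Support X' g'
      oo' = Support-inject₁ X' g' (subst (Support X') (sym hq) (Support-erase g oo))
      mo' : Monotone X' g'
      mo' = Monotone-inject₁ X' g' (subst (Monotone X') (sym hq) (Monotone-erase g mo))
      su' : Onto g'
      su' i with su (Fin.inject₁ i)
      ... | y , e = y , does-yes (g' ! y Fin.≟ suc i) (trans (sym (fibre-lower g tf av i y)) (dec-true (g ! y Fin.≟ suc (Fin.inject₁ i)) e))
      um' : UniqueMins g'
      um' i = trans (count-cong (λ m → IsMin-cong (λ y → sym (fibre-lower g tf av i y)) m)) (um (Fin.inject₁ i))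

    from : ∀ g → ErasedOStar g → MarkedOStar g
    from g (eq , Xx , av , u≤ , (oo' , mo' , su' , um')) = (oo , mo , su , um) , minFrom x refl , subst (ℕ._≤ suc b) (sym (count-lastFibre g tf av)) u≤
      where
      tf = LastOnUx-fill g eq
      g' = lowerV (erase g)
      hq = inject₁-lowerV (erase g) av
      tfU = lastFibre≡Ux g tf av
      gx = x-last g tf Xx
      oo : Support X g
      oo = Support-erase⁻ g tf (subst (Support X') hq (Support-inject₁⁻ X' g' oo'))
      mo : Monotone X g
      mo = Monotone-erase⁻ g tf (subst (Monotone X') hq (Monotone-inject₁⁻ X' g' mo'))
      su : Onto g
      su i with lastView i
      ... | inj₁ refl = x , gx
      ... | inj₂ (j , refl) with su' j
      ... | y , e = y , does-yes (g ! y Fin.≟ suc (Fin.inject₁ j)) (trans (fibre-lower g tf av j y) (dec-true (g' ! y Fin.≟ suc j) e))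
      Ux→x≤ : ∀ y → Ux y ≡ true → x ≤P y
      Ux→x≤ y e with X y | x ≤P? y
      Ux→x≤ y e | true | yes p = p
      Ux→x≤ y () | true | no _
      Ux→x≤ y () | false | _
      fx : fibre g last x ≡ true
      fx = dec-true (g ! x Fin.≟ last) gx
      minFrom : ∀ m → m ≡ x → IsMin (fibre g last) m
      minFrom m refl = fx , (λ y fy y<x → proj₂ y<x (antisym (proj₁ y<x) (Ux→x≤ y (trans (sym (tfU y)) fy))))
      minTo : ∀ m → IsMin (fibre g last) m → m ≡ x
      minTo m (fm , mn) with x Fin.≟ m
      ... | yes e = sym e
      ... | no ne = ⊥-elim (mn x fx (Ux→x≤ m (trans (sym (tfU m)) fm) , ne))
      um : UniqueMins g
      um i with lastView i
      ... | inj₁ refl = trans (count-cong (λ m → does-cong (minTo m) (minFrom m) (IsMin? (fibre g last) m) (m Fin.≟ x))) (count-δ x)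
      ... | inj₂ (j , refl) = trans (count-cong (λ m → IsMin-cong (fibre-lower g tf av j) m)) (um' j)

    weight-erase : ∀ g → MarkedOStar g → weightRest g ≡ weightErased (erase g)
    weight-erase g pg = weight-cong k' _ _ (suc L) _ _ (λ i → count-cong (fibre-lower g tf av i)) (λ i → cong (λ t → setLast c (suc b ℕ.∸ t) i) (count-lastFibre g tf av))
      where
      fs = marked-facts g pg
      tf = proj₁ fs
      av = proj₁ (proj₂ fs)

    erasedTerm-off-image : ∀ hh → fill Ux zero hh ≢ hh → erasedTerm hh ≡ Q.0ℚ
    erasedTerm-off-image hh ne = trans (cong (Q._* weightErased hh) (R.𝕀-no lem (erasedOK? hh))) (QP.*-zeroˡ (weightErased hh))
      where
      lem : ¬ ((X x ≡ true) × ((avoids last hh ≡ true) × ((upSize X x ℕ.≤ suc b) × IsOStarOn X' (lowerV hh))))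
      lem (_ , av , _ , (oo , _)) = ne (erase-id hh (subst (Support X') (inject₁-lowerV hh av) (Support-inject₁⁻ X' (lowerV hh) oo)))

    marked≡erased : ∀ g → (R.𝕀 (IsOStarOn? X g) Q.* R.ind (does (IsMin? (fibre g last) x))) Q.* peeledWeight g ≡ R.𝕀 (fill Ux last g ≟V g) Q.* erasedTerm (erase g)
    marked≡erased g = begin
      (R.𝕀 (IsOStarOn? X g) Q.* R.ind (does (IsMin? (fibre g last) x))) Q.* (R.ind (does (count (fibre g last) ℕ.≤? suc b)) Q.* weightRest g)
        ≡⟨ sym (QP.*-assoc (R.𝕀 (IsOStarOn? X g) Q.* R.ind (does (IsMin? (fibre g last) x))) (R.ind (does (count (fibre g last) ℕ.≤? suc b))) (weightRest g)) ⟩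
      ((R.𝕀 (IsOStarOn? X g) Q.* R.ind (does (IsMin? (fibre g last) x))) Q.* R.ind (does (count (fibre g last) ℕ.≤? suc b))) Q.* weightRest g
        ≡⟨ cong (Q._* weightRest g) (trans (QP.*-assoc (R.𝕀 (IsOStarOn? X g)) (R.ind (does (IsMin? (fibre g last) x))) (R.ind (does (count (fibre g last) ℕ.≤? suc b))))
             (trans (cong (R.𝕀 (IsOStarOn? X g) Q.*_) (sym (R.ind-∧ (does (IsMin? (fibre g last) x)) _))) (sym (R.ind-∧ (does (IsOStarOn? X g)) _)))) ⟩
      R.𝕀 (MarkedOStar? g) Q.* weightRest g ≡⟨ R.condEq (MarkedOStar? g) ((fill Ux last g ≟V g) ×-dec erasedOK? (erase g)) (weightRest g) (weightErased (erase g)) (to g) (from g) (weight-erase g) ⟩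
      R.𝕀 ((fill Ux last g ≟V g) ×-dec erasedOK? (erase g)) Q.* weightErased (erase g) ≡⟨ cong (Q._* weightErased (erase g)) (R.ind-∧ (does (fill Ux last g ≟V g)) (does (erasedOK? (erase g)))) ⟩
      (R.𝕀 (fill Ux last g ≟V g) Q.* R.𝕀 (erasedOK? (erase g))) Q.* weightErased (erase g) ≡⟨ QP.*-assoc (R.𝕀 (fill Ux last g ≟V g)) (R.𝕀 (erasedOK? (erase g))) (weightErased (erase g)) ⟩
      R.𝕀 (fill Ux last g ≟V g) Q.* erasedTerm (erase g) ∎
      where open ≡-Reasoning

    loweredTerm : Vec Label n → Q.ℚ
    loweredTerm hh = R.ind (does (upSize X x ℕ.≤? suc b)) Q.* (R.𝕀 (IsOStarOn? X' (lowerV hh)) Q.* weightErased hh)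

    erasedTerm-split : ∀ hh → erasedTerm hh ≡ R.ind (X x) Q.* (R.ind (avoids last hh) Q.* loweredTerm hh)
    erasedTerm-split hh = begin
      R.𝕀 (erasedOK? hh) Q.* weightErased hh ≡⟨ cong (Q._* weightErased hh) (trans (R.ind-∧ a1 (does (d2 ×-dec (d3 ×-dec d4)))) (cong (R.ind a1 Q.*_) (trans (R.ind-∧ (does d2) (does (d3 ×-dec d4))) (cong (R.ind (does d2) Q.*_) (R.ind-∧ (does d3) (does d4)))))) ⟩
      (R.ind (does (X x BP.≟ true)) Q.* (R.ind (does (avoids last hh BP.≟ true)) Q.* (R.ind (does (upSize X x ℕ.≤? suc b)) Q.* R.𝕀 (IsOStarOn? X' (lowerV hh))))) Q.* weightErased hh
        ≡⟨ assoc4 (R.ind (does (X x BP.≟ true))) (R.ind (does (avoids last hh BP.≟ true))) (R.ind (does (upSize X x ℕ.≤? suc b))) (R.𝕀 (IsOStarOn? X' (lowerV hh))) (weightErased hh) ⟩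
      R.ind (does (X x BP.≟ true)) Q.* (R.ind (does (avoids last hh BP.≟ true)) Q.* loweredTerm hh)
        ≡⟨ cong₂ (λ s t → R.ind s Q.* (R.ind t Q.* loweredTerm hh)) (does≟true (X x)) (does≟true (avoids last hh)) ⟩
      R.ind (X x) Q.* (R.ind (avoids last hh) Q.* loweredTerm hh) ∎
      where
      open ≡-Reasoning
      a1 = does (X x BP.≟ true)
      d2 = avoids last hh BP.≟ true
      d3 = upSize X x ℕ.≤? suc b
      d4 = IsOStarOn? X' (lowerV hh)

    peel : R.ΣV (suc (suc k')) n (λ g → (R.𝕀 (IsOStarOn? X g) Q.* R.ind (does (IsMin? (fibre g last) x))) Q.* peeledWeight g) ≡
             R.ind (X x) Q.* (R.ind (does (upSize X x ℕ.≤? suc b)) Q.* oWeight X' k' (suc L) c')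
    peel = begin
      R.ΣV (suc (suc k')) n (λ g → (R.𝕀 (IsOStarOn? X g) Q.* R.ind (does (IsMin? (fibre g last) x))) Q.* peeledWeight g) ≡⟨ R.ΣV-cong (suc (suc k')) n marked≡erased ⟩
      R.ΣV (suc (suc k')) n (λ g → R.𝕀 (fill Ux last g ≟V g) Q.* erasedTerm (erase g)) ≡⟨ ΣV-peel (Up X x) (suc k') erasedTerm erasedTerm-off-image ⟩
      R.ΣV (suc (suc k')) n erasedTerm ≡⟨ R.ΣV-cong (suc (suc k')) n erasedTerm-split ⟩
      R.ΣV (suc (suc k')) n (λ hh → R.ind (X x) Q.* (R.ind (avoids last hh) Q.* loweredTerm hh)) ≡⟨ sym (R.Σ-*ˡ (allVec (suc (suc k')) n) (R.ind (X x)) (λ hh → R.ind (avoids last hh) Q.* loweredTerm hh)) ⟩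
      R.ind (X x) Q.* R.ΣV (suc (suc k')) n (λ hh → R.ind (avoids last hh) Q.* loweredTerm hh) ≡⟨ cong (R.ind (X x) Q.*_) (R.ΣV-avoiding (suc k') n last Fin.inject₁ (R.ΣF-avoid-last (suc k')) loweredTerm) ⟩
      R.ind (X x) Q.* R.ΣV (suc k') n (λ g' → loweredTerm (Vec.map Fin.inject₁ g')) ≡⟨ cong (R.ind (X x) Q.*_) (R.ΣV-cong (suc k') n (λ g' → cong (λ t → R.ind (does (upSize X x ℕ.≤? suc b)) Q.* (R.𝕀 (IsOStarOn? X' t) Q.* weight k' (blockSizes t) (suc L) c')) (lowerV-inject₁ g'))) ⟩
      R.ind (X x) Q.* R.ΣV (suc k') n (λ g' → R.ind (does (upSize X x ℕ.≤? suc b)) Q.* (R.𝕀 (IsOStarOn? X' g') Q.* weight k' (blockSizes g') (suc L) c'))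
        ≡⟨ cong (R.ind (X x) Q.*_) (sym (R.Σ-*ˡ (allVec (suc k') n) (R.ind (does (upSize X x ℕ.≤? suc b))) (λ g' → R.𝕀 (IsOStarOn? X' g') Q.* weight k' (blockSizes g') (suc L) c'))) ⟩
      R.ind (X x) Q.* (R.ind (does (upSize X x ℕ.≤? suc b)) Q.* oWeight X' k' (suc L) c') ∎
      where open ≡-Reasoning

  weight-unfold : ∀ L (c : Fin (suc L) → ℕ) b → c (Fin.fromℕ L) ≡ suc b → ∀ k' (α : Fin (suc k') → ℕ) →
    weight (suc k') α (suc L) c ≡ R.ind (does (α (Fin.fromℕ k') ℕ.≤? suc b)) Q.* (inv (suc b) Q.* weight k' (λ i → α (Fin.inject₁ i)) (suc L) (setLast c (suc b ℕ.∸ α (Fin.fromℕ k'))))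
  weight-unfold L c b cb k' α = cong (weightStep (suc k') α L c) cb

  -- The peeling recursion for weighted 𝒪*-maps with k'+1 blocks, obtained by
  -- marking the unique minimum x of the last fibre.
  oWeight-peel : ∀ X L c b → c (Fin.fromℕ L) ≡ suc b → ∀ k' → ℕtoℚ (suc b) Q.* oWeight X (suc k') (suc L) c ≡
         R.ΣF n (λ x → R.ind (X x) Q.* (R.ind (does (upSize X x ℕ.≤? suc b)) Q.* oWeight (Down X x) k' (suc L) (setLast c (suc b ℕ.∸ upSize X x))))
  oWeight-peel X L c b cb k' = begin
    ℕtoℚ (suc b) Q.* R.ΣV labels n (λ g → R.𝕀 (IsOStarOn? X g) Q.* weight (suc k') (blockSizes g) (suc L) c)
      ≡⟨ R.Σ-*ˡ (allVec labels n) (ℕtoℚ (suc b)) (λ g → R.𝕀 (IsOStarOn? X g) Q.* weight (suc k') (blockSizes g) (suc L) c) ⟩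
    R.ΣV labels n (λ g → ℕtoℚ (suc b) Q.* (R.𝕀 (IsOStarOn? X g) Q.* weight (suc k') (blockSizes g) (suc L) c)) ≡⟨ R.ΣV-cong labels n unfold-last ⟩
    R.ΣV labels n (λ g → R.𝕀 (IsOStarOn? X g) Q.* peeledWeight g) ≡⟨ sym (QP.*-identityˡ _) ⟩
    ℕtoℚ 1 Q.* R.ΣV labels n (λ g → R.𝕀 (IsOStarOn? X g) Q.* peeledWeight g)
      ≡⟨ Σ-mark (IsOStarOn X) (IsOStarOn? X) (λ g m → does (IsMin? (fibre g last) m)) 1 (λ g v → proj₂ (proj₂ (proj₂ v)) (Fin.fromℕ k')) peeledWeight ⟩
    R.ΣF n (λ x → R.ΣV labels n (λ g → (R.𝕀 (IsOStarOn? X g) Q.* R.ind (does (IsMin? (fibre g last) x))) Q.* peeledWeight g)) ≡⟨ R.ΣF-cong n (λ x → PeelOStar.peel X L c b cb k' x) ⟩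
    R.ΣF n (λ x → R.ind (X x) Q.* (R.ind (does (upSize X x ℕ.≤? suc b)) Q.* oWeight (Down X x) k' (suc L) (setLast c (suc b ℕ.∸ upSize X x)))) ∎
    where
    open ≡-Reasoning
    labels = suc (suc k')
    last = Fin.fromℕ (suc k')
    peeledWeight : Vec (Fin labels) n → Q.ℚ
    peeledWeight g = R.ind (does (count (fibre g last) ℕ.≤? suc b)) Q.* weight k' (λ i → blockSizes g (Fin.inject₁ i)) (suc L) (setLast c (suc b ℕ.∸ count (fibre g last)))
    unfold-last : ∀ g → ℕtoℚ (suc b) Q.* (R.𝕀 (IsOStarOn? X g) Q.* weight (suc k') (blockSizes g) (suc L) c) ≡ R.𝕀 (IsOStarOn? X g) Q.* peeledWeight g
    unfold-last g = begin
      ℕtoℚ (suc b) Q.* (R.𝕀 (IsOStarOn? X g) Q.* weight (suc k') (blockSizes g) (suc L) c) ≡⟨ sym (QP.*-assoc (ℕtoℚ (suc b)) (R.𝕀 (IsOStarOn? X g)) _) ⟩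
      (ℕtoℚ (suc b) Q.* R.𝕀 (IsOStarOn? X g)) Q.* weight (suc k') (blockSizes g) (suc L) c ≡⟨ cong (Q._* weight (suc k') (blockSizes g) (suc L) c) (QP.*-comm (ℕtoℚ (suc b)) (R.𝕀 (IsOStarOn? X g))) ⟩
      (R.𝕀 (IsOStarOn? X g) Q.* ℕtoℚ (suc b)) Q.* weight (suc k') (blockSizes g) (suc L) c ≡⟨ QP.*-assoc (R.𝕀 (IsOStarOn? X g)) (ℕtoℚ (suc b)) _ ⟩
      R.𝕀 (IsOStarOn? X g) Q.* (ℕtoℚ (suc b) Q.* weight (suc k') (blockSizes g) (suc L) c) ≡⟨ cong (λ t → R.𝕀 (IsOStarOn? X g) Q.* (ℕtoℚ (suc b) Q.* t)) (weight-unfold L c b cb k' (blockSizes g)) ⟩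
      R.𝕀 (IsOStarOn? X g) Q.* (ℕtoℚ (suc b) Q.* (R.ind (does (count (fibre g last) ℕ.≤? suc b)) Q.* (inv (suc b) Q.* weight k' (λ i → blockSizes g (Fin.inject₁ i)) (suc L) (setLast c (suc b ℕ.∸ count (fibre g last))))))
        ≡⟨ cong (R.𝕀 (IsOStarOn? X g) Q.*_) (*-inv-cancel b (R.ind (does (count (fibre g last) ℕ.≤? suc b))) (weight k' (λ i → blockSizes g (Fin.inject₁ i)) (suc L) (setLast c (suc b ℕ.∸ count (fibre g last))))) ⟩
      R.𝕀 (IsOStarOn? X g) Q.* peeledWeight g ∎

  oWeight-no-blocks : ∀ X L c b → c (Fin.fromℕ L) ≡ suc b → oWeight X 0 (suc L) c ≡ Q.0ℚ
  oWeight-no-blocks X L c b cb = trans (R.ΣV-cong 1 n (λ g → trans (cong (R.𝕀 (IsOStarOn? X g) Q.*_) (no-parts (blockSizes g))) (QP.*-zeroʳ (R.𝕀 (IsOStarOn? X g))))) (R.Σ-0 (allVec 1 n))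
    where
    no-parts : ∀ α → weight 0 α (suc L) c ≡ Q.0ℚ
    no-parts α = cong (weightStep 0 α L c) cb

  oWeightUpTo-peel : ∀ X N L c b → c (Fin.fromℕ L) ≡ suc b → ℕtoℚ (suc b) Q.* oWeightUpTo X (suc N) (suc L) c ≡
          R.ΣF n (λ x → R.ind (X x) Q.* (R.ind (does (upSize X x ℕ.≤? suc b)) Q.* oWeightUpTo (Down X x) N (suc L) (setLast c (suc b ℕ.∸ upSize X x))))
  oWeightUpTo-peel X N L c b cb = begin
    ℕtoℚ (suc b) Q.* (oWeight X 0 (suc L) c Q.+ R.Σ (List.applyUpTo (λ i → suc i) N) (λ k → oWeight X k (suc L) c))
      ≡⟨ cong (ℕtoℚ (suc b) Q.*_) (cong₂ Q._+_ (oWeight-no-blocks X L c b cb) (R.Σ-applyUpTo-shift (λ k → oWeight X k (suc L) c) N (λ i → i))) ⟩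
    ℕtoℚ (suc b) Q.* (Q.0ℚ Q.+ R.Σ (List.upTo N) (λ k → oWeight X (suc k) (suc L) c)) ≡⟨ cong (ℕtoℚ (suc b) Q.*_) (QP.+-identityˡ _) ⟩
    ℕtoℚ (suc b) Q.* R.Σ (List.upTo N) (λ k → oWeight X (suc k) (suc L) c) ≡⟨ R.Σ-*ˡ (List.upTo N) (ℕtoℚ (suc b)) (λ k → oWeight X (suc k) (suc L) c) ⟩
    R.Σ (List.upTo N) (λ k → ℕtoℚ (suc b) Q.* oWeight X (suc k) (suc L) c) ≡⟨ R.Σ-cong (List.upTo N) (oWeight-peel X L c b cb) ⟩
    R.Σ (List.upTo N) (λ k → R.ΣF n (λ x → R.ind (X x) Q.* (R.ind (does (upSize X x ℕ.≤? suc b)) Q.* oWeight (Down X x) k (suc L) (peeled x))))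
      ≡⟨ R.Σ-swap (List.upTo N) (allFin n) (λ k x → R.ind (X x) Q.* (R.ind (does (upSize X x ℕ.≤? suc b)) Q.* oWeight (Down X x) k (suc L) (peeled x))) ⟩
    R.ΣF n (λ x → R.Σ (List.upTo N) (λ k → R.ind (X x) Q.* (R.ind (does (upSize X x ℕ.≤? suc b)) Q.* oWeight (Down X x) k (suc L) (peeled x))))
      ≡⟨ R.ΣF-cong n (λ x → trans (sym (R.Σ-*ˡ (List.upTo N) (R.ind (X x)) _)) (cong (R.ind (X x) Q.*_) (sym (R.Σ-*ˡ (List.upTo N) (R.ind (does (upSize X x ℕ.≤? suc b))) (λ k → oWeight (Down X x) k (suc L) (peeled x)))))) ⟩
    R.ΣF n (λ x → R.ind (X x) Q.* (R.ind (does (upSize X x ℕ.≤? suc b)) Q.* oWeightUpTo (Down X x) N (suc L) (peeled x))) ∎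
    where
    open ≡-Reasoning
    peeled = λ x → setLast c (suc b ℕ.∸ upSize X x)

  -- Both quantities satisfy the same recursion and base cases, hence agree
  -- by strong induction on |X| (bounded by N) and on the length of c.
  ppCount≡oWeightUpTo : ∀ N X → count X ℕ.< N → ∀ L c → ppCount X L c ≡ oWeightUpTo X N L c
  ppCount≡oWeightUpTo (suc N) X lt zero c = trans (ppCount-nil X c) (sym (oWeightUpTo-nil X N c))
  ppCount≡oWeightUpTo (suc N) X lt (suc L) c = by-last-entry (c (Fin.fromℕ L)) refl
    where
    by-last-entry : ∀ v → c (Fin.fromℕ L) ≡ v → ppCount X (suc L) c ≡ oWeightUpTo X (suc N) (suc L) c
    by-last-entry zero eq = trans (ppCount-last0 X L c eq) (trans (ppCount≡oWeightUpTo (suc N) X lt L (λ i → c (Fin.inject₁ i))) (sym (oWeightUpTo-last0 X (suc N) L c eq)))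
    by-last-entry (suc b) eq = *-cancelˡ-suc b (trans (ppCount-peel X L c b eq) (trans (R.ΣF-cong n induction) (sym (oWeightUpTo-peel X N L c b eq))))
      where
      induction : ∀ x → R.ind (X x) Q.* (R.ind (does (upSize X x ℕ.≤? suc b)) Q.* ppCount (Down X x) (suc L) (setLast c (suc b ℕ.∸ upSize X x)))
               ≡ R.ind (X x) Q.* (R.ind (does (upSize X x ℕ.≤? suc b)) Q.* oWeightUpTo (Down X x) N (suc L) (setLast c (suc b ℕ.∸ upSize X x)))
      induction x with X x in Xx
      ... | false = trans (QP.*-zeroˡ (R.ind (does (upSize X x ℕ.≤? suc b)) Q.* ppCount (Down X x) (suc L) (setLast c (suc b ℕ.∸ upSize X x))))
                      (sym (QP.*-zeroˡ (R.ind (does (upSize X x ℕ.≤? suc b)) Q.* oWeightUpTo (Down X x) N (suc L) (setLast c (suc b ℕ.∸ upSize X x)))))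
      ... | true = cong (λ t → Q.1ℚ Q.* (R.ind (does (upSize X x ℕ.≤? suc b)) Q.* t))
                     (ppCount≡oWeightUpTo N (Down X x) (NP.<-≤-trans (Down-smaller X x Xx) (NP.≤-pred lt)) (suc L) (setLast c (suc b ℕ.∸ upSize X x)))

module Weights where

  partialSumsFrom : ℕ → List ℕ → List ℕ
  partialSumsFrom s xs = List.drop 1 (partialSums (s ∷ xs))

  blocksFrom : ℕ → List ℕ → List (ℕ × ℕ)
  blocksFrom s xs = List.drop 1 (blocks (s ∷ xs))

  AllPos : List ℕ → Set
  AllPos = All (λ p → 0 ℕ.< p)

  sum-∷ʳ : ∀ xs x → sum (xs ∷ʳ x) ≡ sum xs ℕ.+ x
  sum-∷ʳ xs x = trans (LAP.sum-++ xs (x ∷ [])) (cong (sum xs ℕ.+_) (NP.+-identityʳ x))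

  partialSumsFrom-∷ʳ : ∀ s xs p → partialSumsFrom s (xs ∷ʳ p) ≡ partialSumsFrom s xs ∷ʳ (s ℕ.+ sum xs ℕ.+ p)
  partialSumsFrom-∷ʳ s [] p = cong (λ t → t ℕ.+ p ∷ []) (sym (NP.+-identityʳ s))
  partialSumsFrom-∷ʳ s (x ∷ xs) p = cong ((s ℕ.+ x) ∷_) (trans (partialSumsFrom-∷ʳ (s ℕ.+ x) xs p) (cong (λ t → partialSumsFrom (s ℕ.+ x) xs ∷ʳ (t ℕ.+ p)) (NP.+-assoc s x (sum xs))))

  blocksFrom-∷ʳ : ∀ s xs p → blocksFrom s (xs ∷ʳ p) ≡ blocksFrom s xs ∷ʳ (s ℕ.+ sum xs , s ℕ.+ sum xs ℕ.+ p)
  blocksFrom-∷ʳ s [] p = cong (λ t → (t , t ℕ.+ p) ∷ []) (sym (NP.+-identityʳ s))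
  blocksFrom-∷ʳ s (x ∷ xs) p = cong ((s , s ℕ.+ x) ∷_) (trans (blocksFrom-∷ʳ (s ℕ.+ x) xs p) (cong (λ t → blocksFrom (s ℕ.+ x) xs ∷ʳ (t , t ℕ.+ p)) (NP.+-assoc s x (sum xs))))

  length-partialSumsFrom : ∀ s xs → length (partialSumsFrom s xs) ≡ length xs
  length-partialSumsFrom s [] = refl
  length-partialSumsFrom s (x ∷ xs) = cong suc (length-partialSumsFrom (s ℕ.+ x) xs)

  length-blocksFrom : ∀ s xs → length (blocksFrom s xs) ≡ length xs
  length-blocksFrom s [] = refl
  length-blocksFrom s (x ∷ xs) = cong suc (length-blocksFrom (s ℕ.+ x) xs)

  take-∷ʳ : ∀ {A : Set} (ys : List A) y → take (length ys) (ys ∷ʳ y) ≡ ys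
  take-∷ʳ [] y = refl
  take-∷ʳ (x ∷ ys) y = cong (x ∷_) (take-∷ʳ ys y)

  length-∷ʳ : ∀ {A : Set} (ys : List A) y → length (ys ∷ʳ y) ≡ suc (length ys)
  length-∷ʳ [] y = refl
  length-∷ʳ (x ∷ ys) y = cong suc (length-∷ʳ ys y)

  S-∷ʳ : ∀ xs p → S (xs ∷ʳ p) ≡ partialSumsFrom 0 xs
  S-∷ʳ xs p = begin
    take (length (xs ∷ʳ p) ℕ.∸ 1) (partialSumsFrom 0 (xs ∷ʳ p)) ≡⟨ cong₂ (λ a b → take (a ℕ.∸ 1) b) (length-∷ʳ xs p) (partialSumsFrom-∷ʳ 0 xs p) ⟩
    take (length xs) (partialSumsFrom 0 xs ∷ʳ (sum xs ℕ.+ p)) ≡⟨ cong (λ t → take t (partialSumsFrom 0 xs ∷ʳ (sum xs ℕ.+ p))) (sym (length-partialSumsFrom 0 xs)) ⟩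
    take (length (partialSumsFrom 0 xs)) (partialSumsFrom 0 xs ∷ʳ (sum xs ℕ.+ p)) ≡⟨ take-∷ʳ (partialSumsFrom 0 xs) _ ⟩
    partialSumsFrom 0 xs ∎
    where open ≡-Reasoning

  snocView : ∀ {A : Set} (xs : List A) → (xs ≡ []) ⊎ Σ[ ys ∈ List A ] Σ[ y ∈ A ] (xs ≡ ys ∷ʳ y)
  snocView [] = inj₁ refl
  snocView (x ∷ xs) with snocView xs
  ... | inj₁ refl = inj₂ ([] , x , refl)
  ... | inj₂ (ys , y , refl) = inj₂ (x ∷ ys , y , refl)

  partialSums≡S∷ʳsum : ∀ xs → xs ≢ [] → partialSumsFrom 0 xs ≡ S xs ∷ʳ sum xs
  partialSums≡S∷ʳsum xs ne with snocView xs
  ... | inj₁ refl = ⊥-elim (ne refl)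
  ... | inj₂ (ys , y , refl) = trans (partialSumsFrom-∷ʳ 0 ys y) (cong₂ _∷ʳ_ (sym (S-∷ʳ ys y)) (sym (sum-∷ʳ ys y)))

  Mem : ℕ → List ℕ → Set
  Mem y xs = Any (y ≡_) xs

  partialSumsFrom-≤ : ∀ s xs y → Mem y (partialSumsFrom s xs) → y ℕ.≤ s ℕ.+ sum xs
  partialSumsFrom-≤ s (x ∷ xs) y (here refl) = NP.+-monoʳ-≤ s (NP.m≤m+n x (sum xs))
  partialSumsFrom-≤ s (x ∷ xs) y (there m) = subst (y ℕ.≤_) (NP.+-assoc s x (sum xs)) (partialSumsFrom-≤ (s ℕ.+ x) xs y m)

  partialSumsFrom-> : ∀ s xs y → AllPos xs → Mem y (partialSumsFrom s xs) → s ℕ.< y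
  partialSumsFrom-> s (x ∷ xs) y (px ∷ _) (here refl) = subst (ℕ._≤ s ℕ.+ x) (NP.+-comm s 1) (NP.+-monoʳ-≤ s px)
  partialSumsFrom-> s (x ∷ xs) y (px ∷ pxs) (there m) = NP.<-trans (subst (ℕ._≤ s ℕ.+ x) (NP.+-comm s 1) (NP.+-monoʳ-≤ s px)) (partialSumsFrom-> (s ℕ.+ x) xs y pxs m)

  partialSumsFrom-last : ∀ s xs → xs ≢ [] → Mem (s ℕ.+ sum xs) (partialSumsFrom s xs)
  partialSumsFrom-last s [] ne = ⊥-elim (ne refl)
  partialSumsFrom-last s (x ∷ []) ne = here (cong (s ℕ.+_) (NP.+-identityʳ x))
  partialSumsFrom-last s (x ∷ x' ∷ xs) ne = there (subst (λ t → Mem t (partialSumsFrom (s ℕ.+ x) (x' ∷ xs))) (NP.+-assoc s x (sum (x' ∷ xs))) (partialSumsFrom-last (s ℕ.+ x) (x' ∷ xs) (λ ())))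

  S-bound : ∀ xs → AllPos xs → ∀ y → Mem y (S xs) → y ℕ.< sum xs
  S-bound xs pos y m with snocView xs
  S-bound xs pos y m | inj₁ refl = ⊥-elim (lem m)
    where lem : ¬ Mem y (S [])
          lem ()
  S-bound xs pos y m | inj₂ (ys , p , refl) =
    subst (y ℕ.<_) (sym (sum-∷ʳ ys p))
      (NP.≤-<-trans (partialSumsFrom-≤ 0 ys y (subst (Mem y) (S-∷ʳ ys p) m)) (NP.m<m+n (sum ys) (proj₂ (AllP.∷ʳ⁻ pos))))

  sum-pos : ∀ xs → AllPos xs → xs ≢ [] → 0 ℕ.< sum xs
  sum-pos [] _ ne = ⊥-elim (ne refl)
  sum-pos (x ∷ xs) (px ∷ _) _ = NP.<-≤-trans px (NP.m≤m+n x (sum xs))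

  filter-cong-local : ∀ {A : Set} {P Q : A → Set} (P? : ∀ x → Dec (P x)) (Q? : ∀ x → Dec (Q x)) xs →
    All (λ x → does (P? x) ≡ does (Q? x)) xs → filter P? xs ≡ filter Q? xs
  filter-cong-local P? Q? [] [] = refl
  filter-cong-local P? Q? (x ∷ xs) (e ∷ es) with does (P? x) | does (Q? x)
  ... | true | true = cong (x ∷_) (filter-cong-local P? Q? xs es)
  ... | false | false = filter-cong-local P? Q? xs es
  filter-cong-local P? Q? (x ∷ xs) (() ∷ es) | true | false
  filter-cong-local P? Q? (x ∷ xs) (() ∷ es) | false | true

  zip-∷ʳ : ∀ {A B : Set} (xs : List A) (ys : List B) x y → length xs ≡ length ys → zip (xs ∷ʳ x) (ys ∷ʳ y) ≡ zip xs ys ∷ʳ (x , y)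
  zip-∷ʳ [] [] x y _ = refl
  zip-∷ʳ (a ∷ xs) (b ∷ ys) x y e = cong ((a , b) ∷_) (zip-∷ʳ xs ys x y (NP.suc-injective e))

  All-zip : ∀ {A B : Set} {Q : B → Set} (xs : List A) (ys : List B) → All Q ys → All (λ p → Q (proj₂ p)) (zip xs ys)
  All-zip [] ys _ = []
  All-zip (x ∷ xs) [] _ = []
  All-zip (x ∷ xs) (y ∷ ys) (q ∷ qs) = q ∷ All-zip xs ys qs

  map-proj₁-zip : ∀ {A B : Set} (xs : List A) (ys : List B) → length xs ≡ length ys → map proj₁ (zip xs ys) ≡ xs
  map-proj₁-zip [] [] _ = refl
  map-proj₁-zip (x ∷ xs) (y ∷ ys) e = cong (x ∷_) (map-proj₁-zip xs ys (NP.suc-injective e))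

  blocksFrom-hi : ∀ s xs → All (λ B → proj₂ B ℕ.≤ s ℕ.+ sum xs) (blocksFrom s xs)
  blocksFrom-hi s [] = []
  blocksFrom-hi s (x ∷ xs) = NP.+-monoʳ-≤ s (NP.m≤m+n x (sum xs)) ∷ All.map (λ {B} le → NP.≤-trans le (NP.≤-reflexive (NP.+-assoc s x (sum xs)))) (blocksFrom-hi (s ℕ.+ x) xs)

  blocksFrom-lo : ∀ s xs → All (λ B → s ℕ.≤ proj₁ B) (blocksFrom s xs)
  blocksFrom-lo s [] = []
  blocksFrom-lo s (x ∷ xs) = NP.≤-refl ∷ All.map (λ {B} le → NP.≤-trans (NP.m≤m+n s x) le) (blocksFrom-lo (s ℕ.+ x) xs)

  subcomp-∷ʳ : ∀ α u B → subcomp (α ∷ʳ u) B ≡ subcomp α B ++ map proj₁ (filter (λ pB → proj₂ pB ⊆B? B) ((u , (sum α , sum α ℕ.+ u)) ∷ []))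
  subcomp-∷ʳ α u B = begin
    map proj₁ (filter P? (zip (α ∷ʳ u) (blocksFrom 0 (α ∷ʳ u)))) ≡⟨ cong (λ t → map proj₁ (filter P? (zip (α ∷ʳ u) t))) (blocksFrom-∷ʳ 0 α u) ⟩
    map proj₁ (filter P? (zip (α ∷ʳ u) (blocksFrom 0 α ∷ʳ (sum α , sum α ℕ.+ u)))) ≡⟨ cong (λ t → map proj₁ (filter P? t)) (zip-∷ʳ α (blocksFrom 0 α) u _ (sym (length-blocksFrom 0 α))) ⟩
    map proj₁ (filter P? (zip α (blocksFrom 0 α) ∷ʳ (u , (sum α , sum α ℕ.+ u)))) ≡⟨ cong (map proj₁) (LP.filter-++ P? (zip α (blocksFrom 0 α)) _) ⟩
    map proj₁ (filter P? (zip α (blocksFrom 0 α)) ++ filter P? ((u , (sum α , sum α ℕ.+ u)) ∷ [])) ≡⟨ LP.map-++ proj₁ (filter P? (zip α (blocksFrom 0 α))) _ ⟩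
    subcomp α B ++ map proj₁ (filter P? ((u , (sum α , sum α ℕ.+ u)) ∷ [])) ∎
    where
    open ≡-Reasoning
    P? = λ (pB : ℕ × (ℕ × ℕ)) → proj₂ pB ⊆B? B

  subcomp-out : ∀ α u lo hi → hi ℕ.< sum α ℕ.+ u → subcomp (α ∷ʳ u) (lo , hi) ≡ subcomp α (lo , hi)
  subcomp-out α u lo hi lt = trans (subcomp-∷ʳ α u (lo , hi))
    (trans (cong (λ t → subcomp α (lo , hi) ++ map proj₁ t) (LP.filter-reject (λ pB → proj₂ pB ⊆B? (lo , hi)) (λ p → NP.<⇒≱ lt (proj₂ p)))) (LP.++-identityʳ _))

  subcomp-in : ∀ α u lo hi → lo ℕ.≤ sum α → sum α ℕ.+ u ℕ.≤ hi → subcomp (α ∷ʳ u) (lo , hi) ≡ subcomp α (lo , hi) ∷ʳ u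
  subcomp-in α u lo hi l1 l2 = trans (subcomp-∷ʳ α u (lo , hi))
    (cong (λ t → subcomp α (lo , hi) ++ map proj₁ t) (LP.filter-accept (λ pB → proj₂ pB ⊆B? (lo , hi)) (l1 , l2)))

  subcomp-none-g : ∀ s xs lo hi → AllPos xs → s ℕ.+ sum xs ℕ.≤ lo → filter (λ pB → proj₂ pB ⊆B? (lo , hi)) (zip xs (blocksFrom s xs)) ≡ []
  subcomp-none-g s [] lo hi _ _ = refl
  subcomp-none-g s (x ∷ xs) lo hi (px ∷ pxs) le =
    trans (LP.filter-reject (λ pB → proj₂ pB ⊆B? (lo , hi)) (λ p → NP.<⇒≱ (NP.<-≤-trans (NP.m<m+n s (NP.<-≤-trans px (NP.m≤m+n x (sum xs)))) le) (proj₁ p)))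
          (subcomp-none-g (s ℕ.+ x) xs lo hi pxs (NP.≤-trans (NP.≤-reflexive (NP.+-assoc s x (sum xs))) le))

  subcomp-none : ∀ α lo hi → AllPos α → sum α ℕ.≤ lo → subcomp α (lo , hi) ≡ []
  subcomp-none α lo hi pos le = cong (map proj₁) (subcomp-none-g 0 α lo hi pos le)

  subcomp-hi : ∀ α lo h1 h2 → sum α ℕ.≤ h1 → sum α ℕ.≤ h2 → subcomp α (lo , h1) ≡ subcomp α (lo , h2)
  subcomp-hi α lo h1 h2 l1 l2 = cong (map proj₁) (filter-cong-local _ _ (zip α (blocksFrom 0 α))
     (All.map (λ {pB} le → cong (does (lo ℕ.≤? proj₁ (proj₂ pB)) ∧_) (trans (dec-true (proj₂ (proj₂ pB) ℕ.≤? h1) (NP.≤-trans le l1)) (sym (dec-true (proj₂ (proj₂ pB) ℕ.≤? h2) (NP.≤-trans le l2)))))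
        (All-zip α (blocksFrom 0 α) (blocksFrom-hi 0 α))))

  product-∷ʳ : ∀ xs x → product (xs ∷ʳ x) ≡ product xs ℕ.* x
  product-∷ʳ xs x = trans (LAP.product-++ xs (x ∷ [])) (cong (product xs ℕ.*_) (NP.*-identityʳ x))

  πc-∷ʳ : ∀ γ u → πc (γ ∷ʳ u) ≡ πc γ ℕ.* (sum γ ℕ.+ u)
  πc-∷ʳ γ u = trans (cong product (partialSumsFrom-∷ʳ 0 γ u)) (product-∷ʳ (partialSumsFrom 0 γ) _)

  π2-∷ʳ : ∀ α β b → π2 α (β ∷ʳ b) ≡ π2 α β ℕ.* πc (subcomp α (sum β , sum β ℕ.+ b))
  π2-∷ʳ α β b = trans (cong (λ t → product (map (λ Bβ → πc (subcomp α Bβ)) t)) (blocksFrom-∷ʳ 0 β b))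
    (trans (cong product (LP.map-++ (λ Bβ → πc (subcomp α Bβ)) (blocksFrom 0 β) _)) (product-∷ʳ (map (λ Bβ → πc (subcomp α Bβ)) (blocksFrom 0 β)) _))

  π2-left : ∀ α u β → sum β ℕ.< sum α ℕ.+ u → π2 (α ∷ʳ u) β ≡ π2 α β
  π2-left α u β lt = cong product (LP.map-cong-local (All.map (λ {B} le → cong πc (subcomp-out α u (proj₁ B) (proj₂ B) (NP.≤-<-trans le lt))) (blocksFrom-hi 0 β)))

  align-sum-from : ∀ s xs t → AllPos xs → (t ≡ s ⊎ Mem t (partialSumsFrom s xs)) →
    sum (map proj₁ (filter (λ pB → t ℕ.≤? proj₁ (proj₂ pB)) (zip xs (blocksFrom s xs)))) ≡ (s ℕ.+ sum xs) ℕ.∸ t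
  align-sum-from s [] t _ (inj₁ refl) = sym (trans (cong (ℕ._∸ s) (NP.+-identityʳ s)) (NP.n∸n≡0 s))
  align-sum-from s (x ∷ xs) t (px ∷ pxs) (inj₁ refl) = begin
    sum (map proj₁ (filter P? ((x , (s , s ℕ.+ x)) ∷ zip xs (blocksFrom (s ℕ.+ x) xs)))) ≡⟨ cong (λ l → sum (map proj₁ l)) (LP.filter-accept P? NP.≤-refl) ⟩
    x ℕ.+ sum (map proj₁ (filter P? (zip xs (blocksFrom (s ℕ.+ x) xs)))) ≡⟨ cong (λ l → x ℕ.+ sum (map proj₁ l)) (LP.filter-all P? (All.map (λ {pB} le → NP.≤-trans (NP.m≤m+n s x) le) (All-zip xs (blocksFrom (s ℕ.+ x) xs) (blocksFrom-lo (s ℕ.+ x) xs)))) ⟩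
    x ℕ.+ sum (map proj₁ (zip xs (blocksFrom (s ℕ.+ x) xs))) ≡⟨ cong (λ l → x ℕ.+ sum l) (map-proj₁-zip xs _ (sym (length-blocksFrom (s ℕ.+ x) xs))) ⟩
    x ℕ.+ sum xs ≡⟨ sym (NP.m+n∸m≡n s (x ℕ.+ sum xs)) ⟩
    (s ℕ.+ (x ℕ.+ sum xs)) ℕ.∸ s ∎
    where
    open ≡-Reasoning
    P? = λ (pB : ℕ × (ℕ × ℕ)) → s ℕ.≤? proj₁ (proj₂ pB)
  align-sum-from s (x ∷ xs) t (px ∷ pxs) (inj₂ m) = begin
    sum (map proj₁ (filter P? ((x , (s , s ℕ.+ x)) ∷ zip xs (blocksFrom (s ℕ.+ x) xs)))) ≡⟨ cong (λ l → sum (map proj₁ l)) (LP.filter-reject P? (NP.<⇒≱ s<t)) ⟩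
    sum (map proj₁ (filter P? (zip xs (blocksFrom (s ℕ.+ x) xs)))) ≡⟨ align-sum-from (s ℕ.+ x) xs t pxs m' ⟩
    (s ℕ.+ x ℕ.+ sum xs) ℕ.∸ t ≡⟨ cong (ℕ._∸ t) (NP.+-assoc s x (sum xs)) ⟩
    (s ℕ.+ (x ℕ.+ sum xs)) ℕ.∸ t ∎
    where
    open ≡-Reasoning
    P? = λ (pB : ℕ × (ℕ × ℕ)) → t ℕ.≤? proj₁ (proj₂ pB)
    s<t : s ℕ.< t
    s<t = partialSumsFrom-> s (x ∷ xs) t (px ∷ pxs) m
    conv : Mem t (partialSumsFrom s (x ∷ xs)) → t ≡ s ℕ.+ x ⊎ Mem t (partialSumsFrom (s ℕ.+ x) xs)
    conv (here e) = inj₁ e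
    conv (there m₁) = inj₂ m₁
    m' = conv m

  align-sum : ∀ α t → AllPos α → t ℕ.≤ sum α → (t ≡ 0 ⊎ Mem t (partialSumsFrom 0 α)) → sum (subcomp α (t , sum α)) ≡ sum α ℕ.∸ t
  align-sum α t pos le m = trans (cong (λ l → sum (map proj₁ l)) (filter-cong-local _ _ (zip α (blocksFrom 0 α))
     (All.map (λ {pB} le' → trans (cong (does (t ℕ.≤? proj₁ (proj₂ pB)) ∧_) (dec-true (proj₂ (proj₂ pB) ℕ.≤? sum α) le')) (BP.∧-identityʳ _))
        (All-zip α (blocksFrom 0 α) (blocksFrom-hi 0 α))))) (align-sum-from 0 α t pos m)

  mem-∷ʳ⁻ : ∀ y xs z → Mem y (xs ∷ʳ z) → Mem y xs ⊎ y ≡ z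
  mem-∷ʳ⁻ y xs z m with AnyP.++⁻ xs m
  ... | inj₁ m' = inj₁ m'
  ... | inj₂ (here e) = inj₂ e

  mem-∷ʳˡ : ∀ {y xs} z → Mem y xs → Mem y (xs ∷ʳ z)
  mem-∷ʳˡ z m = AnyP.++⁺ˡ m

  mem-∷ʳ-last : ∀ xs z → Mem z (xs ∷ʳ z)
  mem-∷ʳ-last xs z = AnyP.++⁺ʳ xs (here refl)

  ≼-snoc⇒ : ∀ α u β b → (α ∷ʳ u) ≼ (β ∷ʳ b) → All (λ s → Mem s (partialSumsFrom 0 α)) (partialSumsFrom 0 β)
  ≼-snoc⇒ α u β b h = subst (All (λ s → Mem s (partialSumsFrom 0 α))) (S-∷ʳ β b) (All.map (λ {s} m → subst (Mem s) (S-∷ʳ α u) m) h)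

  ≼-snoc⇐ : ∀ α u β b → All (λ s → Mem s (partialSumsFrom 0 α)) (partialSumsFrom 0 β) → (α ∷ʳ u) ≼ (β ∷ʳ b)
  ≼-snoc⇐ α u β b h = subst (All (λ s → Mem s (S (α ∷ʳ u)))) (sym (S-∷ʳ β b)) (All.map (λ {s} m → subst (Mem s) (sym (S-∷ʳ α u)) m) h)

  ne-of-sum : ∀ xs → 0 ℕ.< sum xs → xs ≢ []
  ne-of-sum [] () refl
  ne-of-sum (x ∷ xs) _ ()

  ≼-eq⇒ : ∀ α β b → AllPos α → AllPos β → sum α ≡ sum β → (α ∷ʳ b) ≼ (β ∷ʳ b) → α ≼ β
  ≼-eq⇒ α [] b pa pb e h = []
  ≼-eq⇒ α β@(_ ∷ _) b pa pb e h = All.tabulate (λ {y} m → lem y m (All.lookup (proj₁ (AllP.∷ʳ⁻ h2)) m))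
    where
    T = sum β
    Tpos = sum-pos β pb (λ ())
    αne = ne-of-sum α (subst (0 ℕ.<_) (sym e) Tpos)
    h2 : All (λ s → Mem s (S α ∷ʳ T)) (S β ∷ʳ T)
    h2 = subst₂ (λ X Y → All (λ s → Mem s X) Y) (trans (partialSums≡S∷ʳsum α αne) (cong (S α ∷ʳ_) e)) (partialSums≡S∷ʳsum β (λ ())) (≼-snoc⇒ α b β b h)
    lem : ∀ y → Mem y (S β) → Mem y (S α ∷ʳ T) → Mem y (S α)
    lem y my m with mem-∷ʳ⁻ y (S α) T m
    ... | inj₁ m' = m'
    ... | inj₂ refl = ⊥-elim (NP.<-irrefl refl (S-bound β pb y my))

  ≼-eq⇐ : ∀ α β b → AllPos α → AllPos β → sum α ≡ sum β → α ≼ β → (α ∷ʳ b) ≼ (β ∷ʳ b)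
  ≼-eq⇐ α [] b pa pb e h = ≼-snoc⇐ α b [] b []
  ≼-eq⇐ α β@(_ ∷ _) b pa pb e h = ≼-snoc⇐ α b β b (subst₂ (λ X Y → All (λ s → Mem s X) Y) (sym (trans (partialSums≡S∷ʳsum α αne) (cong (S α ∷ʳ_) e))) (sym (partialSums≡S∷ʳsum β (λ ())))
      (AllP.∷ʳ⁺ (All.map (λ {s} m → mem-∷ʳˡ T m) h) (mem-∷ʳ-last (S α) T)))
    where
    T = sum β
    Tpos = sum-pos β pb (λ ())
    αne = ne-of-sum α (subst (0 ℕ.<_) (sym e) Tpos)

  -- The arithmetic of |α| + u = |β| + b with u < b: α ends inside the last
  -- block of β, at distance d = b - u from its end.
  module LastParts (A T u b : ℕ) (u<b : u ℕ.< b) (e : A ℕ.+ u ≡ T ℕ.+ b) where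
    d = b ℕ.∸ u
    b≡ : b ≡ d ℕ.+ u
    b≡ = sym (NP.m∸n+n≡m (NP.<⇒≤ u<b))
    A≡ : A ≡ T ℕ.+ d
    A≡ = NP.+-cancelʳ-≡ u A (T ℕ.+ d) (trans e (trans (cong (T ℕ.+_) b≡) (sym (NP.+-assoc T d u))))
    d>0 : 0 ℕ.< d
    d>0 = NP.m<n⇒0<n∸m u<b
    T<A : T ℕ.< A
    T<A = subst (T ℕ.<_) (sym A≡) (NP.m<m+n T d>0)
    A∸T : A ℕ.∸ T ≡ d
    A∸T = trans (cong (ℕ._∸ T) A≡) (NP.m+n∸m≡n T d)

  ≼-lt⇒ : ∀ α β u b → AllPos α → AllPos β → u ℕ.< b → sum α ℕ.+ u ≡ sum β ℕ.+ b → (α ∷ʳ u) ≼ (β ∷ʳ b) → α ≼ (β ∷ʳ (b ℕ.∸ u))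
  ≼-lt⇒ α β u b pa pb u<b e h = subst (All (λ s → Mem s (S α))) (sym (S-∷ʳ β (b ℕ.∸ u)))
      (All.tabulate (λ {y} m → lem y m (All.lookup h2 m)))
    where
    open LastParts (sum α) (sum β) u b u<b e
    αne = ne-of-sum α (NP.≤-<-trans ℕ.z≤n T<A)
    h2 : All (λ s → Mem s (S α ∷ʳ sum α)) (partialSumsFrom 0 β)
    h2 = subst (λ X → All (λ s → Mem s X) (partialSumsFrom 0 β)) (partialSums≡S∷ʳsum α αne) (≼-snoc⇒ α u β b h)
    lem : ∀ y → Mem y (partialSumsFrom 0 β) → Mem y (S α ∷ʳ sum α) → Mem y (S α)
    lem y my m with mem-∷ʳ⁻ y (S α) (sum α) m
    ... | inj₁ m' = m'
    ... | inj₂ refl = ⊥-elim (NP.<⇒≱ T<A (partialSumsFrom-≤ 0 β y my))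

  ≼-lt⇐ : ∀ α β u b → AllPos α → AllPos β → u ℕ.< b → sum α ℕ.+ u ≡ sum β ℕ.+ b → α ≼ (β ∷ʳ (b ℕ.∸ u)) → (α ∷ʳ u) ≼ (β ∷ʳ b)
  ≼-lt⇐ α β u b pa pb u<b e h = ≼-snoc⇐ α u β b (subst (λ X → All (λ s → Mem s X) (partialSumsFrom 0 β)) (sym (partialSums≡S∷ʳsum α αne))
      (All.map (λ {s} m → mem-∷ʳˡ (sum α) m) (subst (All (λ s → Mem s (S α))) (S-∷ʳ β (b ℕ.∸ u)) h)))
    where
    open LastParts (sum α) (sum β) u b u<b e
    αne = ne-of-sum α (NP.≤-<-trans ℕ.z≤n T<A)

  ≼-gt : ∀ α β u b → b ℕ.< u → sum α ℕ.+ u ≡ sum β ℕ.+ b → ¬ ((α ∷ʳ u) ≼ (β ∷ʳ b))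
  ≼-gt α [] u b b<u e h = NP.<⇒≱ b<u (NP.≤-trans (NP.m≤n+m u (sum α)) (NP.≤-reflexive e))
  ≼-gt α β@(_ ∷ _) u b b<u e h = NP.<⇒≱ lt (partialSumsFrom-≤ 0 α (sum β) (All.lookup (≼-snoc⇒ α u β b h) (partialSumsFrom-last 0 β (λ ()))))
    where
    lt : sum α ℕ.< sum β
    lt = NP.+-cancelʳ-< b (sum α) (sum β) (NP.<-≤-trans (NP.+-monoʳ-< (sum α) b<u) (NP.≤-reflexive e))

  π2-eq : ∀ α β b → AllPos α → 0 ℕ.< b → sum α ≡ sum β → π2 (α ∷ʳ b) (β ∷ʳ b) ≡ π2 α β ℕ.* b
  π2-eq α β b pa b>0 e = begin
    π2 (α ∷ʳ b) (β ∷ʳ b) ≡⟨ π2-∷ʳ (α ∷ʳ b) β b ⟩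
    π2 (α ∷ʳ b) β ℕ.* πc (subcomp (α ∷ʳ b) (T , T ℕ.+ b)) ≡⟨ cong (ℕ._* πc (subcomp (α ∷ʳ b) (T , T ℕ.+ b))) (π2-left α b β (subst (ℕ._< sum α ℕ.+ b) e (NP.m<m+n (sum α) b>0))) ⟩
    π2 α β ℕ.* πc (subcomp (α ∷ʳ b) (T , T ℕ.+ b)) ≡⟨ cong (λ l → π2 α β ℕ.* πc l) (subcomp-in α b T (T ℕ.+ b) (NP.≤-reflexive (sym e)) (NP.≤-reflexive (cong (ℕ._+ b) e))) ⟩
    π2 α β ℕ.* πc (subcomp α (T , T ℕ.+ b) ∷ʳ b) ≡⟨ cong (λ l → π2 α β ℕ.* πc (l ∷ʳ b)) (subcomp-none α T (T ℕ.+ b) pa (NP.≤-reflexive e)) ⟩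
    π2 α β ℕ.* (b ℕ.* 1) ≡⟨ cong (π2 α β ℕ.*_) (NP.*-identityʳ b) ⟩
    π2 α β ℕ.* b ∎
    where
    open ≡-Reasoning
    T = sum β

  cut-point : ∀ α β d → sum β ℕ.< sum α → α ≼ (β ∷ʳ d) → sum β ≡ 0 ⊎ Mem (sum β) (partialSumsFrom 0 α)
  cut-point α [] d lt h = inj₁ refl
  cut-point α β@(_ ∷ _) d lt h = inj₂ (subst (Mem (sum β)) (sym (partialSums≡S∷ʳsum α (ne-of-sum α (NP.≤-<-trans ℕ.z≤n lt))))
    (mem-∷ʳˡ (sum α) (All.lookup (subst (All (λ s → Mem s (S α))) (S-∷ʳ β d) h) (partialSumsFrom-last 0 β (λ ())))))

  -- u < b: π(α·u, β·b) = π(α, β·(b - u)) · b, since the parts of α·u in the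
  -- last block of β·b are those of α in the last block of β·(b - u), which sum
  -- to b - u, followed by u; the extra partial sum is (b - u) + u = b.
  π2-lt : ∀ α β u b → AllPos α → AllPos β → u ℕ.< b → sum α ℕ.+ u ≡ sum β ℕ.+ b → α ≼ (β ∷ʳ (b ℕ.∸ u)) →
       π2 (α ∷ʳ u) (β ∷ʳ b) ≡ π2 α (β ∷ʳ (b ℕ.∸ u)) ℕ.* b
  π2-lt α β u b pa pb u<b e h = begin
    π2 (α ∷ʳ u) (β ∷ʳ b) ≡⟨ π2-∷ʳ (α ∷ʳ u) β b ⟩
    π2 (α ∷ʳ u) β ℕ.* πc (subcomp (α ∷ʳ u) (T , T ℕ.+ b)) ≡⟨ cong (ℕ._* πc (subcomp (α ∷ʳ u) (T , T ℕ.+ b))) (π2-left α u β (NP.<-≤-trans T<A (NP.m≤m+n A u))) ⟩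
    π2 α β ℕ.* πc (subcomp (α ∷ʳ u) (T , T ℕ.+ b)) ≡⟨ cong (λ l → π2 α β ℕ.* πc l) (subcomp-in α u T (T ℕ.+ b) (NP.<⇒≤ T<A) (NP.≤-reflexive e)) ⟩
    π2 α β ℕ.* πc (subcomp α (T , T ℕ.+ b) ∷ʳ u) ≡⟨ cong (λ l → π2 α β ℕ.* πc (l ∷ʳ u)) (subcomp-hi α T (T ℕ.+ b) A (NP.≤-trans (NP.m≤m+n A u) (NP.≤-reflexive e)) NP.≤-refl) ⟩
    π2 α β ℕ.* πc (γ ∷ʳ u) ≡⟨ cong (π2 α β ℕ.*_) (πc-∷ʳ γ u) ⟩
    π2 α β ℕ.* (πc γ ℕ.* (sum γ ℕ.+ u)) ≡⟨ cong (λ t → π2 α β ℕ.* (πc γ ℕ.* (t ℕ.+ u))) (trans (align-sum α T pa (NP.<⇒≤ T<A) cut) A∸T) ⟩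
    π2 α β ℕ.* (πc γ ℕ.* (d ℕ.+ u)) ≡⟨ cong (λ t → π2 α β ℕ.* (πc γ ℕ.* t)) (sym b≡) ⟩
    π2 α β ℕ.* (πc γ ℕ.* b) ≡⟨ sym (NP.*-assoc (π2 α β) (πc γ) b) ⟩
    (π2 α β ℕ.* πc γ) ℕ.* b ≡⟨ cong (λ t → (π2 α β ℕ.* πc (subcomp α (T , t))) ℕ.* b) A≡ ⟩
    (π2 α β ℕ.* πc (subcomp α (T , T ℕ.+ d))) ℕ.* b ≡⟨ cong (ℕ._* b) (sym (π2-∷ʳ α β d)) ⟩
    π2 α (β ∷ʳ d) ℕ.* b ∎
    where
    open ≡-Reasoning
    A = sum α
    T = sum β
    open LastParts A T u b u<b e
    γ = subcomp α (T , A)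
    αne = ne-of-sum α (NP.≤-<-trans ℕ.z≤n T<A)
    cut : T ≡ 0 ⊎ Mem T (partialSumsFrom 0 α)
    cut = cut-point α β d T<A h

  nz-∷ʳ-0 : ∀ cs → nonzeroParts (cs ∷ʳ 0) ≡ nonzeroParts cs
  nz-∷ʳ-0 cs = trans (LP.filter-++ (λ p → ¬? (p ℕ.≟ 0)) cs (0 ∷ [])) (LP.++-identityʳ _)

  nz-∷ʳ-s : ∀ cs b → nonzeroParts (cs ∷ʳ suc b) ≡ nonzeroParts cs ∷ʳ suc b
  nz-∷ʳ-s cs b = LP.filter-++ (λ p → ¬? (p ℕ.≟ 0)) cs (suc b ∷ [])

  nz-pos : ∀ cs → AllPos (nonzeroParts cs)
  nz-pos [] = []
  nz-pos (c ∷ cs) = lem (c ℕ.≟ 0)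
    where
    P? = λ p → ¬? (p ℕ.≟ 0)
    lem : Dec (c ≡ 0) → AllPos (nonzeroParts (c ∷ cs))
    lem (yes e) = subst AllPos (sym (LP.filter-reject P? (λ ne → ne e))) (nz-pos cs)
    lem (no ne) = subst AllPos (sym (LP.filter-accept P? ne)) (NP.n≢0⇒n>0 ne ∷ nz-pos cs)

  Admissible : List ℕ → List ℕ → Set
  Admissible αs β = (β ⊨ sum αs) × (αs ≼ β)

  Wc : List ℕ → List ℕ → Q.ℚ
  Wc αs β = R.𝕀 (β ⊨? sum αs) Q.* (R.𝕀 (αs ≼? β) Q.* inv (π2 αs β))

  -- W α a = [x^a] Ψ_α / z_α, in terms of the nonzero exponents of a.
  W : List ℕ → List ℕ → Q.ℚ
  W αs cs = Wc αs (nonzeroParts cs)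

  W-nil-content : ∀ αs u → 0 ℕ.< u → W (αs ∷ʳ u) [] ≡ Q.0ℚ
  W-nil-content αs u u>0 = trans (cong (Q._* x) (R.𝕀-no (λ p → NP.<⇒≢ (NP.<-≤-trans u>0 (NP.≤-trans (NP.m≤n+m u (sum αs)) (NP.≤-reflexive (sym (sum-∷ʳ αs u))))) (proj₂ p)) ([] ⊨? sum (αs ∷ʳ u)))) (QP.*-zeroˡ x)
    where x = R.𝕀 ((αs ∷ʳ u) ≼? []) Q.* inv (π2 (αs ∷ʳ u) [])

  W-zero-last : ∀ αs cs → W αs (cs ∷ʳ 0) ≡ W αs cs
  W-zero-last αs cs = cong (Wc αs) (nz-∷ʳ-0 cs)

  W-nil-type : ∀ cs b → W [] (cs ∷ʳ suc b) ≡ Q.0ℚ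
  W-nil-type cs b = trans (cong (Wc []) (nz-∷ʳ-s cs b))
     (trans (cong (Q._* x) (R.𝕀-no (λ p → NP.<⇒≢ (NP.<-≤-trans (ℕ.s≤s ℕ.z≤n) (NP.≤-trans (NP.m≤n+m (suc b) _) (NP.≤-reflexive (sym (sum-∷ʳ (nonzeroParts cs) (suc b)))))) (sym (proj₂ p))) ((nonzeroParts cs ∷ʳ suc b) ⊨? 0))) (QP.*-zeroˡ x))
    where x = R.𝕀 ([] ≼? (nonzeroParts cs ∷ʳ suc b)) Q.* inv (π2 [] (nonzeroParts cs ∷ʳ suc b))

  ⊨-snoc⁻ : ∀ αs β u b → (β ∷ʳ b) ⊨ sum (αs ∷ʳ u) → sum αs ℕ.+ u ≡ sum β ℕ.+ b
  ⊨-snoc⁻ αs β u b pp = trans (sym (sum-∷ʳ αs u)) (trans (sym (proj₂ pp)) (sum-∷ʳ β b))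

  ⊨-snoc⁺ : ∀ αs β u b → AllPos β → 0 ℕ.< b → sum αs ℕ.+ u ≡ sum β ℕ.+ b → (β ∷ʳ b) ⊨ sum (αs ∷ʳ u)
  ⊨-snoc⁺ αs β u b pβ b>0 e = AllP.∷ʳ⁺ pβ b>0 , trans (sum-∷ʳ β b) (trans (sym e) (sym (sum-∷ʳ αs u)))

  Wc-rescale : ∀ αs β αs' β' b →
    (Admissible αs β → Admissible αs' β') → (Admissible αs' β' → Admissible αs β) →
    (Admissible αs β → π2 αs β ≡ π2 αs' β' ℕ.* suc b) →
    Wc αs β ≡ inv (suc b) Q.* Wc αs' β'
  Wc-rescale αs β αs' β' b to from val = begin
    Wc αs β ≡⟨ R.𝕀-∧ p q _ ⟩
    R.𝕀 (p ×-dec q) Q.* inv (π2 αs β)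
      ≡⟨ R.condEq (p ×-dec q) (p' ×-dec q') _ _ to from (λ c → trans (cong inv (val c)) (inv-mul (π2 αs' β') b)) ⟩
    R.𝕀 (p' ×-dec q') Q.* (inv (suc b) Q.* inv (π2 αs' β')) ≡⟨ sym (R.*-𝕀-swap (inv (suc b)) (p' ×-dec q') _) ⟩
    inv (suc b) Q.* (R.𝕀 (p' ×-dec q') Q.* inv (π2 αs' β')) ≡⟨ cong (inv (suc b) Q.*_) (sym (R.𝕀-∧ p' q' _)) ⟩
    inv (suc b) Q.* Wc αs' β' ∎
    where
    open ≡-Reasoning
    p = β ⊨? sum αs
    q = αs ≼? β
    p' = β' ⊨? sum αs'
    q' = αs' ≼? β'

  Wc-last-gt : ∀ αs β u b → b ℕ.< u → Wc (αs ∷ʳ u) (β ∷ʳ b) ≡ Q.0ℚ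
  Wc-last-gt αs β u b b<u =
    trans (R.𝕀-∧ p q x) (trans (cong (Q._* x) (R.𝕀-no impossible (p ×-dec q))) (QP.*-zeroˡ x))
    where
    p = (β ∷ʳ b) ⊨? sum (αs ∷ʳ u)
    q = (αs ∷ʳ u) ≼? (β ∷ʳ b)
    x = inv (π2 (αs ∷ʳ u) (β ∷ʳ b))
    impossible : ¬ Admissible (αs ∷ʳ u) (β ∷ʳ b)
    impossible (pp , qq) = ≼-gt αs β u b b<u (⊨-snoc⁻ αs β u b pp) qq

  Wc-last-lt : ∀ αs β u b → AllPos αs → AllPos β → u ℕ.< suc b →
    Wc (αs ∷ʳ u) (β ∷ʳ suc b) ≡ inv (suc b) Q.* Wc αs (β ∷ʳ (suc b ℕ.∸ u))
  Wc-last-lt αs β u b pa pβ lt = Wc-rescale (αs ∷ʳ u) (β ∷ʳ suc b) αs (β ∷ʳ d) b to from val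
    where
    d = suc b ℕ.∸ u
    to : Admissible (αs ∷ʳ u) (β ∷ʳ suc b) → Admissible αs (β ∷ʳ d)
    to (pp , qq) = (AllP.∷ʳ⁺ pβ d>0 , trans (sum-∷ʳ β d) (sym A≡)) , ≼-lt⇒ αs β u (suc b) pa pβ lt e qq
      where
      e = ⊨-snoc⁻ αs β u (suc b) pp
      open LastParts (sum αs) (sum β) u (suc b) lt e using (A≡; d>0)
    from : Admissible αs (β ∷ʳ d) → Admissible (αs ∷ʳ u) (β ∷ʳ suc b)
    from (pp' , qq') = ⊨-snoc⁺ αs β u (suc b) pβ (ℕ.s≤s ℕ.z≤n) e , ≼-lt⇐ αs β u (suc b) pa pβ lt e qq'
      where
      e : sum αs ℕ.+ u ≡ sum β ℕ.+ suc b
      e = trans (cong (ℕ._+ u) (sym (trans (sym (sum-∷ʳ β d)) (proj₂ pp'))))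
                (trans (NP.+-assoc (sum β) d u) (cong (sum β ℕ.+_) (NP.m∸n+n≡m (NP.<⇒≤ lt))))
    val : Admissible (αs ∷ʳ u) (β ∷ʳ suc b) → π2 (αs ∷ʳ u) (β ∷ʳ suc b) ≡ π2 αs (β ∷ʳ d) ℕ.* suc b
    val (pp , qq) = π2-lt αs β u (suc b) pa pβ lt e (≼-lt⇒ αs β u (suc b) pa pβ lt e qq)
      where e = ⊨-snoc⁻ αs β u (suc b) pp

  Wc-last-eq : ∀ αs β b → AllPos αs → AllPos β →
    Wc (αs ∷ʳ suc b) (β ∷ʳ suc b) ≡ inv (suc b) Q.* Wc αs β
  Wc-last-eq αs β b pa pβ = Wc-rescale (αs ∷ʳ suc b) (β ∷ʳ suc b) αs β b to from val
    where
    sizes : (β ∷ʳ suc b) ⊨ sum (αs ∷ʳ suc b) → sum β ≡ sum αs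
    sizes pp = sym (NP.+-cancelʳ-≡ (suc b) (sum αs) (sum β) (⊨-snoc⁻ αs β (suc b) (suc b) pp))
    to : Admissible (αs ∷ʳ suc b) (β ∷ʳ suc b) → Admissible αs β
    to (pp , qq) = (pβ , sizes pp) , ≼-eq⇒ αs β (suc b) pa pβ (sym (sizes pp)) qq
    from : Admissible αs β → Admissible (αs ∷ʳ suc b) (β ∷ʳ suc b)
    from (pp' , qq') = ⊨-snoc⁺ αs β (suc b) (suc b) pβ (ℕ.s≤s ℕ.z≤n) (cong (ℕ._+ suc b) (sym (proj₂ pp'))) ,
                       ≼-eq⇐ αs β (suc b) pa pβ (sym (proj₂ pp')) qq'
    val : Admissible (αs ∷ʳ suc b) (β ∷ʳ suc b) → π2 (αs ∷ʳ suc b) (β ∷ʳ suc b) ≡ π2 αs β ℕ.* suc b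
    val (pp , qq) = π2-eq αs β (suc b) pa (ℕ.s≤s ℕ.z≤n) (sym (sizes pp))

  W-last : ∀ αs cs u b → AllPos αs → 0 ℕ.< u →
    W (αs ∷ʳ u) (cs ∷ʳ suc b) ≡ R.ind (does (u ℕ.≤? suc b)) Q.* (inv (suc b) Q.* W αs (cs ∷ʳ (suc b ℕ.∸ u)))
  W-last αs cs u b pa u>0 = trans (cong (Wc (αs ∷ʳ u)) (nz-∷ʳ-s cs b)) (by-cases (NP.<-cmp u (suc b)))
    where
    open ≡-Reasoning
    β = nonzeroParts cs
    rest = inv (suc b) Q.* W αs (cs ∷ʳ (suc b ℕ.∸ u))
    admitted : u ℕ.≤ suc b → rest ≡ R.ind (does (u ℕ.≤? suc b)) Q.* rest
    admitted le = sym (trans (cong (λ t → R.ind t Q.* rest) (dec-true (u ℕ.≤? suc b) le)) (QP.*-identityˡ rest))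
    by-cases : Tri (u ℕ.< suc b) (u ≡ suc b) (suc b ℕ.< u) →
      Wc (αs ∷ʳ u) (β ∷ʳ suc b) ≡ R.ind (does (u ℕ.≤? suc b)) Q.* rest
    by-cases (tri< lt _ _) = begin
      Wc (αs ∷ʳ u) (β ∷ʳ suc b) ≡⟨ Wc-last-lt αs β u b pa (nz-pos cs) lt ⟩
      inv (suc b) Q.* Wc αs (β ∷ʳ (suc b ℕ.∸ u))
        ≡⟨ cong (λ t → inv (suc b) Q.* Wc αs (β ∷ʳ t)) (NP.+-∸-assoc 1 (NP.≤-pred lt)) ⟩
      inv (suc b) Q.* Wc αs (β ∷ʳ suc (b ℕ.∸ u))
        ≡⟨ cong (λ l → inv (suc b) Q.* Wc αs l) (sym (nz-∷ʳ-s cs (b ℕ.∸ u))) ⟩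
      inv (suc b) Q.* W αs (cs ∷ʳ suc (b ℕ.∸ u))
        ≡⟨ cong (λ t → inv (suc b) Q.* W αs (cs ∷ʳ t)) (sym (NP.+-∸-assoc 1 (NP.≤-pred lt))) ⟩
      rest ≡⟨ admitted (NP.<⇒≤ lt) ⟩
      R.ind (does (u ℕ.≤? suc b)) Q.* rest ∎
    by-cases (tri≈ _ refl _) = begin
      Wc (αs ∷ʳ suc b) (β ∷ʳ suc b) ≡⟨ Wc-last-eq αs β b pa (nz-pos cs) ⟩
      inv (suc b) Q.* W αs cs ≡⟨ cong (inv (suc b) Q.*_) (sym (W-zero-last αs cs)) ⟩
      inv (suc b) Q.* W αs (cs ∷ʳ 0) ≡⟨ cong (λ t → inv (suc b) Q.* W αs (cs ∷ʳ t)) (sym (NP.n∸n≡0 (suc b))) ⟩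
      rest ≡⟨ admitted NP.≤-refl ⟩
      R.ind (does (u ℕ.≤? suc b)) Q.* rest ∎
    by-cases (tri> _ _ gt) = begin
      Wc (αs ∷ʳ u) (β ∷ʳ suc b) ≡⟨ Wc-last-gt αs β u (suc b) gt ⟩
      Q.0ℚ ≡⟨ sym (QP.*-zeroˡ rest) ⟩
      Q.0ℚ Q.* rest ≡⟨ cong (λ t → R.ind t Q.* rest) (sym (dec-false (u ℕ.≤? suc b) (NP.<⇒≱ gt))) ⟩
      R.ind (does (u ℕ.≤? suc b)) Q.* rest ∎

open Weights

tab-∷ʳ : ∀ {A : Set} k (f : Fin (suc k) → A) → List.tabulate f ≡ List.tabulate (λ i → f (Fin.inject₁ i)) ∷ʳ f (Fin.fromℕ k)
tab-∷ʳ zero f = refl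
tab-∷ʳ (suc k) f = cong (f zero ∷_) (tab-∷ʳ k (λ i → f (suc i)))

AllPos-tabulate : ∀ k (f : Fin k → ℕ) → (∀ i → 0 ℕ.< f i) → AllPos (List.tabulate f)
AllPos-tabulate zero f h = []
AllPos-tabulate (suc k) f h = h zero ∷ AllPos-tabulate k (λ i → f (suc i)) (λ i → h (suc i))

module WeightLists {n : ℕ} (P : FinPoset n) where
  open Core P

  tabulate-setLast : ∀ L (c : Fin (suc L) → ℕ) v → List.tabulate (setLast c v) ≡ List.tabulate (λ i → c (Fin.inject₁ i)) ∷ʳ v
  tabulate-setLast L c v = trans (tab-∷ʳ L (setLast c v)) (cong₂ _∷ʳ_ (LP.tabulate-cong (λ i → setLast-inject₁ c v i)) (setLast-last c v))

  -- w(α, c) = W(α, c) for positive α: both satisfy the same recursion on the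
  -- last entries of c (`W-last`, `W-zero-last`, and the empty cases).
  weight≡W : ∀ k (α : Fin k → ℕ) L (c : Fin L → ℕ) → (∀ i → 0 ℕ.< α i) → weight k α L c ≡ W (List.tabulate α) (List.tabulate c)
  weight≡W zero α zero c pos = refl
  weight≡W (suc k) α zero c pos = sym (trans (cong (λ l → W l []) (tab-∷ʳ k α)) (W-nil-content (List.tabulate (λ i → α (Fin.inject₁ i))) (α (Fin.fromℕ k)) (pos (Fin.fromℕ k))))
  weight≡W k α (suc L) c pos = step k α pos (c (Fin.fromℕ L)) refl
    where
    tc : ∀ v → c (Fin.fromℕ L) ≡ v → List.tabulate c ≡ List.tabulate (λ i → c (Fin.inject₁ i)) ∷ʳ v
    tc v eq = trans (tab-∷ʳ L c) (cong (List.tabulate (λ i → c (Fin.inject₁ i)) ∷ʳ_) eq)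
    step : ∀ k (α : Fin k → ℕ) → (∀ i → 0 ℕ.< α i) → ∀ v → c (Fin.fromℕ L) ≡ v → weight k α (suc L) c ≡ W (List.tabulate α) (List.tabulate c)
    step k α pos zero eq = begin
      weightStep k α L c (c (Fin.fromℕ L)) ≡⟨ cong (weightStep k α L c) eq ⟩
      weight k α L (λ i → c (Fin.inject₁ i)) ≡⟨ weight≡W k α L (λ i → c (Fin.inject₁ i)) pos ⟩
      W (List.tabulate α) (List.tabulate (λ i → c (Fin.inject₁ i))) ≡⟨ sym (W-zero-last (List.tabulate α) (List.tabulate (λ i → c (Fin.inject₁ i)))) ⟩
      W (List.tabulate α) (List.tabulate (λ i → c (Fin.inject₁ i)) ∷ʳ 0) ≡⟨ cong (W (List.tabulate α)) (sym (tc 0 eq)) ⟩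
      W (List.tabulate α) (List.tabulate c) ∎
      where open ≡-Reasoning
    step zero α pos (suc b) eq = trans (cong (weightStep zero α L c) eq) (sym (trans (cong (W []) (tc (suc b) eq)) (W-nil-type (List.tabulate (λ i → c (Fin.inject₁ i))) b)))
    step (suc k) α pos (suc b) eq = begin
      weightStep (suc k) α L c (c (Fin.fromℕ L)) ≡⟨ cong (weightStep (suc k) α L c) eq ⟩
      R.ind (does (u' ℕ.≤? suc b)) Q.* (inv (suc b) Q.* weight k α' (suc L) (setLast c (suc b ℕ.∸ u')))
        ≡⟨ cong (λ t → R.ind (does (u' ℕ.≤? suc b)) Q.* (inv (suc b) Q.* t)) (weight≡W k α' (suc L) (setLast c (suc b ℕ.∸ u')) (λ i → pos (Fin.inject₁ i))) ⟩
      R.ind (does (u' ℕ.≤? suc b)) Q.* (inv (suc b) Q.* W (List.tabulate α') (List.tabulate (setLast c (suc b ℕ.∸ u'))))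
        ≡⟨ cong (λ l → R.ind (does (u' ℕ.≤? suc b)) Q.* (inv (suc b) Q.* W (List.tabulate α') l)) (tabulate-setLast L c _) ⟩
      R.ind (does (u' ℕ.≤? suc b)) Q.* (inv (suc b) Q.* W (List.tabulate α') (List.tabulate (λ i → c (Fin.inject₁ i)) ∷ʳ (suc b ℕ.∸ u')))
        ≡⟨ sym (W-last (List.tabulate α') (List.tabulate (λ i → c (Fin.inject₁ i))) u' b (AllPos-tabulate k α' (λ i → pos (Fin.inject₁ i))) (pos (Fin.fromℕ k))) ⟩
      W (List.tabulate α' ∷ʳ u') (List.tabulate (λ i → c (Fin.inject₁ i)) ∷ʳ suc b) ≡⟨ cong₂ W (sym (tab-∷ʳ k α)) (sym (tc (suc b) eq)) ⟩
      W (List.tabulate α) (List.tabulate c) ∎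
      where
      open ≡-Reasoning
      u' = α (Fin.fromℕ k)
      α' = λ i → α (Fin.inject₁ i)

Σₛ-app : ∀ {A : Set} (xs : List A) (F : A → Series) a → Σₛ xs F a ≡ R.Σ xs (λ x → F x a)
Σₛ-app [] F a = refl
Σₛ-app (x ∷ xs) F a = cong (F x a Q.+_) (Σₛ-app xs F a)

length-filterℚ : ∀ {A : Set} {P : A → Set} (p : ∀ x → Dec (P x)) xs → ℕtoℚ (length (filter p xs)) ≡ R.Σ xs (λ x → R.𝕀 (p x))
length-filterℚ p [] = refl
length-filterℚ p (x ∷ xs) with does (p x)
... | true = trans (ℕtoℚ-+ 1 (length (filter p xs))) (cong (Q.1ℚ Q.+_) (length-filterℚ p xs))
... | false = trans (length-filterℚ p xs) (sym (QP.+-identityˡ _))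

length-filterℕ : ∀ {A : Set} {P : A → Set} (p : ∀ x → Dec (P x)) xs → length (filter p xs) ≡ N.Σ xs (λ x → N.ind (does (p x)))
length-filterℕ p [] = refl
length-filterℕ p (x ∷ xs) with does (p x)
... | true = cong suc (length-filterℕ p xs)
... | false = length-filterℕ p xs

if-ind : ∀ b → (if b then Q.1ℚ else Q.0ℚ) ≡ R.ind b
if-ind true = refl
if-ind false = refl

applyUpTo-tab : ∀ N (f : ℕ → ℕ) → List.applyUpTo f N ≡ List.tabulate (λ (i : Fin N) → f (Fin.toℕ i))
applyUpTo-tab zero f = refl
applyUpTo-tab (suc N) f = cong (f 0 ∷_) (applyUpTo-tab N (λ i → f (suc i)))

Σ-upTo-δ : ∀ N c → c ℕ.< N → R.Σ (List.upTo N) (λ l → R.𝕀 (l ℕ.≟ c)) ≡ Q.1ℚ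
Σ-upTo-δ N c lt = begin
  R.Σ (List.upTo N) (λ l → R.𝕀 (l ℕ.≟ c)) ≡⟨ cong (λ xs → R.Σ xs (λ l → R.𝕀 (l ℕ.≟ c))) (applyUpTo-tab N (λ i → i)) ⟩
  R.Σ (List.tabulate (λ (i : Fin N) → Fin.toℕ i)) (λ l → R.𝕀 (l ℕ.≟ c)) ≡⟨ R.Σ-tab N Fin.toℕ (λ l → R.𝕀 (l ℕ.≟ c)) ⟩
  R.ΣF N (λ i → R.𝕀 (Fin.toℕ i ℕ.≟ c)) ≡⟨ R.ΣF-cong N (λ i → trans (R.𝕀-cong (λ e → FP.toℕ-injective (trans e (sym (FP.toℕ-fromℕ< lt)))) (λ e → trans (cong Fin.toℕ e) (FP.toℕ-fromℕ< lt)) (Fin.toℕ i ℕ.≟ c) (i Fin.≟ Fin.fromℕ< lt)) (sym (QP.*-identityʳ _))) ⟩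
  R.ΣF N (λ i → R.𝕀 (i Fin.≟ Fin.fromℕ< lt) Q.* Q.1ℚ) ≡⟨ R.ΣF-δ N (Fin.fromℕ< lt) (λ _ → Q.1ℚ) ⟩
  Q.1ℚ ∎
  where open ≡-Reasoning

product-pos : ∀ xs → All (λ x → 0 ℕ.< x) xs → 0 ℕ.< product xs
product-pos [] [] = ℕ.s≤s ℕ.z≤n
product-pos (x ∷ xs) (p ∷ ps) = NP.*-mono-≤ p (product-pos xs ps)

z-pos : ∀ α → 0 ℕ.< z α
z-pos α = product-pos _ (factors-pos (List.upTo (sum α)))
  where
  factor-pos : ∀ j → 0 ℕ.< (suc j ℕ.^ mult (suc j) α) ℕ.* (mult (suc j) α ℕ.!)
  factor-pos j = NP.*-mono-≤ (NP.m^n>0 (suc j) (mult (suc j) α)) (NP.1≤n! (mult (suc j) α))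
  factors-pos : ∀ xs → All (λ x → 0 ℕ.< x) (map (λ j → let i = suc j in (i ℕ.^ mult i α) ℕ.* ((mult i α) ℕ.!)) xs)
  factors-pos [] = []
  factors-pos (j ∷ xs) = factor-pos j ∷ factors-pos xs

inv-z : ∀ α X → inv (z α) Q.* (ℕtoℚ (z α) Q.* X) ≡ X
inv-z α X with z α | z-pos α
... | suc d | _ = trans (sym (QP.*-assoc (inv (suc d)) (ℕtoℚ (suc d)) X)) (trans (cong (Q._* X) (inv-ℕ d)) (QP.*-identityˡ X))

-- `isListOf M l γ`: γ has length l and entries below M; the vectors of
-- length l with entries below M list each such γ exactly once.
isListOf : ℕ → ℕ → List ℕ → Bool
isListOf M zero [] = true
isListOf M zero (_ ∷ _) = false
isListOf M (suc l) [] = false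
isListOf M (suc l) (g ∷ γ) = does (g ℕ.<? M) ∧ isListOf M l γ

ΣF-toℕ-δ : ∀ M g X → R.ΣF M (λ i → R.𝕀 (g ℕ.≟ Fin.toℕ i) Q.* X) ≡ R.ind (does (g ℕ.<? M)) Q.* X
ΣF-toℕ-δ zero g X = sym (QP.*-zeroˡ X)
ΣF-toℕ-δ (suc M) zero X = trans (R.ΣF-suc M (λ i → R.𝕀 (zero ℕ.≟ Fin.toℕ i) Q.* X)) (trans (cong₂ Q._+_ (QP.*-identityˡ X) (trans (R.ΣF-cong M (λ i → QP.*-zeroˡ X)) (R.Σ-0 (allFin M)))) (trans (QP.+-identityʳ X) (sym (QP.*-identityˡ X))))
ΣF-toℕ-δ (suc M) (suc g) X = trans (R.ΣF-suc M (λ i → R.𝕀 (suc g ℕ.≟ Fin.toℕ i) Q.* X)) (trans (cong (Q._+ R.ΣF M (λ i → R.𝕀 (g ℕ.≟ Fin.toℕ i) Q.* X)) (QP.*-zeroˡ X)) (trans (QP.+-identityˡ _) (ΣF-toℕ-δ M g X)))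

toList : ∀ {M l} → Vec (Fin M) l → List ℕ
toList v = Vec.toList (Vec.map Fin.toℕ v)

ΣV-toList-δ : ∀ M l γ → R.ΣV M l (λ v → R.𝕀 (LP.≡-dec ℕ._≟_ γ (toList v))) ≡ R.ind (isListOf M l γ)
ΣV-toList-δ M zero [] = refl
ΣV-toList-δ M zero (x ∷ γ) = refl
ΣV-toList-δ M (suc l) [] = trans (R.ΣV-suc M l (λ v → R.𝕀 (LP.≡-dec ℕ._≟_ [] (toList v)))) (trans (R.ΣF-cong M (λ i → R.Σ-0 (allVec M l))) (R.Σ-0 (allFin M)))
ΣV-toList-δ M (suc l) (g ∷ γ) = begin
  R.ΣV M (suc l) (λ v → R.𝕀 (LP.≡-dec ℕ._≟_ (g ∷ γ) (toList v))) ≡⟨ R.ΣV-suc M l (λ v → R.𝕀 (LP.≡-dec ℕ._≟_ (g ∷ γ) (toList v))) ⟩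
  R.ΣF M (λ i → R.ΣV M l (λ v → R.ind (does (g ℕ.≟ Fin.toℕ i) ∧ does (LP.≡-dec ℕ._≟_ γ (toList v))))) ≡⟨ R.ΣF-cong M (λ i → trans (R.ΣV-cong M l (λ v → sym (QP.*-identityʳ (R.ind (does (g ℕ.≟ Fin.toℕ i) ∧ does (LP.≡-dec ℕ._≟_ γ (toList v))))))) (trans (R.Σ-factor-ind (allVec M l) (does (g ℕ.≟ Fin.toℕ i)) (λ v → does (LP.≡-dec ℕ._≟_ γ (toList v))) (λ _ → Q.1ℚ)) (cong (R.𝕀 (g ℕ.≟ Fin.toℕ i) Q.*_) (R.ΣV-cong M l (λ v → QP.*-identityʳ (R.𝕀 (LP.≡-dec ℕ._≟_ γ (toList v)))))))) ⟩
  R.ΣF M (λ i → R.𝕀 (g ℕ.≟ Fin.toℕ i) Q.* R.ΣV M l (λ v → R.𝕀 (LP.≡-dec ℕ._≟_ γ (toList v)))) ≡⟨ ΣF-toℕ-δ M g _ ⟩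
  R.ind (does (g ℕ.<? M)) Q.* R.ΣV M l (λ v → R.𝕀 (LP.≡-dec ℕ._≟_ γ (toList v))) ≡⟨ cong (R.ind (does (g ℕ.<? M)) Q.*_) (ΣV-toList-δ M l γ) ⟩
  R.ind (does (g ℕ.<? M)) Q.* R.ind (isListOf M l γ) ≡⟨ sym (R.ind-∧ (does (g ℕ.<? M)) (isListOf M l γ)) ⟩
  R.ind (isListOf M (suc l) (g ∷ γ)) ∎
  where open ≡-Reasoning

isListOf-δ : ∀ M l γ → All (λ x → x ℕ.< M) γ → isListOf M l γ ≡ does (l ℕ.≟ length γ)
isListOf-δ M zero [] _ = refl
isListOf-δ M zero (x ∷ γ) _ = refl
isListOf-δ M (suc l) [] _ = refl
isListOf-δ M (suc l) (g ∷ γ) (p ∷ ps) rewrite dec-true (g ℕ.<? M) p = isListOf-δ M l γ ps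

-- A composition of m has parts ≤ m and at most m parts, so it is
-- enumerated exactly once by `allListsUpTo (1+m) m`.
parts-le : ∀ γ → All (λ x → x ℕ.≤ sum γ) γ
parts-le [] = []
parts-le (x ∷ γ) = NP.m≤m+n x (sum γ) ∷ All.map (λ {y} le → NP.≤-trans le (NP.m≤n+m (sum γ) x)) (parts-le γ)

length-le : ∀ γ → AllPos γ → length γ ℕ.≤ sum γ
length-le [] _ = ℕ.z≤n
length-le (x ∷ γ) (p ∷ ps) = NP.+-mono-≤ p (length-le γ ps)

count-lists : ∀ m γ → γ ⊨ m → R.Σ (allListsUpTo (suc m) m) (λ β → R.𝕀 (LP.≡-dec ℕ._≟_ γ β)) ≡ Q.1ℚ
count-lists m γ (pos , sm) = begin
  R.Σ (allListsUpTo (suc m) m) (λ β → R.𝕀 (LP.≡-dec ℕ._≟_ γ β))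
    ≡⟨ R.Σ-concatMap (λ l → map toList (allVec (suc m) l)) (List.upTo (suc m)) (λ β → R.𝕀 (LP.≡-dec ℕ._≟_ γ β)) ⟩
  R.Σ (List.upTo (suc m)) (λ l → R.Σ (map toList (allVec (suc m) l)) (λ β → R.𝕀 (LP.≡-dec ℕ._≟_ γ β)))
    ≡⟨ R.Σ-cong (List.upTo (suc m)) (λ l → trans (R.Σ-map toList (allVec (suc m) l) (λ β → R.𝕀 (LP.≡-dec ℕ._≟_ γ β))) (ΣV-toList-δ (suc m) l γ)) ⟩
  R.Σ (List.upTo (suc m)) (λ l → R.ind (isListOf (suc m) l γ)) ≡⟨ R.Σ-cong (List.upTo (suc m)) (λ l → cong R.ind (isListOf-δ (suc m) l γ entries<)) ⟩
  R.Σ (List.upTo (suc m)) (λ l → R.𝕀 (l ℕ.≟ length γ)) ≡⟨ Σ-upTo-δ (suc m) (length γ) (ℕ.s≤s (subst (length γ ℕ.≤_) sm (length-le γ pos))) ⟩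
  Q.1ℚ ∎
  where
  open ≡-Reasoning
  entries< : All (λ x → x ℕ.< suc m) γ
  entries< = All.map (λ {x} le → ℕ.s≤s (subst (x ℕ.≤_) sm le)) (parts-le γ)

Σ-compositions-δ : ∀ m γ (G : List ℕ → Q.ℚ) → R.Σ (compositions m) (λ β → R.𝕀 (LP.≡-dec ℕ._≟_ γ β) Q.* G β) ≡ R.𝕀 (γ ⊨? m) Q.* G γ
Σ-compositions-δ m γ G = begin
  R.Σ (compositions m) (λ β → R.𝕀 (LP.≡-dec ℕ._≟_ γ β) Q.* G β) ≡⟨ R.Σ-filter (λ α → α ⊨? m) (allListsUpTo (suc m) m) _ ⟩
  R.Σ lists (λ β → R.𝕀 (β ⊨? m) Q.* (R.𝕀 (LP.≡-dec ℕ._≟_ γ β) Q.* G β)) ≡⟨ R.Σ-cong lists (λ β → move-guard β (LP.≡-dec ℕ._≟_ γ β)) ⟩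
  R.Σ lists (λ β → R.𝕀 (LP.≡-dec ℕ._≟_ γ β) Q.* (R.𝕀 (γ ⊨? m) Q.* G γ)) ≡⟨ sym (R.Σ-*ʳ lists (R.𝕀 (γ ⊨? m) Q.* G γ) (λ β → R.𝕀 (LP.≡-dec ℕ._≟_ γ β))) ⟩
  R.Σ lists (λ β → R.𝕀 (LP.≡-dec ℕ._≟_ γ β)) Q.* (R.𝕀 (γ ⊨? m) Q.* G γ) ≡⟨ enumerated-once (γ ⊨? m) ⟩
  R.𝕀 (γ ⊨? m) Q.* G γ ∎
  where
  open ≡-Reasoning
  lists = allListsUpTo (suc m) m
  move-guard : ∀ β (d : Dec (γ ≡ β)) → R.𝕀 (β ⊨? m) Q.* (R.𝕀 d Q.* G β) ≡ R.𝕀 d Q.* (R.𝕀 (γ ⊨? m) Q.* G γ)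
  move-guard β (yes refl) = trans (cong (R.𝕀 (β ⊨? m) Q.*_) (QP.*-identityˡ (G β))) (sym (QP.*-identityˡ _))
  move-guard β (no _) = trans (cong (R.𝕀 (β ⊨? m) Q.*_) (QP.*-zeroˡ (G β))) (trans (QP.*-zeroʳ (R.𝕀 (β ⊨? m))) (sym (QP.*-zeroˡ (R.𝕀 (γ ⊨? m) Q.* G γ))))
  enumerated-once : (d : Dec (γ ⊨ m)) → R.Σ lists (λ β → R.𝕀 (LP.≡-dec ℕ._≟_ γ β)) Q.* (R.𝕀 d Q.* G γ) ≡ R.𝕀 d Q.* G γ
  enumerated-once (yes p) = trans (cong (Q._* (Q.1ℚ Q.* G γ)) (count-lists m γ p)) (QP.*-identityˡ _)
  enumerated-once (no _) = trans (cong (R.Σ lists (λ β → R.𝕀 (LP.≡-dec ℕ._≟_ γ β)) Q.*_) (QP.*-zeroˡ (G γ))) (trans (QP.*-zeroʳ (R.Σ lists (λ β → R.𝕀 (LP.≡-dec ℕ._≟_ γ β)))) (sym (QP.*-zeroˡ (G γ))))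

-- [x^a] Ψ_α / z_α = W(α, a): only β = nonzero parts of a contributes.
Ψ/z≡W : ∀ α a → inv (z α) Q.* Ψ α a ≡ W α a
Ψ/z≡W α a = begin
  inv (z α) Q.* (ℕtoℚ (z α) Q.* Σₛ coarsenings (λ β → inv (π2 α β) ⊙ M β) a) ≡⟨ inv-z α _ ⟩
  Σₛ coarsenings (λ β → inv (π2 α β) ⊙ M β) a ≡⟨ Σₛ-app coarsenings (λ β → inv (π2 α β) ⊙ M β) a ⟩
  R.Σ coarsenings (λ β → inv (π2 α β) Q.* M β a) ≡⟨ R.Σ-filter (λ β → α ≼? β) (compositions (sum α)) (λ β → inv (π2 α β) Q.* M β a) ⟩
  R.Σ (compositions (sum α)) (λ β → R.𝕀 (α ≼? β) Q.* (inv (π2 α β) Q.* M β a)) ≡⟨ R.Σ-cong (compositions (sum α)) monomial-test ⟩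
  R.Σ (compositions (sum α)) (λ β → R.𝕀 (LP.≡-dec ℕ._≟_ (nonzeroParts a) β) Q.* (R.𝕀 (α ≼? β) Q.* inv (π2 α β))) ≡⟨ Σ-compositions-δ (sum α) (nonzeroParts a) (λ β → R.𝕀 (α ≼? β) Q.* inv (π2 α β)) ⟩
  W α a ∎
  where
  open ≡-Reasoning
  coarsenings = filter (λ β → α ≼? β) (compositions (sum α))
  monomial-test : ∀ β → R.𝕀 (α ≼? β) Q.* (inv (π2 α β) Q.* M β a) ≡ R.𝕀 (LP.≡-dec ℕ._≟_ (nonzeroParts a) β) Q.* (R.𝕀 (α ≼? β) Q.* inv (π2 α β))
  monomial-test β = begin
    R.𝕀 (α ≼? β) Q.* (inv (π2 α β) Q.* M β a) ≡⟨ sym (QP.*-assoc (R.𝕀 (α ≼? β)) (inv (π2 α β)) (M β a)) ⟩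
    (R.𝕀 (α ≼? β) Q.* inv (π2 α β)) Q.* M β a ≡⟨ QP.*-comm _ (M β a) ⟩
    M β a Q.* (R.𝕀 (α ≼? β) Q.* inv (π2 α β)) ≡⟨ cong (Q._* (R.𝕀 (α ≼? β) Q.* inv (π2 α β))) (trans (if-ind (⌊ LP.≡-dec ℕ._≟_ (nonzeroParts a) β ⌋)) (cong R.ind (isYes≗does (LP.≡-dec ℕ._≟_ (nonzeroParts a) β)))) ⟩
    R.𝕀 (LP.≡-dec ℕ._≟_ (nonzeroParts a) β) Q.* (R.𝕀 (α ≼? β) Q.* inv (π2 α β)) ∎

sum-map : ∀ {A : Set} (h : A → ℕ) xs → sum (map h xs) ≡ N.Σ xs h
sum-map h [] = refl
sum-map h (x ∷ xs) = cong (h x ℕ.+_) (sum-map h xs)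

ΣF-1 : ∀ n → N.ΣF n (λ _ → 1) ≡ n
ΣF-1 zero = refl
ΣF-1 (suc n) = trans (N.ΣF-suc n (λ _ → 1)) (cong suc (ΣF-1 n))

-- Specialisation to X = P and translation between the definitions of the
-- statement (K_P, 𝒪*(P), type) and the labellings above (shift labels by one).
module Final {n : ℕ} (P : FinPoset n) where
  open FinPoset P
  open Core P
  open WeightLists P
  open R using (avoids)

  whole : Fin n → Bool
  whole _ = true

  n<1+|P| : count whole ℕ.< suc n
  n<1+|P| = ℕ.s≤s (NP.≤-reflexive (ΣF-1 n))

  countFin≡count : ∀ {Qp : Fin n → Set} (Q? : ∀ x → Dec (Qp x)) → countFin Q? ≡ count (λ y → does (Q? y))
  countFin≡count Q? = length-filterℕ Q? (allFin n)

  lookup-map-suc : ∀ {k} (f : Vec (Fin k) n) y → Vec.map Fin.suc f ! y ≡ suc (f ! y)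
  lookup-map-suc f y = VP.lookup-map y Fin.suc f

  fibre-map-suc : ∀ {k} (f : Vec (Fin k) n) i y → fibre (Vec.map Fin.suc f) (suc i) y ≡ does (f ! y Fin.≟ i)
  fibre-map-suc f i y = cong (λ t → does (t Fin.≟ suc i)) (lookup-map-suc f y)

  fibreSize≡count : ∀ {k} (f : Vec (Fin k) n) i → count (fibre (Vec.map Fin.suc f) (suc i)) ≡ fiberSize P f i
  fibreSize≡count f i = trans (count-cong (fibre-map-suc f i)) (sym (countFin≡count (λ x → lookup f x Fin.≟ i)))

  ≤suc : ∀ {k} {a b : Fin k} → suc a Fin.≤ suc b → a Fin.≤ b
  ≤suc (ℕ.s≤s le) = le

  IsMin⇔MinimalInFiber : ∀ {k} (f : Vec (Fin k) n) i m → does (MinimalInFiber? P f i m) ≡ does (IsMin? (fibre (Vec.map Fin.suc f) (suc i)) m)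
  IsMin⇔MinimalInFiber f i m = does-cong to from (MinimalInFiber? P f i m) (IsMin? (fibre (Vec.map Fin.suc f) (suc i)) m)
    where
    c1 : ∀ y → f ! y ≡ i → fibre (Vec.map Fin.suc f) (suc i) y ≡ true
    c1 y e = trans (fibre-map-suc f i y) (dec-true (f ! y Fin.≟ i) e)
    c2 : ∀ y → fibre (Vec.map Fin.suc f) (suc i) y ≡ true → f ! y ≡ i
    c2 y t = does-yes (f ! y Fin.≟ i) (trans (sym (fibre-map-suc f i y)) t)
    to : MinimalInFiber P f i m → IsMin (fibre (Vec.map Fin.suc f) (suc i)) m
    to (e , h) = c1 m e , (λ y t → h y (c2 y t))
    from : IsMin (fibre (Vec.map Fin.suc f) (suc i)) m → MinimalInFiber P f i m
    from (t , h) = c2 m t , (λ y e → h y (c1 y e))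

  IsOStarOn⇒IsOStar : ∀ {k} (f : Vec (Fin k) n) → IsOStarOn whole (Vec.map Fin.suc f) → IsOStar P f
  IsOStarOn⇒IsOStar f (oo , mo , su , um) =
      (λ x y le → ≤suc (subst₂ Fin._≤_ (lookup-map-suc f x) (lookup-map-suc f y) (mo x y refl refl le))) ,
      (λ i → proj₁ (su i) , FP.suc-injective (trans (sym (lookup-map-suc f (proj₁ (su i)))) (proj₂ (su i)))) ,
      (λ i → trans (countFin≡count (MinimalInFiber? P f i)) (trans (count-cong (IsMin⇔MinimalInFiber f i)) (um i)))

  IsOStar⇒IsOStarOn : ∀ {k} (f : Vec (Fin k) n) → IsOStar P f → IsOStarOn whole (Vec.map Fin.suc f)
  IsOStar⇒IsOStarOn f (op , sj , umf) =
      (λ y → sym (cong isSuc (lookup-map-suc f y))) ,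
      (λ y z _ _ le → subst₂ Fin._≤_ (sym (lookup-map-suc f y)) (sym (lookup-map-suc f z)) (ℕ.s≤s (op y z le))) ,
      (λ i → proj₁ (sj i) , trans (lookup-map-suc f (proj₁ (sj i))) (cong suc (proj₂ (sj i)))) ,
      (λ i → trans (sym (count-cong (IsMin⇔MinimalInFiber f i))) (trans (sym (countFin≡count (MinimalInFiber? P f i))) (umf i)))

  IsPPart⇔ : ∀ (a : Monomial) (f : Vec (Fin (length a)) n) → R.𝕀 (IsPPart? whole (List.lookup a) (Vec.map Fin.suc f)) ≡ R.𝕀 (IsPPartition? P f ×-dec HasContent? P a f)
  IsPPart⇔ a f = R.𝕀-cong to from (IsPPart? whole (List.lookup a) (Vec.map Fin.suc f)) (IsPPartition? P f ×-dec HasContent? P a f)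
    where
    g : Vec (Fin (suc (length a))) n
    g = Vec.map Fin.suc f
    to : IsPPart whole (List.lookup a) g → IsPPartition P f × HasContent P a f
    to (oo , mo , ct) = (λ x y lt → ≤suc (subst₂ Fin._≤_ (lookup-map-suc f x) (lookup-map-suc f y) (mo x y refl refl (proj₁ lt)))) ,
                        (λ i → trans (sym (fibreSize≡count f i)) (ct i))
    from : IsPPartition P f × HasContent P a f → IsPPart whole (List.lookup a) g
    from (pp , hc) = (λ y → sym (cong isSuc (lookup-map-suc f y))) ,
                     (λ y z _ _ le → subst₂ Fin._≤_ (sym (lookup-map-suc f y)) (sym (lookup-map-suc f z)) (ℕ.s≤s (mono y z le))) ,
                     (λ i → trans (fibreSize≡count f i) (hc i))
      where
      mono : ∀ y z → y ≤P z → f ! y Fin.≤ f ! z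
      mono y z le with y Fin.≟ z
      ... | yes refl = FP.≤-refl
      ... | no ne = pp y z (le , ne)

  whole-avoids-zero : ∀ {K} (g : Vec (Fin (suc K)) n) → Support whole g → avoids zero g ≡ true
  whole-avoids-zero g oo = avoids-intro zero g (λ y e → true≢false (trans (oo y) (cong isSuc e)))

  𝕀-avoids-zero : ∀ {A : Set} {K} (d : Dec A) (g : Vec (Fin (suc K)) n) x → (A → Support whole g) → R.𝕀 d Q.* x ≡ R.ind (avoids zero g) Q.* (R.𝕀 d Q.* x)
  𝕀-avoids-zero d g x h = trans (cong (Q._* x) (R.𝕀-guard d (avoids zero g) (λ a → whole-avoids-zero g (h a)))) (QP.*-assoc (R.ind (avoids zero g)) (R.𝕀 d) x)

  K≡ppCount : ∀ a → K P a ≡ ppCount whole (length a) (List.lookup a)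
  K≡ppCount a = begin
    K P a ≡⟨ length-filterℚ (λ f → IsPPartition? P f ×-dec HasContent? P a f) (allVec L n) ⟩
    R.ΣV L n (λ f → R.𝕀 (IsPPartition? P f ×-dec HasContent? P a f)) ≡⟨ R.ΣV-cong L n (λ f → sym (IsPPart⇔ a f)) ⟩
    R.ΣV L n (λ f → R.𝕀 (IsPPart? whole cf (Vec.map Fin.suc f))) ≡⟨ sym (R.ΣV-avoiding L n zero Fin.suc (R.ΣF-avoid-zero L) (λ g → R.𝕀 (IsPPart? whole cf g))) ⟩
    R.ΣV (suc L) n (λ g → R.ind (avoids zero g) Q.* R.𝕀 (IsPPart? whole cf g)) ≡⟨ R.ΣV-cong (suc L) n (λ g → sym (R.𝕀-guard (IsPPart? whole cf g) (avoids zero g) (λ v → whole-avoids-zero g (proj₁ v)))) ⟩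
    ppCount whole L cf ∎
    where
    open ≡-Reasoning
    L = length a
    cf = List.lookup a

  Σ-OStar : ∀ (Φ : (Σ[ k ∈ ℕ ] Vec (Fin k) n) → Q.ℚ) → R.Σ (OStar P) Φ ≡ R.Σ (List.upTo (suc n)) (λ k → R.ΣV k n (λ f → R.𝕀 (IsOStar? P f) Q.* Φ (k , f)))
  Σ-OStar Φ = trans (R.Σ-concatMap (λ k → map (k ,_) (filter (IsOStar? P) (allVec k n))) (List.upTo (suc n)) Φ) (R.Σ-cong (List.upTo (suc n)) (λ k →
      trans (R.Σ-map (k ,_) (filter (IsOStar? P) (allVec k n)) Φ) (R.Σ-filter (IsOStar? P) (allVec k n) (λ f → Φ (k , f)))))

  tabulate-blockSizes : ∀ {k} (f : Vec (Fin k) n) → List.tabulate (blockSizes (Vec.map Fin.suc f)) ≡ type P (k , f)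
  tabulate-blockSizes {k} f = trans (LP.tabulate-cong (fibreSize≡count f)) (sym (LP.map-tabulate (λ i → i) (fiberSize P f)))

  oWeightUpTo≡ΣW : ∀ a → oWeightUpTo whole (suc n) (length a) (List.lookup a) ≡ R.Σ (OStar P) (λ kf → W (type P kf) a)
  oWeightUpTo≡ΣW a = trans (R.Σ-cong (List.upTo (suc n)) by-blocks) (sym (Σ-OStar (λ kf → W (type P kf) a)))
    where
    L = length a
    cf = List.lookup a
    by-blocks : ∀ k → oWeight whole k L cf ≡ R.ΣV k n (λ f → R.𝕀 (IsOStar? P f) Q.* W (type P (k , f)) a)
    by-blocks k = begin
      R.ΣV (suc k) n (λ g → R.𝕀 (IsOStarOn? whole g) Q.* weight k (blockSizes g) L cf)
        ≡⟨ R.ΣV-cong (suc k) n (λ g → 𝕀-avoids-zero (IsOStarOn? whole g) g (weight k (blockSizes g) L cf) proj₁) ⟩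
      R.ΣV (suc k) n (λ g → R.ind (avoids zero g) Q.* (R.𝕀 (IsOStarOn? whole g) Q.* weight k (blockSizes g) L cf))
        ≡⟨ R.ΣV-avoiding k n zero Fin.suc (R.ΣF-avoid-zero k) (λ g → R.𝕀 (IsOStarOn? whole g) Q.* weight k (blockSizes g) L cf) ⟩
      R.ΣV k n (λ f → R.𝕀 (IsOStarOn? whole (Vec.map Fin.suc f)) Q.* weight k (blockSizes (Vec.map Fin.suc f)) L cf)
        ≡⟨ R.ΣV-cong k n (λ f → R.condEq (IsOStarOn? whole (Vec.map Fin.suc f)) (IsOStar? P f) _ _ (IsOStarOn⇒IsOStar f) (IsOStar⇒IsOStarOn f) (weight-of-type f)) ⟩
      R.ΣV k n (λ f → R.𝕀 (IsOStar? P f) Q.* W (type P (k , f)) a) ∎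
      where
      open ≡-Reasoning
      weight-of-type : ∀ f → IsOStarOn whole (Vec.map Fin.suc f) → weight k (blockSizes (Vec.map Fin.suc f)) L cf ≡ W (type P (k , f)) a
      weight-of-type f (oo , mo , su , um) = trans (weight≡W k (blockSizes (Vec.map Fin.suc f)) L cf (λ i → fibre-count-pos (Vec.map Fin.suc f) (proj₁ (su i)) (suc i) (proj₂ (su i))))
                                        (cong₂ W (tabulate-blockSizes f) (LP.tabulate-lookup a))

  type-composition : ∀ {k} (f : Vec (Fin k) n) → IsOStar P f → type P (k , f) ⊨ n
  type-composition {k} f (op , sj , umf) = pos , sm
    where
    pos : AllPos (type P (k , f))
    pos = subst AllPos (sym (LP.map-tabulate (λ i → i) (fiberSize P f)))
            (AllPos-tabulate k (fiberSize P f) (λ i → subst (0 ℕ.<_) (sym (countFin≡count (λ x → lookup f x Fin.≟ i))) (count-pos {p = λ y → does (lookup f y Fin.≟ i)} (proj₁ (sj i)) (dec-true (lookup f (proj₁ (sj i)) Fin.≟ i) (proj₂ (sj i))))))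
    sm : sum (type P (k , f)) ≡ n
    sm = begin
      sum (map (fiberSize P f) (allFin k)) ≡⟨ sum-map (fiberSize P f) (allFin k) ⟩
      N.ΣF k (fiberSize P f) ≡⟨ N.ΣF-cong k (λ i → countFin≡count (λ x → lookup f x Fin.≟ i)) ⟩
      N.ΣF k (λ i → N.ΣF n (λ y → N.ind (does (f ! y Fin.≟ i)))) ≡⟨ N.Σ-swap (allFin k) (allFin n) (λ i y → N.ind (does (f ! y Fin.≟ i))) ⟩
      N.ΣF n (λ y → N.ΣF k (λ i → N.ind (does (f ! y Fin.≟ i)))) ≡⟨ N.ΣF-cong n (λ y → trans (N.ΣF-cong k (λ i → sym (NP.*-identityʳ _))) (N.ΣF-δ' k (f ! y) (λ _ → 1))) ⟩
      N.ΣF n (λ _ → 1) ≡⟨ ΣF-1 n ⟩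
      n ∎
      where open ≡-Reasoning

  OStar-side : ∀ a → Σₛ (OStar P) (λ f → inv (z (type P f)) ⊙ Ψ (type P f)) a ≡ R.Σ (OStar P) (λ f → W (type P f) a)
  OStar-side a = trans (Σₛ-app (OStar P) (λ f → inv (z (type P f)) ⊙ Ψ (type P f)) a) (R.Σ-cong (OStar P) (λ f → Ψ/z≡W (type P f) a))

  composition-term : ∀ a α → (inv (z α) Q.* ℕtoℚ (OStarCount P α)) Q.* Ψ α a ≡
    R.Σ (OStar P) (λ f → R.𝕀 (LP.≡-dec ℕ._≟_ (type P f) α) Q.* W α a)
  composition-term a α = begin
    (inv (z α) Q.* ℕtoℚ (OStarCount P α)) Q.* Ψ α a ≡⟨ cong (Q._* Ψ α a) (QP.*-comm (inv (z α)) (ℕtoℚ (OStarCount P α))) ⟩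
    (ℕtoℚ (OStarCount P α) Q.* inv (z α)) Q.* Ψ α a ≡⟨ QP.*-assoc (ℕtoℚ (OStarCount P α)) (inv (z α)) (Ψ α a) ⟩
    ℕtoℚ (OStarCount P α) Q.* (inv (z α) Q.* Ψ α a) ≡⟨ cong₂ Q._*_ (length-filterℚ (λ f → LP.≡-dec ℕ._≟_ (type P f) α) (OStar P)) (Ψ/z≡W α a) ⟩
    R.Σ (OStar P) (λ f → R.𝕀 (LP.≡-dec ℕ._≟_ (type P f) α)) Q.* W α a ≡⟨ R.Σ-*ʳ (OStar P) (W α a) (λ f → R.𝕀 (LP.≡-dec ℕ._≟_ (type P f) α)) ⟩
    R.Σ (OStar P) (λ f → R.𝕀 (LP.≡-dec ℕ._≟_ (type P f) α) Q.* W α a) ∎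
    where open ≡-Reasoning

  -- Grouping 𝒪*(P) by type: since every type is a composition of n, the
  -- second right-hand side has the same coefficients as the first.
  composition-side : ∀ a → Σₛ (compositions n) (λ α → (inv (z α) Q.* ℕtoℚ (OStarCount P α)) ⊙ Ψ α) a ≡
    R.Σ (OStar P) (λ f → W (type P f) a)
  composition-side a = begin
    Σₛ (compositions n) (λ α → (inv (z α) Q.* ℕtoℚ (OStarCount P α)) ⊙ Ψ α) a
      ≡⟨ Σₛ-app (compositions n) (λ α → (inv (z α) Q.* ℕtoℚ (OStarCount P α)) ⊙ Ψ α) a ⟩
    R.Σ (compositions n) (λ α → (inv (z α) Q.* ℕtoℚ (OStarCount P α)) Q.* Ψ α a) ≡⟨ R.Σ-cong (compositions n) (composition-term a) ⟩
    R.Σ (compositions n) (λ α → R.Σ (OStar P) (λ f → R.𝕀 (LP.≡-dec ℕ._≟_ (type P f) α) Q.* W α a))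
      ≡⟨ R.Σ-swap (compositions n) (OStar P) (λ α f → R.𝕀 (LP.≡-dec ℕ._≟_ (type P f) α) Q.* W α a) ⟩
    R.Σ (OStar P) (λ f → R.Σ (compositions n) (λ α → R.𝕀 (LP.≡-dec ℕ._≟_ (type P f) α) Q.* W α a))
      ≡⟨ R.Σ-cong (OStar P) (λ f → Σ-compositions-δ n (type P f) (λ α → W α a)) ⟩
    R.Σ (OStar P) (λ f → R.𝕀 (type P f ⊨? n) Q.* W (type P f) a) ≡⟨ Σ-OStar _ ⟩
    R.Σ (List.upTo (suc n)) (λ k → R.ΣV k n (λ f → R.𝕀 (IsOStar? P f) Q.* (R.𝕀 (type P (k , f) ⊨? n) Q.* W (type P (k , f)) a)))
      ≡⟨ R.Σ-cong (List.upTo (suc n)) (λ k → R.ΣV-cong k n (λ f → R.𝕀-implied (IsOStar? P f) (type P (k , f) ⊨? n) (W (type P (k , f)) a) (type-composition f))) ⟩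
    R.Σ (List.upTo (suc n)) (λ k → R.ΣV k n (λ f → R.𝕀 (IsOStar? P f) Q.* W (type P (k , f)) a)) ≡⟨ sym (Σ-OStar (λ f → W (type P f) a)) ⟩
    R.Σ (OStar P) (λ f → W (type P f) a) ∎
    where open ≡-Reasoning

theorem5p3 : (n : ℕ) (P : FinPoset n) →
    (K P ≈ₛ Σₛ (OStar P) (λ f → inv (z (type P f)) ⊙ Ψ (type P f)))
    × (K P ≈ₛ Σₛ (compositions n) (λ α → (inv (z α) Q.* ℕtoℚ (OStarCount P α)) ⊙ Ψ α))
theorem5p3 n P = OStar-form , (λ a → trans (OStar-form a) (trans (OStar-side a) (sym (composition-side a))))
  where
  open Core P using (ppCount; oWeightUpTo; ppCount≡oWeightUpTo)
  open Final P
  open ≡-Reasoning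
  OStar-form : K P ≈ₛ Σₛ (OStar P) (λ f → inv (z (type P f)) ⊙ Ψ (type P f))
  OStar-form a = begin
    K P a                                              ≡⟨ K≡ppCount a ⟩
    ppCount whole (length a) (List.lookup a)           ≡⟨ ppCount≡oWeightUpTo (suc n) whole n<1+|P| (length a) (List.lookup a) ⟩
    oWeightUpTo whole (suc n) (length a) (List.lookup a) ≡⟨ oWeightUpTo≡ΣW a ⟩
    R.Σ (OStar P) (λ f → W (type P f) a)               ≡⟨ sym (OStar-side a) ⟩
    Σₛ (OStar P) (λ f → inv (z (type P f)) ⊙ Ψ (type P f)) a ∎
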